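{- Fix $t\ge2$, put $N=t+2$, and for a partition $\lambda$ with at most $N$ parts let $\Phi_t(\lambda;z)=s_\lambda(1,\zeta,\dots,\zeta^{t-1},z,z^{ -1})$, $\zeta=e^{2\pi i/t}$. Let $\lambda,\mu$ be partitions with at most $N$ parts and suppose $\Phi_t(\lambda;z)\not\equiv0$. Then $\Phi_t(\lambda;z)=\Phi_t(\mu;z)$ (as Laurent polynomials in $z$) if and only if the triple and sign of $\mu$ are defined, $\{d_1,d_2,d_3\}(\lambda)=\{d_1,d_2,d_3\}(\mu)$ as multisets, and $\varepsilon_\lambda=\varepsilon_\mu$.
   Context: For $\lambda=(\lambda_1\ge\dots\ge\lambda_N\ge0)$ let $\beta_j=\lambda_j+N-j$ ($1\le j\le N$; $j$ is the column of $\beta_j$), $\beta(\lambda)=\{\beta_1>\dots>\beta_N\}$, and let $n_i$ be the number of $\beta_j\equiv i\pmod t$. Since $\sum_i n_i=t+2$, if no class is empty then either exactly two classes have size $2$ (others $1$) or exactly one has size $3$ (others $1$). In the first case let $r_A<r_B$ be the two residues and $A=\{a_1>a_2\}$, $B=\{b_1>b_2\}$ the elements of $\beta(\lambda)$ in classes $r_A,r_B$; in the second case, with class $\{p>q>r\}$, let $A=\{a_1>a_2\}=\{p,q\}$, $B=\{b_1>b_2\}=\{q,r\}$. Put $d_1=a_1-a_2$, $d_2=b_1-b_2$, $\tilde d_3=a_1+a_2-b_1-b_2$, $d_3=|\tilde d_3|$. When no class is empty and $\tilde d_3\ne0$ (which is equivalent to $\Phi_t(\lambda;z)\not\equiv 0$),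 the sign is $\varepsilon_\lambda=(-1)^{t+\binom{N+1}{2}}(-1)^{j_{A_1}+j_{B_1}+\operatorname{inv}(b_S)}\operatorname{sgn}(a_1-b_1)\operatorname{sgn}(\tilde d_3)$, where $j_{A_1},j_{B_1}$ are the columns of $a_1,b_1$, $S=\{1,\dots,N\}\setminus\{j_{A_1},j_{B_1}\}$, $b_S$ is the word of residues $\beta_j\bmod t\in\{0,\dots,t-1\}$ for $j\in S$ in increasing order of $j$, and $\operatorname{inv}$ counts inversions. The triple and sign are called defined when no class is empty and $\tilde d_3\neq0$. -}

module Defs where

open import Level using (Level; _⊔_)
open import Algebra.Bundles using (RawSemiring; Semiring; CommutativeRing)
open import Algebra.Apartness.Bundles using (HeytingField; HeytingCommutativeRing)
import Algebra.Definitions.RawSemiring as RawSemiringDefinitions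
open import Data.Bool.Base using (if_then_else_)
open import Data.Fin.Base using (Fin; toℕ)
import Data.Fin.Properties as Fin
open import Data.Integer.Base as ℤ using (ℤ; +_; -[1+_]; +[1+_]; 0ℤ; 1ℤ; -1ℤ; _⊖_; ∣_∣)
import Data.Integer.Properties as ℤ
open import Data.List.Base as List using (List; []; _∷_; [_]; _++_; applyUpTo; cartesianProductWith; concatMap; filter; length; allFin)
open import Data.Nat.Base using (ℕ; zero; suc; _+_; _*_; _∸_; _≤_; _<_; _≥_; NonZero)
open import Data.Nat.Combinatorics using (_C_)
open import Data.Nat.DivMod using (_%_)
import Data.Nat.Properties as ℕ
open import Data.Product.Base using (_×_; _,_)
open import Data.Vec.Base as Vec using (Vec; []; _∷_)
open import Data.Vec.Relation.Unary.Linked using (Linked)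
open import Relation.Binary.PropositionalEquality.Core using (_≡_; _≢_)
open import Relation.Nullary.Decidable.Core using (¬?; ⌊_⌋; _×-dec_)

private
  variable
    c ℓ ℓ₁ ℓ₂ : Level
    n : ℕ

-- A partition with at most n parts, padded with zeros to length n.
record Partition (n : ℕ) : Set where
  field
    parts      : Vec ℕ n
    decreasing : Linked _≥_ parts

-- Schur polynomials.  A semistandard tableau of shape κ with letters from an
-- ordered n-letter alphabet is a chain of partitions from ∅ to κ in which each
-- step (the cells containing one given letter) is a horizontal strip.

-- All ν = (ν₁,…,νₙ) with κ₁ ≥ ν₁ ≥ κ₂ ≥ ν₂ ≥ … ≥ νₙ ≥ κₙ₊₁, that is, those for
-- which κ / ν is a horizontal strip and ν has at most n parts.
interlacing : Vec ℕ (suc n) → List (Vec ℕ n)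
interlacing (_ ∷ [])    = [ [] ]
interlacing (a ∷ b ∷ κ) =
  cartesianProductWith _∷_ (applyUpTo (λ i → b + i) (suc a ∸ b)) (interlacing (b ∷ κ))

-- The contents (number of occurrences of each letter), with repetition, of the
-- semistandard tableaux of shape κ.  The head of a content counts the
-- largest letter, whose cells form the outermost strip κ / ν.
contents : Vec ℕ n → List (Vec ℕ n)
contents []        = [ [] ]
contents κ@(_ ∷ _) =
  concatMap (λ ν → List.map ((Vec.sum κ ∸ Vec.sum ν) ∷_) (contents ν)) (interlacing κ)

module _ (S : RawSemiring c ℓ) where
  open RawSemiring S using (Carrier; 0#; 1#) renaming (_+_ to _⊕_; _*_ to _⊛_)
  open RawSemiringDefinitions S using (_^_)

  monomial : Vec Carrier n → Vec ℕ n → Carrier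
  monomial x e = Vec.foldr _ _⊛_ 1# (Vec.zipWith _^_ x e)

  -- s_κ(x) = Σ_T x^T
  schur : Partition n → Vec Carrier n → Carrier
  schur κ x = List.foldr _⊕_ 0# (List.map (monomial x) (contents (Partition.parts κ)))

-- Laurent polynomials over R in one variable z: a list of terms (i , a) stands
-- for Σ a zⁱ, exponents may repeat, and equality is equality of all coefficients.
module Laurent (R : CommutativeRing c ℓ) where
  open CommutativeRing R using (Carrier; _≈_; 0#; 1#) renaming (_+_ to _⊕_; _*_ to _⊛_)

  LaurentPoly : Set c
  LaurentPoly = List (ℤ × Carrier)

  coeff : LaurentPoly → ℤ → Carrier
  coeff []            k = 0#
  coeff ((i , a) ∷ p) k = (if ⌊ i ℤ.≟ k ⌋ then a else 0#) ⊕ coeff p k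

  infix 4 _≈ᴸ_
  _≈ᴸ_ : LaurentPoly → LaurentPoly → Set ℓ
  p ≈ᴸ q = ∀ k → coeff p k ≈ coeff q k

  0ᴸ : LaurentPoly
  0ᴸ = []

  const : Carrier → LaurentPoly
  const a = [ 0ℤ , a ]

  z z⁻¹ : LaurentPoly
  z   = [ 1ℤ , 1# ]
  z⁻¹ = [ -1ℤ , 1# ]

  _*ᴸ_ : LaurentPoly → LaurentPoly → LaurentPoly
  _*ᴸ_ = cartesianProductWith λ { (i , a) (j , b) → i ℤ.+ j , a ⊛ b }

  laurentRawSemiring : RawSemiring c ℓ
  laurentRawSemiring = record
    { Carrier = LaurentPoly
    ; _≈_     = _≈ᴸ_
    ; _+_     = _++_
    ; _*_     = _*ᴸ_
    ; 0#      = 0ᴸ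
    ; 1#      = const 1#
    }

module _ (K : HeytingField c ℓ₁ ℓ₂) where
  open HeytingField K using (Carrier; _≈_; _#_; 0#; 1#)

  fieldRing : CommutativeRing c ℓ₁
  fieldRing = HeytingCommutativeRing.commutativeRing (HeytingField.heytingCommutativeRing K)

  open RawSemiringDefinitions (Semiring.rawSemiring (CommutativeRing.semiring fieldRing))
    using (_^_) renaming (_×_ to _·_)

  CharacteristicZero : Set ℓ₂
  CharacteristicZero = ∀ m → (suc m · 1#) # 0#

  record IsPrimitiveRoot (t : ℕ) (ζ : Carrier) : Set (ℓ₁ ⊔ ℓ₂) where
    field
      ζ^t≈1  : ζ ^ t ≈ 1#
      ζ^k#1  : ∀ k → 1 ≤ k → k < t → (ζ ^ k) # 1#

  -- Φ_t(κ; z) = s_κ(1, ζ, …, ζ^{t-1}, z, z⁻¹)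
  Φ : (t : ℕ) → Carrier → Partition (t + 2) → Laurent.LaurentPoly fieldRing
  Φ t ζ κ = schur laurentRawSemiring κ
    (Vec.tabulate {n = t} (λ i → const (ζ ^ toℕ i)) Vec.++ (z ∷ z⁻¹ ∷ []))
    where open Laurent fieldRing

sgn : ℤ → ℤ
sgn +[1+ _ ] = 1ℤ
sgn (+ 0)    = 0ℤ
sgn -[1+ _ ] = -1ℤ

inversions : List ℕ → ℕ
inversions []       = 0
inversions (x ∷ xs) = length (filter (ℕ._<? x) xs) + inversions xs

module Beta (t : ℕ) .{{_ : NonZero t}} (κ : Partition (t + 2)) where

  N : ℕ
  N = t + 2

  -- Columns are elements of Fin N, so the column written j in 1,…,N is
  -- column j′ with suc (toℕ j′) = j.
  column : Fin N → ℕ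
  column j = suc (toℕ j)

  β : Fin N → ℕ
  β j = Vec.lookup (Partition.parts κ) j + (N ∸ column j)

  -- The columns j with β j ≡ r (mod t), in increasing order; since β is strictly
  -- decreasing, the elements of the class are thus listed in decreasing order.
  residueClass : Fin t → List (Fin N)
  residueClass r = filter (λ j → β j % t ℕ.≟ toℕ r) (allFin N)

  -- Arrangement a₁ a₂ b₁ b₂: the columns of A = {a₁ > a₂} and B = {b₁ > b₂}.
  data Arrangement : (a₁ a₂ b₁ b₂ : Fin N) → Set where
    twoPairs : ∀ {a₁ a₂ b₁ b₂} (rA rB : Fin t) → toℕ rA < toℕ rB →
               residueClass rA ≡ a₁ ∷ a₂ ∷ [] →
               residueClass rB ≡ b₁ ∷ b₂ ∷ [] →
               Arrangement a₁ a₂ b₁ b₂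
    oneTriple : ∀ {p q s} (r : Fin t) →
                residueClass r ≡ p ∷ q ∷ s ∷ [] →
                Arrangement p q q s

  d̃₃ : (a₁ a₂ b₁ b₂ : Fin N) → ℤ
  d̃₃ a₁ a₂ b₁ b₂ = (β a₁ + β a₂) ⊖ (β b₁ + β b₂)

  -- b_S, where S omits the columns of a₁ and b₁.
  wordS : (a₁ b₁ : Fin N) → List ℕ
  wordS a₁ b₁ = List.map (λ j → β j % t)
    (filter (λ j → ¬? (j Fin.≟ a₁) ×-dec ¬? (j Fin.≟ b₁)) (allFin N))

-- The triple and sign of κ are defined.  All the fields are determined by κ.
record Defined (t : ℕ) .{{_ : NonZero t}} (κ : Partition (t + 2)) : Set where
  open Beta t κ
  field
    noEmptyClass : ∀ r → residueClass r ≢ []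
    a₁ a₂ b₁ b₂  : Fin N
    arrangement  : Arrangement a₁ a₂ b₁ b₂
    d̃₃≢0         : d̃₃ a₁ a₂ b₁ b₂ ≢ 0ℤ

  d₁ d₂ d₃ : ℕ
  d₁ = β a₁ ∸ β a₂
  d₂ = β b₁ ∸ β b₂
  d₃ = ∣ d̃₃ a₁ a₂ b₁ b₂ ∣

  triple : List ℕ
  triple = d₁ ∷ d₂ ∷ d₃ ∷ []

  ε : ℤ
  ε = -1ℤ ℤ.^ (t + suc N C 2)
      ℤ.* -1ℤ ℤ.^ (column a₁ + column b₁ + inversions (wordS a₁ b₁))
      ℤ.* sgn (β a₁ ⊖ β b₁)
      ℤ.* sgn (d̃₃ a₁ a₂ b₁ b₂)

{-# OPTIONS --safe #-}
-- By the bialternant formula, the Vandermonde determinant of x = (1, ζ, …, ζᵗ⁻¹, z, z⁻¹) times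
-- s_κ(x) is det(x_i^β_j).  The column of β_j is u_r + z^β_j e + z^-β_j e′, where r = β_j mod t, the
-- vector u_r depends on r only, and e, e′ are the unit vectors of the rows z and z⁻¹.  If a residue
-- class is empty, three successive differences of columns of equal residue lie in the span of e and
-- e′, so the determinant vanishes.  Otherwise the differences a₁ - a₂ and b₁ - b₂ turn it into
--   ± [(z^a₁ - z^a₂)(z^-b₁ - z^-b₂) - (z^-a₁ - z^-a₂)(z^b₁ - z^b₂)] · det(e, e′, u₀, …, u_{t-1}),
-- whose last factor is a constant independent of κ.  With 2M = d₁ + d₂ + d₃ and φ(m) = zᵐ - z⁻ᵐ the
-- bracket is - sgn(d̃₃) (φ(M) - φ(M - d₁) - φ(M - d₂) - φ(M - d₃)), and it vanishes when d̃₃ = 0.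
-- So, up to a common factor, s_κ(x) is ε times a polynomial in which zᴹ is the top term, and since
-- (M - d_i) + (M - d_j) > 0 for i ≠ j no two of the three last terms cancel: M, ε and then the
-- multiset of the M - d_i can be read off.
module Submission where

open import Algebra.Bundles using (CommutativeRing; Semiring)
open import Algebra.Apartness.Bundles using (HeytingField)
open import Data.Nat.Base using (ℕ; NonZero)
open import Defs using (CharacteristicZero; IsPrimitiveRoot)

-- The constant determinant in the last factor is never evaluated. That it is nonzero follows from
-- the hypothesis on λ: were it 0, every coefficient would be 0. Being the same for all partitions,
-- it is then nonzero for μ as well. In a Heyting field an element that is merely not 0 need not be
-- invertible, and equality of coefficients need not be decidable. Hence every decision is made in
-- ℤ: each coefficient of the product with the Vandermonde determinant is the common constant times
-- an integer, and characteristic 0 turns nonzero integers into units, which is enough to compare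
-- the integers. For the same reason the Vandermonde determinant is removed factor by factor: each
-- factor is an invertible constant or a binomial with invertible top coefficient, hence not a zero
-- divisor. One of the M - d_i can be 0, and then φ(M - d_i) leaves no trace; it is recovered from
-- the sum of the M - d_i, which is M. A residue class of three elements is treated together with
-- two classes of two: the differences are taken in an order that allows a₂ = b₁.

-- The image of ℤ in a commutative ring.

module IntegerImage {c ℓ} (R : CommutativeRing c ℓ) where
  open import Data.Integer.Base as ℤ using (ℤ; +_; -[1+_]; _⊖_; 1ℤ)
  import Data.Integer.Properties as ℤ
  open import Data.Nat.Base using (zero; suc)
  open import Data.Maybe.Base using (Maybe; just; nothing)
  open import Relation.Nullary.Decidable.Core using (yes; no)
  open import Relation.Binary.PropositionalEquality.Core as ≡ using (_≡_)
  open import Algebra.Solver.Ring.AlmostCommutativeRing using (fromCommutativeRing; _-Raw-AlmostCommutative⟶_)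
  open CommutativeRing R
  open import Algebra.Properties.Ring ring public
    using (-0#≈0#; -‿distribˡ-*; -‿distribʳ-*; -‿anti-homo-+; -‿involutive; -1*x≈-x)
  open import Algebra.Properties.Semiring.Mult semiring using (_×_; ×-homo-+; ×1-homo-*; ×-homo-1)
  open import Algebra.Properties.AbelianGroup +-abelianGroup using (⁻¹-∙-comm)
  open import Relation.Binary.Reasoning.Setoid setoid

  ι : ℤ → Carrier
  ι (+ n)    = n × 1#
  ι -[1+ n ] = - (suc n × 1#)

  ι-cong : ∀ {i j} → i ≡ j → ι i ≈ ι j
  ι-cong ≡.refl = refl

  ι-neg : ∀ i → ι (ℤ.- i) ≈ - ι i
  ι-neg (+ zero)  = sym -0#≈0#
  ι-neg (+ suc n) = refl
  ι-neg -[1+ n ]  = sym (-‿involutive _)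

  ι-1 : ι 1ℤ ≈ 1#
  ι-1 = ×-homo-1 1#

  private
    cancel : ∀ a b → (1# + a) - (1# + b) ≈ a - b
    cancel a b = begin
      (1# + a) + - (1# + b)   ≈⟨ +-cong (+-comm 1# a) (sym (⁻¹-∙-comm 1# b)) ⟩
      (a + 1#) + (- 1# + - b) ≈⟨ +-assoc a 1# _ ⟩
      a + (1# + (- 1# + - b)) ≈⟨ +-congˡ (+-assoc 1# (- 1#) (- b)) ⟨
      a + (1# + - 1# + - b)   ≈⟨ +-congˡ (+-congʳ (-‿inverseʳ 1#)) ⟩
      a + (0# + - b)          ≈⟨ +-congˡ (+-identityˡ (- b)) ⟩
      a - b                   ∎

  ι-⊖ : ∀ m n → ι (m ⊖ n) ≈ (m × 1#) - (n × 1#)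
  ι-⊖ zero zero = sym (-‿inverseʳ 0#)
  ι-⊖ zero (suc n) = sym (+-identityˡ _)
  ι-⊖ (suc m) zero = sym (trans (+-congˡ -0#≈0#) (+-identityʳ _))
  ι-⊖ (suc m) (suc n) = begin
    ι (suc m ⊖ suc n)               ≈⟨ ι-cong (ℤ.[1+m]⊖[1+n]≡m⊖n m n) ⟩
    ι (m ⊖ n)                       ≈⟨ ι-⊖ m n ⟩
    (m × 1#) - (n × 1#)             ≈⟨ cancel _ _ ⟨
    (1# + m × 1#) - (1# + n × 1#)   ∎

  ι-+ : ∀ i j → ι (i ℤ.+ j) ≈ ι i + ι j
  ι-+ (+ m)    (+ n)    = ×-homo-+ 1# m n
  ι-+ (+ m)    -[1+ n ] = ι-⊖ m (suc n)
  ι-+ -[1+ m ] (+ n)    = trans (ι-⊖ n (suc m)) (+-comm _ _)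
  ι-+ -[1+ m ] -[1+ n ] = begin
    ι (-[1+ m ] ℤ.+ -[1+ n ])           ≈⟨ ι-cong (ℤ.neg-distrib-+ (+ suc m) (+ suc n)) ⟨
    ι (ℤ.- (+ suc m ℤ.+ + suc n))       ≈⟨ ι-neg (+ suc m ℤ.+ + suc n) ⟩
    - ι (+ suc m ℤ.+ + suc n)           ≈⟨ -‿cong (×-homo-+ 1# (suc m) (suc n)) ⟩
    - (suc m × 1# + suc n × 1#)         ≈⟨ ⁻¹-∙-comm _ _ ⟨
    - (suc m × 1#) - (suc n × 1#)       ∎

  private
    ι-*⁺ : ∀ m j → ι (+ m ℤ.* j) ≈ m × 1# * ι j
    ι-*⁺ m (+ n)    = trans (ι-cong (≡.sym (ℤ.pos-* m n))) (×1-homo-* m n)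
    ι-*⁺ m -[1+ n ] = begin
      ι (+ m ℤ.* -[1+ n ])     ≈⟨ ι-cong (ℤ.neg-distribʳ-* (+ m) (+ suc n)) ⟨
      ι (ℤ.- (+ m ℤ.* + suc n)) ≈⟨ ι-neg (+ m ℤ.* + suc n) ⟩
      - ι (+ m ℤ.* + suc n)     ≈⟨ -‿cong (ι-*⁺ m (+ suc n)) ⟩
      - (m × 1# * suc n × 1#)   ≈⟨ -‿distribʳ-* _ _ ⟩
      m × 1# * - (suc n × 1#)   ∎

  ι-* : ∀ i j → ι (i ℤ.* j) ≈ ι i * ι j
  ι-* (+ m)    j = ι-*⁺ m j
  ι-* -[1+ m ] j = begin
    ι (-[1+ m ] ℤ.* j)         ≈⟨ ι-cong (ℤ.neg-distribˡ-* (+ suc m) j) ⟨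
    ι (ℤ.- (+ suc m ℤ.* j))    ≈⟨ ι-neg (+ suc m ℤ.* j) ⟩
    - ι (+ suc m ℤ.* j)        ≈⟨ -‿cong (ι-*⁺ (suc m) j) ⟩
    - (suc m × 1# * ι j)       ≈⟨ -‿distribˡ-* _ _ ⟩
    - (suc m × 1#) * ι j       ∎

  private
    homomorphism : CommutativeRing.rawRing ℤ.+-*-commutativeRing -Raw-AlmostCommutative⟶ fromCommutativeRing R
    homomorphism = record
      { ⟦_⟧ = ι ; +-homo = ι-+ ; *-homo = ι-* ; -‿homo = ι-neg ; 0-homo = refl ; 1-homo = ι-1 }

    _coeff≟_ : ∀ i j → Maybe (ι i ≈ ι j)
    i coeff≟ j with i ℤ.≟ j
    ... | yes i≡j = just (ι-cong i≡j)
    ... | no _    = nothing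

  -- The ring solver with integer coefficients, so that cancellation is decided in every ring.
  open import Algebra.Solver.Ring _ (fromCommutativeRing R) homomorphism _coeff≟_ public
    using (solve; _:=_; _:+_; _:*_; _:-_; :-_; con)

-- Alternating forms on lists of columns, inversion signs and determinants.

module AlternatingForms {c ℓ} (R : CommutativeRing c ℓ) where
  open import Defs using (inversions)
  open import Level using (_⊔_)
  open import Data.Fin.Base using (Fin; zero; suc)
  open import Data.Integer.Base as ℤ using (0ℤ; -1ℤ)
  import Data.Integer.Properties as ℤ
  open import Data.List.Base using (List; []; _∷_; _++_; map; filter; length)
  import Data.List.Properties as List
  open import Data.List.Membership.Propositional using (_∈_)
  open import Data.List.Relation.Unary.Any using (here; there)
  open import Data.List.Relation.Unary.All as All using (All; []; _∷_)
  import Data.List.Relation.Unary.All.Properties as All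
  open import Data.List.Relation.Binary.Pointwise as Pointwise using (Pointwise; []; _∷_)
  open import Data.List.Relation.Binary.Permutation.Propositional as ↭ using (_↭_)
  import Data.List.Relation.Binary.Permutation.Propositional.Properties as ↭
  open import Data.Nat.Base using (ℕ; zero; suc)
  import Data.Nat.Base as ℕ
  import Data.Nat.Properties as ℕ
  open import Relation.Binary.Definitions using (tri<; tri≈; tri>)
  open import Relation.Binary.PropositionalEquality.Core as ≡ using (_≡_)
  open CommutativeRing R hiding (zero)
  open IntegerImage R
  open import Relation.Binary.Reasoning.Setoid setoid

  V : ℕ → Set c
  V n = Fin n → Carrier

  private
    variable
      n : ℕ

  infix  4 _≋_
  infixl 6 _⊞_
  infixr 7 _⊡_

  _≋_ : V n → V n → Set ℓ
  x ≋ y = ∀ i → x i ≈ y i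

  _⊞_ : V n → V n → V n
  (x ⊞ y) i = x i + y i

  _⊡_ : Carrier → V n → V n
  (k ⊡ x) i = k * x i

  𝟘 : V n
  𝟘 i = 0#

  ≋-refl : {x : V n} → x ≋ x
  ≋-refl i = refl

  ≋s-refl : {xs : List (V n)} → Pointwise _≋_ xs xs
  ≋s-refl = Pointwise.refl (λ i → refl)

  record IsAlternating (F : List (V n) → Carrier) : Set (c ⊔ ℓ) where
    field
      cong   : ∀ {xs ys} → Pointwise _≋_ xs ys → F xs ≈ F ys
      linear : ∀ pre x k y post →
               F (pre ++ (x ⊞ k ⊡ y) ∷ post) ≈ F (pre ++ x ∷ post) + k * F (pre ++ y ∷ post)
      alternating : ∀ pre x post → F (pre ++ x ∷ x ∷ post) ≈ 0#

  -- Allows every induction below to act on the head of the list: the columns already dealt with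
  -- become part of the form.
  after : {F : List (V n) → Carrier} → IsAlternating F → ∀ x → IsAlternating (λ xs → F (x ∷ xs))
  after alt x = record
    { cong        = λ xs≋ys → A.cong (≋-refl ∷ xs≋ys)
    ; linear      = λ pre → A.linear (x ∷ pre)
    ; alternating = λ pre → A.alternating (x ∷ pre)
    }
    where module A = IsAlternating alt

  module _ {F : List (V n) → Carrier} (alt : IsAlternating F) where
    open IsAlternating alt

    headCong : ∀ {x y} → x ≋ y → ∀ xs → F (x ∷ xs) ≈ F (y ∷ xs)
    headCong x≋y xs = cong (x≋y ∷ ≋s-refl)

    vanish-𝟘 : ∀ xs → F (𝟘 ∷ xs) ≈ 0#
    vanish-𝟘 xs = begin
      F (𝟘 ∷ xs)                        ≈⟨ headCong (λ i → sym (trans (+-identityˡ _) (zeroʳ _))) xs ⟩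
      F (𝟘 ⊞ - 1# ⊡ 𝟘 ∷ xs)            ≈⟨ linear [] 𝟘 (- 1#) 𝟘 xs ⟩
      F (𝟘 ∷ xs) + - 1# * F (𝟘 ∷ xs)   ≈⟨ +-congˡ (-1*x≈-x _) ⟩
      F (𝟘 ∷ xs) - F (𝟘 ∷ xs)          ≈⟨ -‿inverseʳ _ ⟩
      0#                                 ∎

    scale : ∀ k x xs → F (k ⊡ x ∷ xs) ≈ k * F (x ∷ xs)
    scale k x xs = begin
      F (k ⊡ x ∷ xs)                  ≈⟨ headCong (λ i → sym (+-identityˡ _)) xs ⟩
      F (𝟘 ⊞ k ⊡ x ∷ xs)             ≈⟨ linear [] 𝟘 k x xs ⟩
      F (𝟘 ∷ xs) + k * F (x ∷ xs)    ≈⟨ +-congʳ (vanish-𝟘 xs) ⟩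
      0# + k * F (x ∷ xs)             ≈⟨ +-identityˡ _ ⟩
      k * F (x ∷ xs)                  ∎

    -- Polarization: expand the form at two adjacent columns `x ⊞ y`, where it vanishes together
    -- with its two diagonal terms.
    headSwap : ∀ x y xs → F (x ∷ y ∷ xs) ≈ - F (y ∷ x ∷ xs)
    headSwap x y xs = begin
      a               ≈⟨ solve 2 (λ a b → a := (a :+ b) :- b) refl a b ⟩
      (a + b) - b     ≈⟨ +-congʳ sum≈0 ⟩
      0# - b          ≈⟨ +-identityˡ _ ⟩
      - b             ∎
      where
      a b : Carrier
      a = F (x ∷ y ∷ xs)
      b = F (y ∷ x ∷ xs)
      s : V n
      s = x ⊞ 1# ⊡ y
      at : ∀ w → F (w ∷ s ∷ xs) ≈ F (w ∷ x ∷ xs) + 1# * F (w ∷ y ∷ xs)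
      at w = linear (w ∷ []) x 1# y xs
      sum≈0 : a + b ≈ 0#
      sum≈0 = begin
        a + b                          ≈⟨ +-cong (trans (+-identityˡ _) (*-identityˡ a)) (+-identityʳ b) ⟨
        (0# + 1# * a) + (b + 0#)       ≈⟨ +-cong (+-congʳ (alternating [] x xs)) (+-congˡ (trans (*-congˡ (alternating [] y xs)) (zeroʳ 1#))) ⟨
        (F (x ∷ x ∷ xs) + 1# * a) + (b + 1# * F (y ∷ y ∷ xs)) ≈⟨ +-cong (at x) (at y) ⟨
        F (x ∷ s ∷ xs) + F (y ∷ s ∷ xs)  ≈⟨ +-congˡ (*-identityˡ _) ⟨
        F (x ∷ s ∷ xs) + 1# * F (y ∷ s ∷ xs)  ≈⟨ linear [] x 1# y (s ∷ xs) ⟨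
        F (s ∷ s ∷ xs)                 ≈⟨ alternating [] s xs ⟩
        0#                             ∎

  vanish-∈ : {F : List (V n) → Carrier} → IsAlternating F → ∀ {x xs} → x ∈ xs → F (x ∷ xs) ≈ 0#
  vanish-∈ alt (here ≡.refl) = IsAlternating.alternating alt [] _ _
  vanish-∈ alt {x} {y ∷ xs} (there x∈xs) =
    trans (headSwap alt x y xs) (trans (-‿cong (vanish-∈ (after alt y) x∈xs)) -0#≈0#)

  -- The elementary column operation. It serves both the elimination in the bialternant formula and
  -- the differences of columns of equal residue.
  headReduce : {F : List (V n) → Carrier} → IsAlternating F → ∀ {x w y xs} k →
               x ≋ w ⊞ k ⊡ y → y ∈ xs → F (x ∷ xs) ≈ F (w ∷ xs)
  headReduce {F = F} alt {x} {w} {y} {xs} k x≋ y∈ = begin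
    F (x ∷ xs)                    ≈⟨ headCong alt x≋ xs ⟩
    F (w ⊞ k ⊡ y ∷ xs)            ≈⟨ IsAlternating.linear alt [] w k y xs ⟩
    F (w ∷ xs) + k * F (y ∷ xs)   ≈⟨ +-congˡ (trans (*-congˡ (vanish-∈ alt y∈)) (zeroʳ k)) ⟩
    F (w ∷ xs) + 0#               ≈⟨ +-identityʳ _ ⟩
    F (w ∷ xs)                    ∎

  expand₁ : {F : List (V n) → Carrier} → IsAlternating F → ∀ p q e e′ xs →
            F (p ⊡ e ⊞ q ⊡ e′ ∷ xs) ≈ p * F (e ∷ xs) + q * F (e′ ∷ xs)
  expand₁ alt p q e e′ xs = trans (IsAlternating.linear alt [] (p ⊡ e) q e′ xs) (+-congʳ (scale alt p e xs))

  -- On the plane of `e` and `e′` an alternating form is a multiple of the 2×2 determinant of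
  -- coordinates; the bracket of the overview is such a determinant.
  expand₂ : {F : List (V n) → Carrier} → IsAlternating F → ∀ p q r s e e′ xs →
            F (p ⊡ e ⊞ q ⊡ e′ ∷ r ⊡ e ⊞ s ⊡ e′ ∷ xs) ≈ (p * s - q * r) * F (e ∷ e′ ∷ xs)
  expand₂ {F = F} alt p q r s e e′ xs = begin
    F (p ⊡ e ⊞ q ⊡ e′ ∷ y ∷ xs)                 ≈⟨ expand₁ alt p q e e′ (y ∷ xs) ⟩
    p * F (e ∷ y ∷ xs) + q * F (e′ ∷ y ∷ xs)    ≈⟨ +-cong (*-congˡ (expand₁ (after alt e) r s e e′ xs)) (*-congˡ (expand₁ (after alt e′) r s e e′ xs)) ⟩
    p * (r * F (e ∷ e ∷ xs) + s * a) + q * (r * F (e′ ∷ e ∷ xs) + s * F (e′ ∷ e′ ∷ xs))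
      ≈⟨ +-cong (*-congˡ (+-congʳ (*-congˡ (IsAlternating.alternating alt [] e xs))))
                (*-congˡ (+-cong (*-congˡ (headSwap alt e′ e xs)) (*-congˡ (IsAlternating.alternating alt [] e′ xs)))) ⟩
    p * (r * 0# + s * a) + q * (r * - a + s * 0#)
      ≈⟨ solve 5 (λ p q r s a → p :* (r :* con 0ℤ :+ s :* a) :+ q :* (r :* :- a :+ s :* con 0ℤ) := (p :* s :- q :* r) :* a) refl p q r s a ⟩
    (p * s - q * r) * a                          ∎
    where
    y : V _
    y = r ⊡ e ⊞ s ⊡ e′
    a : Carrier
    a = F (e ∷ e′ ∷ xs)

  sign : ℕ → Carrier
  sign k = ι (-1ℤ ℤ.^ k)

  sign-suc : ∀ k → sign (suc k) ≈ - sign k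
  sign-suc k = trans (ι-cong (ℤ.-1*i≡-i (-1ℤ ℤ.^ k))) (ι-neg (-1ℤ ℤ.^ k))

  sign-+ : ∀ j k → sign (j ℕ.+ k) ≈ sign j * sign k
  sign-+ j k = trans (ι-cong (ℤ.^-distribˡ-+-* -1ℤ j k)) (ι-* (-1ℤ ℤ.^ j) _)

  pull : {F : List (V n) → Carrier} → IsAlternating F → ∀ pre x post →
         F (pre ++ x ∷ post) ≈ sign (length pre) * F (x ∷ pre ++ post)
  pull alt [] x post = sym (trans (*-congʳ ι-1) (*-identityˡ _))
  pull {F = F} alt (y ∷ pre) x post = begin
    F (y ∷ pre ++ x ∷ post)                             ≈⟨ pull (after alt y) pre x post ⟩
    sign (length pre) * F (y ∷ x ∷ pre ++ post)         ≈⟨ *-congˡ (headSwap alt y x _) ⟩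
    sign (length pre) * - F (x ∷ y ∷ pre ++ post)       ≈⟨ solve 2 (λ s a → s :* :- a := :- s :* a) refl _ _ ⟩
    - sign (length pre) * F (x ∷ y ∷ pre ++ post)       ≈⟨ *-congʳ (sign-suc (length pre)) ⟨
    sign (suc (length pre)) * F (x ∷ y ∷ pre ++ post)   ∎

  vanish-↭ : {F : List (V n) → Carrier} → IsAlternating F → ∀ {xs ys} → xs ↭ ys → F xs ≈ 0# → F ys ≈ 0#
  vanish-↭ alt ↭.refl F≈0 = F≈0
  vanish-↭ alt (↭.prep x p) F≈0 = vanish-↭ (after alt x) p F≈0
  vanish-↭ alt (↭.swap x y p) F≈0 =
    trans (headSwap alt y x _)
          (trans (-‿cong (vanish-↭ (after (after alt x) y) p F≈0)) -0#≈0#)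
  vanish-↭ alt (↭.trans p q) F≈0 = vanish-↭ alt q (vanish-↭ alt p F≈0)

  private
    below : ℕ → List ℕ → ℕ
    below x w = length (filter (ℕ._<? x) w)

    below-↭ : ∀ x {w w′} → w ↭ w′ → below x w ≡ below x w′
    below-↭ x p = ↭.↭-length (↭.filter-↭ (ℕ._<? x) p)

    -- The pair itself contributes one inversion or none, while the inversions of `x` and of `y`
    -- with letters of `w` are counted equally in both words.
    descent : ∀ {x y} w → x ℕ.< y → inversions (y ∷ x ∷ w) ≡ suc (inversions (x ∷ y ∷ w))
    descent {x} {y} w x<y
      rewrite List.filter-accept (ℕ._<? y) {xs = w} x<y | List.filter-reject (ℕ._<? x) {xs = w} (ℕ.<⇒≯ x<y)
      = ≡.cong suc exchange
      where
      b₁ = below x w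
      b₂ = below y w
      exchange : b₂ ℕ.+ (b₁ ℕ.+ inversions w) ≡ b₁ ℕ.+ (b₂ ℕ.+ inversions w)
      exchange = ≡.trans (≡.sym (ℕ.+-assoc b₂ b₁ _)) (≡.trans (≡.cong (ℕ._+ inversions w) (ℕ.+-comm b₂ b₁)) (ℕ.+-assoc b₁ b₂ _))

  -- The inversion sign compensates the sign of reordering columns, so the value depends on the
  -- multiset of letters only. This is how inv(b_S) enters ε.
  signed : (u : ℕ → V n) → (List (V n) → Carrier) → List ℕ → Carrier
  signed u F w = sign (inversions w) * F (map u w)

  private
    signed-swap : {F : List (V n) → Carrier} → IsAlternating F → ∀ u x y w →
                  signed u F (x ∷ y ∷ w) ≈ signed u F (y ∷ x ∷ w)
    signed-swap {F = F} alt u x y w with ℕ.<-cmp x y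
    ... | tri< x<y _ _ = begin
      sign i * F (u x ∷ u y ∷ map u w)         ≈⟨ *-congˡ (headSwap alt (u x) (u y) _) ⟩
      sign i * - F (u y ∷ u x ∷ map u w)       ≈⟨ solve 2 (λ s a → s :* :- a := :- s :* a) refl _ _ ⟩
      - sign i * F (u y ∷ u x ∷ map u w)       ≈⟨ *-congʳ (trans (ι-cong (≡.cong (-1ℤ ℤ.^_) (descent w x<y))) (sign-suc i)) ⟨
      sign (inversions (y ∷ x ∷ w)) * F (u y ∷ u x ∷ map u w) ∎
      where i = inversions (x ∷ y ∷ w)
    ... | tri≈ _ ≡.refl _ = refl
    ... | tri> _ _ y<x = begin
      sign (inversions (x ∷ y ∷ w)) * F (u x ∷ u y ∷ map u w)  ≈⟨ *-cong (trans (ι-cong (≡.cong (-1ℤ ℤ.^_) (descent w y<x))) (sign-suc i)) (headSwap alt (u x) (u y) _) ⟩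
      - sign i * - F (u y ∷ u x ∷ map u w)  ≈⟨ solve 2 (λ s a → :- s :* :- a := s :* a) refl _ _ ⟩
      sign i * F (u y ∷ u x ∷ map u w) ∎
      where i = inversions (y ∷ x ∷ w)

    -- The inversions starting at the first letter depend on the other letters only as a multiset,
    -- so their sign splits off and the remaining word can be permuted with `u x` fixed as a column.
    signed-prep : (F : List (V n) → Carrier) → ∀ u x {w w′} → w ↭ w′ →
                  signed u (λ xs → F (u x ∷ xs)) w ≈ signed u (λ xs → F (u x ∷ xs)) w′ →
                  signed u F (x ∷ w) ≈ signed u F (x ∷ w′)
    signed-prep F u x {w} {w′} p w≈w′ = begin
      sign (below x w ℕ.+ inversions w) * F (map u (x ∷ w))     ≈⟨ split w ⟩
      sign (below x w) * signed u (λ xs → F (u x ∷ xs)) w       ≈⟨ *-cong (ι-cong (≡.cong (-1ℤ ℤ.^_) (below-↭ x p))) w≈w′ ⟩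
      sign (below x w′) * signed u (λ xs → F (u x ∷ xs)) w′     ≈⟨ split w′ ⟨
      sign (below x w′ ℕ.+ inversions w′) * F (map u (x ∷ w′))  ∎
      where
      split : ∀ v → sign (below x v ℕ.+ inversions v) * F (map u (x ∷ v)) ≈ sign (below x v) * signed u (λ xs → F (u x ∷ xs)) v
      split v = trans (*-congʳ (sign-+ (below x v) (inversions v))) (*-assoc _ _ _)

  signed-↭ : {F : List (V n) → Carrier} → IsAlternating F → ∀ u {w w′} → w ↭ w′ → signed u F w ≈ signed u F w′
  signed-↭ alt u ↭.refl = refl
  signed-↭ {F = F} alt u (↭.prep x p) = signed-prep F u x p (signed-↭ (after alt (u x)) u p)
  signed-↭ {F = F} alt u {_ ∷ _ ∷ w} (↭.swap x y p) =
    trans (signed-swap alt u x y w)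
          (signed-prep F u y (↭.prep x p) (signed-prep (λ xs → F (u y ∷ xs)) u x p (signed-↭ (after (after alt (u y)) (u x)) u p)))
  signed-↭ alt u (↭.trans p q) = trans (signed-↭ alt u p) (signed-↭ alt u q)

  -- Expansion along the first row, F playing the minors of the remaining rows.
  laplace : (List (V n) → Carrier) → List (V (suc n)) → Carrier
  laplace F []       = 0#
  laplace F (x ∷ xs) = x zero * F (map (λ y i → y (suc i)) xs) - laplace (λ ys → F ((λ i → x (suc i)) ∷ ys)) xs

  -- A list whose length is not `n` gets the value 0, a default that keeps `det n` alternating on
  -- lists of every length.
  det : ∀ n → List (V n) → Carrier
  det zero    []      = 1#
  det zero    (_ ∷ _) = 0#
  det (suc n) xs      = laplace (det n) xs

  private
    tl : V (suc n) → V n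
    tl x i = x (suc i)

    map-tl : ∀ {xs ys : List (V (suc n))} → Pointwise _≋_ xs ys → Pointwise _≋_ (map tl xs) (map tl ys)
    map-tl []       = []
    map-tl (e ∷ es) = (λ i → e (suc i)) ∷ map-tl es

    laplace-cong : {F G : List (V n) → Carrier} → (∀ {xs ys} → Pointwise _≋_ xs ys → F xs ≈ G ys) →
                   ∀ {xs ys} → Pointwise _≋_ xs ys → laplace F xs ≈ laplace G ys
    laplace-cong F≈G []       = refl
    laplace-cong F≈G (e ∷ es) =
      +-cong (*-cong (e zero) (F≈G (map-tl es)))
             (-‿cong (laplace-cong (λ es′ → F≈G ((λ i → e (suc i)) ∷ es′)) es))

  -- Linearity in the form, not in the columns: the recursion of `laplace` absorbs a column into
  -- `F`, so linearity in that column becomes linearity in `F`.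
  laplace-linear : (F G H : List (V n) → Carrier) (k : Carrier) → (∀ xs → F xs ≈ G xs + k * H xs) →
                   ∀ xs → laplace F xs ≈ laplace G xs + k * laplace H xs
  laplace-linear F G H k F≈ []       = sym (trans (+-identityˡ _) (zeroʳ k))
  laplace-linear F G H k F≈ (x ∷ xs) = begin
    x zero * F (map tl xs) - laplace (λ ys → F (tl x ∷ ys)) xs
      ≈⟨ +-cong (*-congˡ (F≈ _)) (-‿cong (laplace-linear _ _ _ k (λ ys → F≈ (tl x ∷ ys)) xs)) ⟩
    x zero * (G (map tl xs) + k * H (map tl xs)) - (laplace (λ ys → G (tl x ∷ ys)) xs + k * laplace (λ ys → H (tl x ∷ ys)) xs)
      ≈⟨ solve 6 (λ x k g h g′ h′ → x :* (g :+ k :* h) :- (g′ :+ k :* h′) := (x :* g :- g′) :+ k :* (x :* h :- h′)) refl _ k _ _ _ _ ⟩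
    (x zero * G (map tl xs) - laplace (λ ys → G (tl x ∷ ys)) xs) + k * (x zero * H (map tl xs) - laplace (λ ys → H (tl x ∷ ys)) xs) ∎

  laplace-vanish : (F : List (V n) → Carrier) → (∀ xs → F xs ≈ 0#) → ∀ xs → laplace F xs ≈ 0#
  laplace-vanish F F≈0 []       = refl
  laplace-vanish F F≈0 (x ∷ xs) = begin
    x zero * F (map tl xs) - laplace (λ ys → F (tl x ∷ ys)) xs
      ≈⟨ +-cong (*-congˡ (F≈0 _)) (-‿cong (laplace-vanish _ (λ ys → F≈0 (tl x ∷ ys)) xs)) ⟩
    x zero * 0# - 0#  ≈⟨ solve 1 (λ x → x :* con 0ℤ :- con 0ℤ := con 0ℤ) refl _ ⟩
    0#                ∎

  laplace-isAlternating : {F : List (V n) → Carrier} → IsAlternating F → IsAlternating (laplace F)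
  laplace-isAlternating {F = F} alt = record
    { cong = laplace-cong (IsAlternating.cong alt)
    ; linear = lin alt
    ; alternating = van alt
    }
    where
    lin : {F : List (V n) → Carrier} → IsAlternating F → ∀ pre x k y post →
          laplace F (pre ++ (x ⊞ k ⊡ y) ∷ post) ≈ laplace F (pre ++ x ∷ post) + k * laplace F (pre ++ y ∷ post)
    lin {F = F} alt [] x k y post = begin
      (x zero + k * y zero) * F (map tl post) - laplace (λ ys → F (tl (x ⊞ k ⊡ y) ∷ ys)) post
        ≈⟨ +-congˡ (-‿cong (laplace-linear _ _ _ k (IsAlternating.linear alt [] (tl x) k (tl y)) post)) ⟩
      (x zero + k * y zero) * F (map tl post) - (laplace (λ ys → F (tl x ∷ ys)) post + k * laplace (λ ys → F (tl y ∷ ys)) post)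
        ≈⟨ solve 6 (λ x k y f g h → (x :+ k :* y) :* f :- (g :+ k :* h) := (x :* f :- g) :+ k :* (y :* f :- h)) refl _ k _ _ _ _ ⟩
      (x zero * F (map tl post) - laplace (λ ys → F (tl x ∷ ys)) post) + k * (y zero * F (map tl post) - laplace (λ ys → F (tl y ∷ ys)) post) ∎
    lin {F = F} alt (w ∷ pre) x k y post
      rewrite List.map-++ tl pre ((x ⊞ k ⊡ y) ∷ post) | List.map-++ tl pre (x ∷ post) | List.map-++ tl pre (y ∷ post) = begin
      w zero * F (map tl pre ++ tl (x ⊞ k ⊡ y) ∷ map tl post) - laplace (λ ys → F (tl w ∷ ys)) (pre ++ (x ⊞ k ⊡ y) ∷ post)
        ≈⟨ +-cong (*-congˡ (IsAlternating.linear alt (map tl pre) (tl x) k (tl y) (map tl post))) (-‿cong (lin (after alt (tl w)) pre x k y post)) ⟩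
      w zero * (F (map tl pre ++ tl x ∷ map tl post) + k * F (map tl pre ++ tl y ∷ map tl post)) - (laplace (λ ys → F (tl w ∷ ys)) (pre ++ x ∷ post) + k * laplace (λ ys → F (tl w ∷ ys)) (pre ++ y ∷ post))
        ≈⟨ solve 6 (λ w k f g f′ g′ → w :* (f :+ k :* g) :- (f′ :+ k :* g′) := (w :* f :- f′) :+ k :* (w :* g :- g′)) refl _ k _ _ _ _ ⟩
      (w zero * F (map tl pre ++ tl x ∷ map tl post) - laplace (λ ys → F (tl w ∷ ys)) (pre ++ x ∷ post)) + k * (w zero * F (map tl pre ++ tl y ∷ map tl post) - laplace (λ ys → F (tl w ∷ ys)) (pre ++ y ∷ post)) ∎
    van : {F : List (V n) → Carrier} → IsAlternating F → ∀ pre x post → laplace F (pre ++ x ∷ x ∷ post) ≈ 0#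
    -- Taking the first-row entry from either copy of `x` gives the same minor with opposite signs;
    -- taking it from a later column leaves both copies inside `F`.
    van {F = F} alt [] x post = begin
      x zero * f - (x zero * f - laplace (λ ys → F (tl x ∷ tl x ∷ ys)) post)
        ≈⟨ +-congˡ (-‿cong (+-congˡ (-‿cong (laplace-vanish _ (IsAlternating.alternating alt [] (tl x)) post)))) ⟩
      x zero * f - (x zero * f - 0#)
        ≈⟨ solve 1 (λ a → a :- (a :- con 0ℤ) := con 0ℤ) refl _ ⟩
      0# ∎
      where f = F (tl x ∷ map tl post)
    van {F = F} alt (w ∷ pre) x post rewrite List.map-++ tl pre (x ∷ x ∷ post) = begin
      w zero * F (map tl pre ++ tl x ∷ tl x ∷ map tl post) - laplace (λ ys → F (tl w ∷ ys)) (pre ++ x ∷ x ∷ post)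
        ≈⟨ +-cong (*-congˡ (IsAlternating.alternating alt (map tl pre) (tl x) (map tl post))) (-‿cong (van (after alt (tl w)) pre x post)) ⟩
      w zero * 0# - 0#  ≈⟨ solve 1 (λ x → x :* con 0ℤ :- con 0ℤ := con 0ℤ) refl _ ⟩
      0#                ∎

  det-isAlternating : ∀ n → IsAlternating (det n)
  det-isAlternating zero = record
    { cong        = λ { [] → refl ; (_ ∷ _) → refl }
    ; linear      = λ { [] x k y post → zero-lin k ; (_ ∷ _) x k y post → zero-lin k }
    ; alternating = λ { [] _ _ → refl ; (_ ∷ _) _ _ → refl }
    }
    where
    zero-lin : ∀ k → 0# ≈ 0# + k * 0#
    zero-lin k = sym (trans (+-identityˡ _) (zeroʳ k))
  det-isAlternating (suc n) = laplace-isAlternating (det-isAlternating n)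

  ∏ : V n → Carrier
  ∏ {zero}  d = 1#
  ∏ {suc _} d = d zero * ∏ (tl d)

  _⊙_ : V n → V n → V n
  (d ⊙ x) i = d i * x i

  private
    laplace-scaleRows : (F G : List (V n) → Carrier) (d : V (suc n)) (p : Carrier) →
                        (∀ xs → G (map (tl d ⊙_) xs) ≈ p * F xs) →
                        ∀ xs → laplace G (map (d ⊙_) xs) ≈ d zero * p * laplace F xs
    laplace-scaleRows F G d p G≈ []       = sym (zeroʳ _)
    laplace-scaleRows F G d p G≈ (x ∷ xs) = begin
      d zero * x zero * G (map tl (map (d ⊙_) xs)) - laplace (λ ys → G (tl d ⊙ tl x ∷ ys)) (map (d ⊙_) xs)
        ≈⟨ +-cong (*-congˡ (trans (reflexive (≡.cong G map-map)) (G≈ _)))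
                  (-‿cong (laplace-scaleRows (λ ys → F (tl x ∷ ys)) _ d p (λ ys → G≈ (tl x ∷ ys)) xs)) ⟩
      d zero * x zero * (p * F (map tl xs)) - d zero * p * laplace (λ ys → F (tl x ∷ ys)) xs
        ≈⟨ solve 5 (λ d x p f g → d :* x :* (p :* f) :- d :* p :* g := d :* p :* (x :* f :- g)) refl (d zero) (x zero) p _ _ ⟩
      d zero * p * (x zero * F (map tl xs) - laplace (λ ys → F (tl x ∷ ys)) xs) ∎
      where
      map-map : map tl (map (d ⊙_) xs) ≡ map (tl d ⊙_) (map tl xs)
      map-map = ≡.trans (≡.sym (List.map-∘ xs)) (List.map-∘ xs)

  det-scaleRows : ∀ n (d : V n) xs → det n (map (d ⊙_) xs) ≈ ∏ d * det n xs
  det-scaleRows zero    d []       = sym (*-identityˡ 1#)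
  det-scaleRows zero    d (_ ∷ _)  = sym (zeroʳ 1#)
  det-scaleRows (suc n) d xs       = laplace-scaleRows (det n) (det n) d (∏ (tl d)) (det-scaleRows n (tl d)) xs

  module _ {p} (P : Carrier → Set p) (P0 : P 0#) (P1 : P 1#)
           (P+ : ∀ {x y} → P x → P y → P (x + y)) (P* : ∀ {x y} → P x → P y → P (x * y))
           (P- : ∀ {x} → P x → P (- x)) where

    private
      Entries : V n → Set p
      Entries x = ∀ i → P (x i)

      laplace-closed : (F : List (V n) → Carrier) → (∀ {xs} → All Entries xs → P (F xs)) →
                       ∀ {xs} → All Entries xs → P (laplace F xs)
      laplace-closed F PF []         = P0
      laplace-closed F PF (px ∷ pxs) =
        P+ (P* (px zero) (PF (All.map⁺ (All.map (λ py i → py (suc i)) pxs))))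
           (P- (laplace-closed _ (λ pys → PF ((λ i → px (suc i)) ∷ pys)) pxs))

    -- Meant for the predicate of being a constant Laurent polynomial, by which a determinant with
    -- constant entries is seen to be free of z.
    det-closed : ∀ n {xs} → All Entries xs → P (det n xs)
    det-closed zero    []      = P1
    det-closed zero    (_ ∷ _) = P0
    det-closed (suc n) pxs     = laplace-closed (det n) (det-closed n) pxs

-- The bialternant formula for Schur polynomials.

module Bialternant {c ℓ} (R : CommutativeRing c ℓ) where
  open import Defs
  open import Data.Fin.Base using (zero; suc; toℕ)
  open import Data.Integer.Base using (0ℤ)
  open import Data.List.Base as List using (List; []; _∷_; _++_; applyUpTo; cartesianProductWith; concatMap; foldr; map)
  import Data.List.Properties as List
  open import Data.List.Relation.Unary.All as All using (All; []; _∷_)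
  import Data.List.Relation.Unary.All.Properties as All
  open import Data.List.Relation.Unary.Any using (here)
  open import Data.Nat.Base as ℕ using (ℕ; zero; suc; _∸_; _≤_; _≥_; z≤n)
  import Data.Nat.Properties as ℕ
  open import Data.Product.Base using (_×_; _,_)
  open import Data.Vec.Base as Vec using (Vec; []; _∷_; lookup)
  import Data.Vec.Relation.Unary.All as VecAll
  open import Data.Vec.Relation.Unary.AllPairs using (AllPairs; []; _∷_)
  open import Data.Vec.Relation.Unary.Linked using (Linked; []; [-]; _∷_)
  open import Function.Base using (_∘_)
  open import Relation.Binary.PropositionalEquality.Core as ≡ using (_≡_)
  import Relation.Binary.PropositionalEquality.Properties as ≡
  open CommutativeRing R hiding (zero)
  open import Algebra.Properties.Semiring.Exp semiring
  open IntegerImage R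
  open AlternatingForms R
  open import Relation.Binary.Reasoning.Setoid setoid

  private
    variable
      n k : ℕ
      B B′ : Set

  ∑ : List B → (B → Carrier) → Carrier
  ∑ bs f = foldr _+_ 0# (map f bs)

  ∑-++ : ∀ (bs bs′ : List B) f → ∑ (bs ++ bs′) f ≈ ∑ bs f + ∑ bs′ f
  ∑-++ []       bs′ f = sym (+-identityˡ _)
  ∑-++ (b ∷ bs) bs′ f = trans (+-congˡ (∑-++ bs bs′ f)) (sym (+-assoc _ _ _))

  ∑-map : ∀ (g : B → B′) bs f → ∑ (map g bs) f ≈ ∑ bs (f ∘ g)
  ∑-map g bs f = reflexive (≡.cong (foldr _+_ 0#) (≡.sym (List.map-∘ bs)))

  ∑-cong : ∀ {bs : List B} {f g} → All (λ b → f b ≈ g b) bs → ∑ bs f ≈ ∑ bs g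
  ∑-cong []       = refl
  ∑-cong (e ∷ es) = +-cong e (∑-cong es)

  ∑-concatMap : ∀ (g : B → List B′) bs f → ∑ (concatMap g bs) f ≈ ∑ bs (λ b → ∑ (g b) f)
  ∑-concatMap g []       f = refl
  ∑-concatMap g (b ∷ bs) f = trans (∑-++ (g b) (concatMap g bs) f) (+-congˡ (∑-concatMap g bs f))

  ∑-cartesianProductWith : ∀ {B″ : Set} (g : B → B′ → B″) bs bs′ f →
    ∑ (cartesianProductWith g bs bs′) f ≈ ∑ bs (λ b → ∑ bs′ (λ b′ → f (g b b′)))
  ∑-cartesianProductWith g []       bs′ f = refl
  ∑-cartesianProductWith g (b ∷ bs) bs′ f =
    trans (∑-++ (map (g b) bs′) _ f) (+-cong (∑-map (g b) bs′ f) (∑-cartesianProductWith g bs bs′ f))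

  *-∑ : ∀ a (bs : List B) f → a * ∑ bs f ≈ ∑ bs (λ b → a * f b)
  *-∑ a []       f = zeroʳ a
  *-∑ a (b ∷ bs) f = trans (distribˡ a _ _) (+-congˡ (*-∑ a bs f))

  headSum : {F : List (V n) → Carrier} → IsAlternating F → ∀ (bs : List B) (g : B → Carrier) (h : B → V n) xs →
            F ((λ i → ∑ bs (λ b → g b * h b i)) ∷ xs) ≈ ∑ bs (λ b → g b * F (h b ∷ xs))
  headSum alt []       g h xs = vanish-𝟘 alt xs
  headSum {F = F} alt (b ∷ bs) g h xs = begin
    F ((λ i → ∑ (b ∷ bs) (λ b → g b * h b i)) ∷ xs)                  ≈⟨ headCong alt (λ i → +-comm _ _) xs ⟩
    F ((λ i → ∑ bs (λ b → g b * h b i)) ⊞ g b ⊡ h b ∷ xs)            ≈⟨ IsAlternating.linear alt [] _ (g b) (h b) xs ⟩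
    F ((λ i → ∑ bs (λ b → g b * h b i)) ∷ xs) + g b * F (h b ∷ xs)   ≈⟨ +-comm _ _ ⟩
    g b * F (h b ∷ xs) + F ((λ i → ∑ bs (λ b → g b * h b i)) ∷ xs)   ≈⟨ +-congˡ (headSum alt bs g h xs) ⟩
    ∑ (b ∷ bs) (λ b → g b * F (h b ∷ xs))                            ∎

  -- Takes a bare vector instead of a `Partition`, since the recursion passes to the vectors listed
  -- by `interlacing`. On a partition it unfolds to `schur`.
  schurSum : Vec ℕ n → Vec Carrier n → Carrier
  schurSum κ x = ∑ (contents κ) (monomial (Semiring.rawSemiring semiring) x)

  schurSum-branching : ∀ (κ : Vec ℕ (suc n)) y x →
    schurSum κ (y ∷ x) ≈ ∑ (interlacing κ) (λ ν → y ^ (Vec.sum κ ∸ Vec.sum ν) * schurSum ν x)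
  schurSum-branching κ@(_ ∷ _) y x =
    trans (∑-concatMap (λ ν → map ((Vec.sum κ ∸ Vec.sum ν) ∷_) (contents ν)) (interlacing κ) _)
          (∑-cong (All.universal (λ ν → trans (∑-map _ (contents ν) _) (sym (*-∑ _ (contents ν) _))) (interlacing κ)))

  private
    relax : ∀ {a b} {ν : Vec ℕ n} → b ≤ a → Linked _≥_ (b ∷ ν) → Linked _≥_ (a ∷ ν)
    relax b≤a [-]     = [-]
    relax b≤a (r ∷ l) = ℕ.≤-trans r b≤a ∷ l

    offset-≤ : ∀ {a b} i → b ≤ a → i ℕ.< suc a ∸ b → b ℕ.+ i ≤ a
    offset-≤ {a} {b} i b≤a i< = ℕ.≤-pred (≡.subst (suc (b ℕ.+ i) ≤_) (ℕ.m+[n∸m]≡n (ℕ.m≤n⇒m≤1+n b≤a))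
      (≡.subst (_≤ b ℕ.+ (suc a ∸ b)) (ℕ.+-suc b i) (ℕ.+-monoʳ-≤ b i<)))

    between : ∀ {a b} → b ≤ a → All (λ v → b ≤ v × v ≤ a) (applyUpTo (b ℕ.+_) (suc a ∸ b))
    between {a} {b} b≤a = All.applyUpTo⁺₁ (b ℕ.+_) (suc a ∸ b) (λ {i} i< → ℕ.m≤m+n b i , offset-≤ i b≤a i<)

    All-cartesian : ∀ {p q r} {B″ : Set} {P : B → Set p} {Q : B′ → Set q} {T : B″ → Set r} (g : B → B′ → B″) →
                    (∀ {b b′} → P b → Q b′ → T (g b b′)) → ∀ {bs bs′} → All P bs → All Q bs′ →
                    All T (cartesianProductWith g bs bs′)
    All-cartesian g pq []         qs = []
    All-cartesian g pq (pb ∷ pbs) qs = All.++⁺ (All.map⁺ (All.map (pq pb) qs)) (All-cartesian g pq pbs qs)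

  -- Monotonicity lets the induction hypothesis of `bialternant` apply to ν, and the bound on the
  -- sum makes the truncated difference of sums exact. The bound `a` is kept in front of ν for the
  -- sake of the induction.
  interlacing-decreasing : ∀ {a} {κ : Vec ℕ n} → Linked _≥_ (a ∷ κ) →
    All (λ ν → Linked _≥_ (a ∷ ν) × Vec.sum ν ≤ Vec.sum (a ∷ κ)) (interlacing (a ∷ κ))
  interlacing-decreasing [-]           = ([-] , z≤n) ∷ []
  interlacing-decreasing {κ = _ ∷ _} (b≤a ∷ rest) =
    All-cartesian _∷_ (λ (b≤v , v≤a) (l , s≤) → v≤a ∷ relax b≤v l , ℕ.+-mono-≤ v≤a s≤)
      (between b≤a) (interlacing-decreasing rest)

  powers : Vec Carrier n → ℕ → V n
  powers x m i = lookup x i ^ m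

  betas : Vec ℕ n → List ℕ
  betas []            = []
  betas (_∷_ {n} k κ) = (k ℕ.+ n) ∷ betas κ

  vandermonde : Vec Carrier n → Carrier
  vandermonde []      = 1#
  vandermonde (y ∷ x) = ∏ (λ i → y - lookup x i) * vandermonde x

  module _ (y : Carrier) (x : Vec Carrier n) where

    private
      D : V n
      D i = y - lookup x i

      -- Subtracting y^(m₁ - m₂) times the next column clears the first row entry of a column; what is
      -- left below is divisible by y - xᵢ, and its quotient runs over the possible parts of an
      -- interlacing ν.
      quotient : ℕ → ℕ → ℕ → V n
      quotient a b k i = ∑ (applyUpTo (b ℕ.+_) (suc a ∸ b)) (λ v → y ^ (a ∸ v) * powers x (v ℕ.+ k) i)

      quotients : Vec ℕ (suc k) → List (V n)
      quotients (a ∷ [])            = []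
      quotients (_∷_ {suc k} a (b ∷ κ)) = quotient a b k ∷ quotients (b ∷ κ)

      -- The factorization of a difference of powers by a telescoping sum. The function `g` stands
      -- for `b ℕ.+_`, because the recursion of `applyUpTo` passes to `g ∘ suc`, which agrees with
      -- `suc b ℕ.+_` only up to a proved equation.
      telescope : ∀ d b k w g → (∀ i → g i ≡ b ℕ.+ i) →
        (y - w) * ∑ (applyUpTo g (suc d)) (λ v → y ^ (b ℕ.+ d ∸ v) * w ^ (v ℕ.+ k)) ≈
        y ^ suc d * w ^ (b ℕ.+ k) - w ^ (suc (b ℕ.+ d) ℕ.+ k)
      telescope d b k w g g≡ = begin
        (y - w) * (y ^ (b ℕ.+ d ∸ g 0) * w ^ (g 0 ℕ.+ k) + rest d)
          ≈⟨ *-congˡ (+-congʳ (*-cong (^-congʳ y top) (^-congʳ w (≡.cong (ℕ._+ k) g0)))) ⟩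
        (y - w) * (y ^ d * w ^ (b ℕ.+ k) + rest d)
          ≈⟨ solve 4 (λ y w p r → (y :- w) :* (p :+ r) := (y :- w) :* p :+ (y :- w) :* r) refl y w _ _ ⟩
        (y - w) * (y ^ d * w ^ (b ℕ.+ k)) + (y - w) * rest d
          ≈⟨ +-congˡ (tail d ≡.refl) ⟩
        (y - w) * (y ^ d * w ^ (b ℕ.+ k)) + (y ^ d * (w * w ^ (b ℕ.+ k)) - w ^ (suc (b ℕ.+ d) ℕ.+ k))
          ≈⟨ solve 5 (λ y w p q r → (y :- w) :* (p :* q) :+ (p :* (w :* q) :- r) := y :* p :* q :- r) refl y w _ _ _ ⟩
        y ^ suc d * w ^ (b ℕ.+ k) - w ^ (suc (b ℕ.+ d) ℕ.+ k) ∎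
        where
        g0 : g 0 ≡ b
        g0 = ≡.trans (g≡ 0) (ℕ.+-identityʳ b)
        top : b ℕ.+ d ∸ g 0 ≡ d
        top = ≡.trans (≡.cong (b ℕ.+ d ∸_) g0) (ℕ.m+n∸m≡n b d)
        rest : ℕ → Carrier
        rest e = ∑ (applyUpTo (g ∘ suc) e) (λ v → y ^ (b ℕ.+ d ∸ v) * w ^ (v ℕ.+ k))
        -- What remains after the first term is a sum of the same shape, with `b` raised and `d`
        -- lowered by one, so that `b + d` is kept.
        tail : ∀ e → e ≡ d → (y - w) * rest e ≈ y ^ d * (w * w ^ (b ℕ.+ k)) - w ^ (suc (b ℕ.+ d) ℕ.+ k)
        tail zero ≡.refl = begin
          (y - w) * 0#  ≈⟨ zeroʳ _ ⟩
          0#  ≈⟨ -‿inverseʳ _ ⟨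
          w * w ^ (b ℕ.+ k) - w * w ^ (b ℕ.+ k)  ≈⟨ +-cong (sym (*-identityˡ _)) (-‿cong (^-congʳ w (≡.cong (λ m → suc m ℕ.+ k) (≡.sym (ℕ.+-identityʳ b))))) ⟩
          1# * (w * w ^ (b ℕ.+ k)) - w ^ (suc (b ℕ.+ zero) ℕ.+ k) ∎
        tail (suc e) ≡.refl = begin
          (y - w) * rest (suc e)
            ≈⟨ *-congˡ (∑-cong (All.universal (λ v → *-congʳ (^-congʳ y (≡.cong (_∸ v) (ℕ.+-suc b e)))) (applyUpTo (g ∘ suc) (suc e)))) ⟩
          (y - w) * ∑ (applyUpTo (g ∘ suc) (suc e)) (λ v → y ^ (suc b ℕ.+ e ∸ v) * w ^ (v ℕ.+ k))
            ≈⟨ telescope e (suc b) k w (g ∘ suc) (λ i → ≡.trans (g≡ (suc i)) (ℕ.+-suc b i)) ⟩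
          y ^ suc e * w ^ (suc b ℕ.+ k) - w ^ (suc (suc b ℕ.+ e) ℕ.+ k)
            ≈⟨ +-congˡ (-‿cong (^-congʳ w (≡.cong (λ m → suc m ℕ.+ k) (≡.sym (ℕ.+-suc b e))))) ⟩
          y ^ suc e * (w * w ^ (b ℕ.+ k)) - w ^ (suc (b ℕ.+ suc e) ℕ.+ k) ∎

      quotient-eq : ∀ {a b} k → b ≤ a → ∀ i →
        D i * quotient a b k i ≈ y ^ (suc a ∸ b) * powers x (b ℕ.+ k) i - powers x (suc a ℕ.+ k) i
      quotient-eq {a} {b} k b≤a i
        rewrite ≡.sym (ℕ.m+[n∸m]≡n b≤a) | ≡.sym (ℕ.+-suc b (a ∸ b)) | ℕ.m+n∸m≡n b (suc (a ∸ b))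
        = telescope (a ∸ b) b k (lookup x i) (b ℕ.+_) (λ _ → ≡.refl)

      -- The column operation leaves a column with first entry 0 and the multiple `- 1# ⊡ q` below.
      -- Its term in the Laplace expansion disappears, and the sign of that multiple cancels the
      -- sign of the remaining term.
      eliminate : {F : List (V n) → Carrier} → IsAlternating F → ∀ {m₁ m₂ d} → m₁ ≡ d ℕ.+ m₂ → ∀ q →
        (∀ i → q i ≈ y ^ d * powers x m₂ i - powers x m₁ i) → ∀ xs →
        laplace F (powers (y ∷ x) m₁ ∷ powers (y ∷ x) m₂ ∷ xs) ≈ laplace (λ ys → F (q ∷ ys)) (powers (y ∷ x) m₂ ∷ xs)
      eliminate {F = F} alt {m₁} {m₂} {d} m₁≡ q q≈ xs = begin
        laplace F (powers (y ∷ x) m₁ ∷ zs)            ≈⟨ headReduce (laplace-isAlternating alt) (y ^ d) split (here ≡.refl) ⟩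
        0# * F (map tl zs) - laplace (λ ys → F (- 1# ⊡ q ∷ ys)) zs
          ≈⟨ +-congˡ (-‿cong (laplace-linear (λ ys → F (- 1# ⊡ q ∷ ys)) (λ _ → 0#) (λ ys → F (q ∷ ys)) (- 1#)
               (λ ys → trans (scale alt (- 1#) q ys) (sym (+-identityˡ _))) zs)) ⟩
        0# * F (map tl zs) - (laplace (λ _ → 0#) zs + - 1# * laplace (λ ys → F (q ∷ ys)) zs)
          ≈⟨ +-cong (zeroˡ _) (-‿cong (+-cong (laplace-vanish _ (λ _ → refl) zs) (-1*x≈-x _))) ⟩
        0# - (0# - laplace (λ ys → F (q ∷ ys)) zs)
          ≈⟨ solve 1 (λ a → con 0ℤ :- (con 0ℤ :- a) := a) refl _ ⟩
        laplace (λ ys → F (q ∷ ys)) zs ∎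
        where
        zs : List (V (suc n))
        zs = powers (y ∷ x) m₂ ∷ xs
        tl : V (suc n) → V n
        tl v i = v (suc i)
        w : V (suc n)
        w zero    = 0#
        w (suc i) = - 1# * q i
        split : powers (y ∷ x) m₁ ≋ w ⊞ y ^ d ⊡ powers (y ∷ x) m₂
        split zero    = trans (trans (^-congʳ y m₁≡) (^-homo-* y d m₂)) (sym (+-identityˡ _))
        split (suc i) = begin
          powers x m₁ i  ≈⟨ solve 2 (λ p r → p := :- (r :- p) :+ r) refl _ _ ⟩
          - (y ^ d * powers x m₂ i - powers x m₁ i) + y ^ d * powers x m₂ i  ≈⟨ +-congʳ (trans (-1*x≈-x _) (-‿cong (q≈ i))) ⟨
          - 1# * q i + y ^ d * powers x m₂ i  ∎

      -- Each column is reduced by its right neighbour, which is still in its original form at that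
      -- moment. The last column has no neighbour and keeps its first-row entry, whence the factor
      -- in front.
      eliminateAll : {F : List (V n) → Carrier} → IsAlternating F → ∀ {κ : Vec ℕ (suc k)} → Linked _≥_ κ →
        laplace F (map (powers (y ∷ x)) (betas κ)) ≈ y ^ Vec.last κ * F (map (D ⊙_) (quotients κ))
      eliminateAll {F = F} alt {a ∷ []} [-] = begin
        y ^ (a ℕ.+ 0) * F [] - 0#  ≈⟨ solve 1 (λ a → a :- con 0ℤ := a) refl _ ⟩
        y ^ (a ℕ.+ 0) * F []       ≈⟨ *-congʳ (^-congʳ y (ℕ.+-identityʳ a)) ⟩
        y ^ a * F []               ∎
      eliminateAll {k = suc k} alt {a ∷ b ∷ κ} (b≤a ∷ rest) = trans
        (eliminate alt {d = suc a ∸ b} exponent (D ⊙ quotient a b k)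
          (λ i → trans (quotient-eq k b≤a i) (+-congˡ (-‿cong (^-congʳ (lookup x i) (≡.sym (ℕ.+-suc a k))))))
          _)
        (eliminateAll (after alt (D ⊙ quotient a b k)) rest)
        where
        exponent : a ℕ.+ suc k ≡ suc a ∸ b ℕ.+ (b ℕ.+ k)
        exponent = ≡.trans (ℕ.+-suc a k) (≡.trans (≡.cong (ℕ._+ k) (≡.sym (ℕ.m∸n+n≡m (ℕ.m≤n⇒m≤1+n b≤a)))) (ℕ.+-assoc (suc a ∸ b) b k))

      -- Multilinearity turns the sums over the single parts into one sum over interlacing ν. The
      -- exponents of `y` collect to Σ (κᵢ - νᵢ) plus the last part of κ, that is, to the size of
      -- the outermost horizontal strip.
      expandQuotients : {F : List (V n) → Carrier} → IsAlternating F → ∀ {κ : Vec ℕ (suc k)} → Linked _≥_ κ →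
        y ^ Vec.last κ * F (quotients κ) ≈
        ∑ (interlacing κ) (λ ν → y ^ (Vec.sum κ ∸ Vec.sum ν) * F (map (powers x) (betas ν)))
      expandQuotients {F = F} alt {a ∷ []} [-] =
        trans (*-congʳ (^-congʳ y (≡.sym (ℕ.+-identityʳ a)))) (sym (+-identityʳ _))
      expandQuotients {k = suc k} {F = F} alt {a ∷ b ∷ κ} (b≤a ∷ rest) = begin
        yˡ * F (quotient a b k ∷ qs)
          ≈⟨ *-congˡ (headSum alt vs (λ v → y ^ (a ∸ v)) (λ v → powers x (v ℕ.+ k)) qs) ⟩
        yˡ * ∑ vs (λ v → y ^ (a ∸ v) * F (powers x (v ℕ.+ k) ∷ qs))
          ≈⟨ *-∑ yˡ vs _ ⟩
        ∑ vs (λ v → yˡ * (y ^ (a ∸ v) * F (powers x (v ℕ.+ k) ∷ qs)))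
          ≈⟨ ∑-cong (All.map inner (between b≤a)) ⟩
        ∑ vs (λ v → ∑ νs (λ ν → y ^ (a ℕ.+ S ∸ (v ℕ.+ Vec.sum ν)) * F (map (powers x) (betas (v ∷ ν)))))
          ≈⟨ ∑-cartesianProductWith _∷_ vs νs (λ ν → y ^ (a ℕ.+ S ∸ Vec.sum ν) * F (map (powers x) (betas ν))) ⟨
        ∑ (cartesianProductWith _∷_ vs νs) (λ ν → y ^ (a ℕ.+ S ∸ Vec.sum ν) * F (map (powers x) (betas ν))) ∎
        where
        yˡ : Carrier
        yˡ = y ^ Vec.last (b ∷ κ)
        S : ℕ
        S = Vec.sum (b ∷ κ)
        vs : List ℕ
        vs = applyUpTo (b ℕ.+_) (suc a ∸ b)
        νs : List (Vec ℕ k)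
        νs = interlacing (b ∷ κ)
        qs : List (V n)
        qs = quotients (b ∷ κ)
        exponent : ∀ {v s} → v ≤ a → s ≤ S → (a ∸ v) ℕ.+ (S ∸ s) ≡ a ℕ.+ S ∸ (v ℕ.+ s)
        exponent {v} {s} v≤a s≤S = ≡.trans (≡.sym (ℕ.+-∸-comm (S ∸ s) v≤a))
          (≡.trans (≡.cong (_∸ v) (≡.sym (ℕ.+-∸-assoc a s≤S)))
          (≡.trans (ℕ.∸-+-assoc (a ℕ.+ S) s v) (≡.cong (a ℕ.+ S ∸_) (ℕ.+-comm s v))))
        inner : ∀ {v} → b ≤ v × v ≤ a → yˡ * (y ^ (a ∸ v) * F (powers x (v ℕ.+ k) ∷ qs)) ≈
                ∑ νs (λ ν → y ^ (a ℕ.+ S ∸ (v ℕ.+ Vec.sum ν)) * F (map (powers x) (betas (v ∷ ν))))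
        inner {v} (_ , v≤a) = begin
          yˡ * (y ^ (a ∸ v) * F (powers x (v ℕ.+ k) ∷ qs))
            ≈⟨ solve 3 (λ p q r → p :* (q :* r) := q :* (p :* r)) refl _ _ _ ⟩
          y ^ (a ∸ v) * (yˡ * F (powers x (v ℕ.+ k) ∷ qs))
            ≈⟨ *-congˡ (expandQuotients (after alt (powers x (v ℕ.+ k))) rest) ⟩
          y ^ (a ∸ v) * ∑ νs (λ ν → y ^ (S ∸ Vec.sum ν) * F (map (powers x) (betas (v ∷ ν))))
            ≈⟨ *-∑ _ νs _ ⟩
          ∑ νs (λ ν → y ^ (a ∸ v) * (y ^ (S ∸ Vec.sum ν) * F (map (powers x) (betas (v ∷ ν)))))
            ≈⟨ ∑-cong (All.map (λ {ν} (_ , s≤) → trans (sym (*-assoc _ _ _)) (*-congʳ (trans (sym (^-homo-* y (a ∸ v) (S ∸ Vec.sum ν))) (^-congʳ y (exponent v≤a s≤)))))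
                 (interlacing-decreasing rest)) ⟩
          ∑ νs (λ ν → y ^ (a ℕ.+ S ∸ (v ℕ.+ Vec.sum ν)) * F (map (powers x) (betas (v ∷ ν)))) ∎

    det-branching : ∀ {κ : Vec ℕ (suc n)} → Linked _≥_ κ →
      det (suc n) (map (powers (y ∷ x)) (betas κ)) ≈
      ∏ D * ∑ (interlacing κ) (λ ν → y ^ (Vec.sum κ ∸ Vec.sum ν) * det n (map (powers x) (betas ν)))
    det-branching {κ} κ↘ = begin
      laplace (det n) (map (powers (y ∷ x)) (betas κ))         ≈⟨ eliminateAll (det-isAlternating n) κ↘ ⟩
      y ^ Vec.last κ * det n (map (D ⊙_) (quotients κ))        ≈⟨ *-congˡ (det-scaleRows n D (quotients κ)) ⟩
      y ^ Vec.last κ * (∏ D * det n (quotients κ))             ≈⟨ solve 3 (λ p q r → p :* (q :* r) := q :* (p :* r)) refl _ _ _ ⟩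
      ∏ D * (y ^ Vec.last κ * det n (quotients κ))             ≈⟨ *-congˡ (expandQuotients (det-isAlternating n) κ↘) ⟩
      _                                                        ∎

  -- Removing the largest letter from tableaux and clearing the first row of the determinant give
  -- the same recursion over interlacing ν, so an induction on the number of variables applies.
  bialternant : ∀ (x : Vec Carrier n) {κ : Vec ℕ n} → Linked _≥_ κ →
    det n (map (powers x) (betas κ)) ≈ vandermonde x * schurSum κ x
  bialternant []      {[]}    _  = sym (trans (*-identityˡ _) (+-identityʳ _))
  bialternant {suc n} (y ∷ x) {κ@(_ ∷ _)} κ↘ = begin
    det (suc n) (map (powers (y ∷ x)) (betas κ))
      ≈⟨ det-branching y x κ↘ ⟩
    P * ∑ (interlacing κ) (λ ν → y ^ (Vec.sum κ ∸ Vec.sum ν) * det n (map (powers x) (betas ν)))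
      ≈⟨ *-congˡ (∑-cong (All.map (λ (a∷ν↘ , _) → *-congˡ (bialternant x (tail↘ a∷ν↘))) (interlacing-decreasing κ↘))) ⟩
    P * ∑ (interlacing κ) (λ ν → y ^ (Vec.sum κ ∸ Vec.sum ν) * (vandermonde x * schurSum ν x))
      ≈⟨ *-congˡ (∑-cong (All.universal (λ ν → solve 3 (λ p q r → p :* (q :* r) := q :* (p :* r)) refl _ _ _) (interlacing κ))) ⟩
    P * ∑ (interlacing κ) (λ ν → vandermonde x * (y ^ (Vec.sum κ ∸ Vec.sum ν) * schurSum ν x))
      ≈⟨ *-congˡ (*-∑ (vandermonde x) (interlacing κ) _) ⟨
    P * (vandermonde x * ∑ (interlacing κ) (λ ν → y ^ (Vec.sum κ ∸ Vec.sum ν) * schurSum ν x))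
      ≈⟨ *-assoc _ _ _ ⟨
    vandermonde (y ∷ x) * ∑ (interlacing κ) (λ ν → y ^ (Vec.sum κ ∸ Vec.sum ν) * schurSum ν x)
      ≈⟨ *-congˡ (schurSum-branching κ y x) ⟨
    vandermonde (y ∷ x) * schurSum κ (y ∷ x) ∎
    where
    P : Carrier
    P = ∏ (λ i → y - lookup x i)
    tail↘ : ∀ {k a} {ν : Vec ℕ k} → Linked _≥_ (a ∷ ν) → Linked _≥_ ν
    tail↘ [-]     = []
    tail↘ (_ ∷ l) = l

  module _ {p} (P : Carrier → Set p) (P1 : P 1#) (P* : ∀ x y → P x → P y → P (x * y)) where

    -- Meant for the predicate of not being a zero divisor, which is thereby reduced to the single
    -- differences of variables.
    vandermonde-closed : {x : Vec Carrier n} → AllPairs (λ a b → P (a - b)) x → P (vandermonde x)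
    vandermonde-closed []       = P1
    vandermonde-closed (r ∷ rs) = P* _ _ (product r) (vandermonde-closed rs)
      where
      product : ∀ {k y} {x : Vec Carrier k} → VecAll.All (λ b → P (y - b)) x → P (∏ (λ i → y - lookup x i))
      product VecAll.[]         = P1
      product (px VecAll.∷ pxs) = P* _ _ px (product pxs)

  betas-tabulate : (κ : Vec ℕ n) → betas κ ≡ List.tabulate (λ j → lookup κ j ℕ.+ (n ∸ suc (toℕ j)))
  betas-tabulate []      = ≡.refl
  betas-tabulate (_ ∷ κ) = ≡.cong (_ ∷_) (betas-tabulate κ)

-- Residue classes of the β-numbers: pigeonhole arguments and column positions.

module Combinatorics where
  open import Defs
  open import Level using (Level)
  open import Data.Bool.Base using (true; false)
  open import Data.Fin.Base as Fin using (Fin; zero; suc; toℕ)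
  import Data.Fin.Properties as Fin
  open import Data.List.Base as List using (List; []; _∷_; [_]; _++_; allFin; filter; length; map; tabulate; upTo)
  import Data.List.Properties as List
  open import Data.List.Membership.Propositional using (_∈_; _∉_)
  open import Data.List.Membership.DecPropositional using () renaming (_∈?_ to decMember)
  open import Data.List.Membership.Propositional.Properties
    using (∈-∃++; ∈-++⁺ʳ; ∈-allFin; ∈-filter⁺; ∈-filter⁻; ∈-map⁺; ∈-map⁻; ∈-upTo⁺; ∈-upTo⁻)
  open import Data.List.Relation.Binary.Permutation.Propositional as ↭ using (_↭_; ↭-sym; ↭-refl)
  import Data.List.Relation.Binary.Permutation.Propositional.Properties as ↭
  open import Data.List.Relation.Unary.All as All using (All; []; _∷_)
  import Data.List.Relation.Unary.All.Properties as All
  open import Data.List.Relation.Unary.AllPairs using (AllPairs; []; _∷_)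
  import Data.List.Relation.Unary.AllPairs.Properties as AllPairs
  open import Data.List.Relation.Unary.Any using (here; there)
  open import Data.List.Relation.Unary.Unique.Propositional using (Unique)
  open import Data.List.Relation.Unary.Unique.Propositional.Properties using (upTo⁺)
  open import Data.Nat.Base as ℕ using (ℕ; zero; suc; _≤_; _<_; _≥_; NonZero; s≤s; z≤n)
  open import Data.Nat.DivMod using (_%_; m%n<n)
  import Data.Nat.Properties as ℕ
  open import Data.Product.Base using (Σ-syntax; ∃-syntax; _×_; _,_; proj₁; proj₂)
  open import Data.Sum.Base using (_⊎_; inj₁; inj₂)
  open import Data.Vec.Base as Vec using (Vec; []; _∷_)
  open import Data.Vec.Relation.Unary.Linked using (Linked; _∷_)
  open import Function.Base using (_∘_)
  open import Relation.Binary.Definitions using (tri<; tri≈; tri>)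
  open import Relation.Binary.PropositionalEquality.Core using (_≡_; _≢_; refl; sym; trans; cong; subst)
  open import Relation.Nullary.Decidable.Core using (yes; no; ¬?; _×-dec_)
  open import Relation.Nullary.Negation.Core using (¬_; contradiction)
  open import Relation.Unary using (Pred; Decidable)

  private
    variable
      p : Level
      A : Set
      n : ℕ

  -- The excess `zs` is what the applications study: a count of lengths makes it impossible, empty
  -- or of length two.
  unique-⊆-↭ : {xs ys : List A} → Unique xs → (∀ {x} → x ∈ xs → x ∈ ys) → ∃[ zs ] ys ↭ xs ++ zs
  unique-⊆-↭ {xs = []}     {ys} _          _ = ys , ↭-refl
  unique-⊆-↭ {xs = x ∷ xs} (x≢ ∷ xs!) xs⊆ys with ∈-∃++ (xs⊆ys (here refl))
  ... | us , vs , refl with unique-⊆-↭ xs! sub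
    where
    sub : ∀ {y} → y ∈ xs → y ∈ us ++ vs
    sub y∈xs with ↭.∈-resp-↭ (↭.shift x us vs) (xs⊆ys (there y∈xs))
    ... | here refl = contradiction refl (All.lookup x≢ y∈xs)
    ... | there y∈  = y∈
  ... | zs , p = zs , ↭.trans (↭.shift x us vs) (↭.prep x p)

  -- The data for one subtraction of columns. The entry `x` is split off, while its partner stays in
  -- `rest`, where the next collision is sought.
  record Collision (key : A → ℕ) (xs : List A) : Set where
    constructor collision
    field
      {x x′}  : A
      {rest}  : List A
      found   : xs ↭ x ∷ rest
      x′∈     : x′ ∈ rest
      sameKey : key x ≡ key x′

  unique⊎collision : (key : A → ℕ) (xs : List A) → Unique (map key xs) ⊎ Collision key xs
  unique⊎collision key []       = inj₁ []
  unique⊎collision key (x ∷ xs) with decMember ℕ._≟_ (key x) (map key xs) | unique⊎collision key xs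
  ... | yes k∈ | _ with y , y∈ , e ← ∈-map⁻ key k∈ = inj₂ (collision ↭-refl y∈ e)
  ... | no k∉  | inj₁ xs! = inj₁ (All.tabulate (λ y∈ e → k∉ (subst (_∈ map key xs) (sym e) y∈)) ∷ xs!)
  ... | no _   | inj₂ (collision p x′∈ e) = inj₂ (collision (↭.trans (↭.prep x p) (↭.swap x _ ↭-refl)) (there x′∈) e)

  -- Pigeonhole: without a collision, `r` and the keys would be more than `t` distinct numbers below
  -- `t`.
  missing⇒collision : ∀ {t r} (key : A → ℕ) (xs : List A) → r < t → All (λ x → key x < t) xs →
                      r ∉ map key xs → t ≤ length xs → Collision key xs
  missing⇒collision {t = t} {r} key xs r<t key<t r∉ t≤ with unique⊎collision key xs
  ... | inj₂ c   = c
  ... | inj₁ xs! with unique-⊆-↭ {ys = upTo t} (All.tabulate (λ y∈ e → r∉ (subst (_∈ map key xs) (sym e) y∈)) ∷ xs!) sub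
    where
    sub : ∀ {y} → y ∈ r ∷ map key xs → y ∈ upTo t
    sub (here refl) = ∈-upTo⁺ r<t
    sub (there y∈) with x , x∈ , refl ← ∈-map⁻ key y∈ = ∈-upTo⁺ (All.lookup key<t x∈)
  ... | zs , p = contradiction (trans (sym (List.length-upTo t)) (↭.↭-length p)) (ℕ.<⇒≢ (s≤s long))
    where
    long : t ≤ length (map key xs ++ zs)
    long = subst (t ≤_) (sym (trans (List.length-++ (map key xs)) (cong (ℕ._+ length zs) (List.length-map key xs))))
      (ℕ.≤-trans t≤ (ℕ.m≤m+n _ _))

  module _ {P : Pred A p} (P? : Decidable P) where

    split₁ : (f : Fin n → A) (b : Fin n) → ¬ P (f b) → (∀ i → i ≢ b → P (f i)) →
      Σ[ pre ∈ List A ] Σ[ post ∈ List A ] (tabulate f ≡ pre ++ f b ∷ post × length pre ≡ toℕ b ×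
        filter P? (tabulate f) ≡ pre ++ post)
    split₁ f zero ¬Pb Pi = [] , tabulate (f ∘ suc) , refl , refl ,
      trans (List.filter-reject P? ¬Pb) (List.filter-all P? (All.tabulate⁺ (λ i → Pi (suc i) (λ ()))))
    split₁ f (suc b) ¬Pb Pi with split₁ (f ∘ suc) b ¬Pb (λ i i≢ → Pi (suc i) (i≢ ∘ Fin.suc-injective))
    ... | pre , post , e , l , g = f zero ∷ pre , post , cong (f zero ∷_) e , cong suc l ,
      trans (List.filter-accept P? (Pi zero (λ ()))) (cong (f zero ∷_) g)

    -- Ties the list filtered by the word b_S to the positions of the two omitted columns; the
    -- lengths of the prefixes yield the signs of pulling these columns to the front.
    split₂ : (f : Fin n → A) {a b : Fin n} → a Fin.< b → ¬ P (f a) → ¬ P (f b) → (∀ i → i ≢ a → i ≢ b → P (f i)) →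
      Σ[ pre ∈ List A ] Σ[ mid ∈ List A ] Σ[ post ∈ List A ] (tabulate f ≡ pre ++ f a ∷ mid ++ f b ∷ post ×
        length pre ≡ toℕ a × length (pre ++ f a ∷ mid) ≡ toℕ b × filter P? (tabulate f) ≡ pre ++ mid ++ post)
    split₂ f {zero} {suc b} _ ¬Pa ¬Pb Pi with split₁ (f ∘ suc) b ¬Pb (λ i i≢ → Pi (suc i) (λ ()) (i≢ ∘ Fin.suc-injective))
    ... | mid , post , e , l , g = [] , mid , post , cong (f zero ∷_) e , refl , cong suc l , trans (List.filter-reject P? ¬Pa) g
    split₂ f {suc a} {suc b} (s≤s a<b) ¬Pa ¬Pb Pi
      with split₂ (f ∘ suc) a<b ¬Pa ¬Pb (λ i i≢a i≢b → Pi (suc i) (i≢a ∘ Fin.suc-injective) (i≢b ∘ Fin.suc-injective))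
    ... | pre , mid , post , e , l , l′ , g = f zero ∷ pre , mid , post , cong (f zero ∷_) e , cong suc l , cong suc l′ ,
      trans (List.filter-accept P? (Pi zero (λ ()) (λ ()))) (cong (f zero ∷_) g)

  occurrences : ℕ → List ℕ → ℕ
  occurrences r w = length (filter (ℕ._≟ r) w)

  occurrences-unique : ∀ {r w} → Unique w → r ∈ w → occurrences r w ≡ 1
  occurrences-unique {w = x ∷ w} (x≢ ∷ _) (here refl) =
    trans (cong length (List.filter-accept (ℕ._≟ x) refl))
          (cong (suc ∘ length) (List.filter-none (ℕ._≟ x) (All.map (λ x≢y y≡x → x≢y (sym y≡x)) x≢)))
  occurrences-unique {r} {x ∷ w} (x≢ ∷ w!) (there r∈) =
    trans (cong length (List.filter-reject (ℕ._≟ r) (All.lookup x≢ r∈))) (occurrences-unique w! r∈)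

  occurrences-map : ∀ (key : A → ℕ) r xs → occurrences r (map key xs) ≡ length (filter (λ x → key x ℕ.≟ r) xs)
  occurrences-map key r []       = refl
  occurrences-map key r (x ∷ xs) with key x ℕ.≡ᵇ r
  ... | true  = cong suc (occurrences-map key r xs)
  ... | false = occurrences-map key r xs

  lookup-decreasing : ∀ {κ : Vec ℕ n} → Linked _≥_ κ → ∀ {i j} → i Fin.< j → Vec.lookup κ j ≤ Vec.lookup κ i
  lookup-decreasing {κ = _ ∷ _ ∷ _} (r ∷ l) {zero}  {suc zero}    _   = r
  lookup-decreasing {κ = _ ∷ _ ∷ _} (r ∷ l) {zero}  {suc (suc j)} _   = ℕ.≤-trans (lookup-decreasing l (s≤s z≤n)) r
  lookup-decreasing {κ = _ ∷ _ ∷ _} (r ∷ l) {suc i} {suc j} (s≤s i<j) = lookup-decreasing l i<j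

  module Columns (t : ℕ) .{{_ : NonZero t}} (κ : Partition (t ℕ.+ 2)) where
    open Beta t κ

    key : Fin N → ℕ
    key j = β j % t

    key<t : ∀ j → key j < t
    key<t j = m%n<n (β j) t

    β-decreasing : ∀ {i j} → i Fin.< j → β j < β i
    β-decreasing {i} {j} i<j =
      ℕ.+-mono-≤-< (lookup-decreasing (Partition.decreasing κ) i<j) (ℕ.∸-monoʳ-< (s≤s i<j) (Fin.toℕ<n j))

    -- What the determinant needs to know of an arrangement, the same for two pairs and for a
    -- triple. The equality `a₂ ≡ b₁` is left open, as it holds in a triple.
    record Arranged (a₁ a₂ b₁ b₂ : Fin N) : Set where
      field
        a₁<a₂  : a₁ Fin.< a₂
        b₁<b₂  : b₁ Fin.< b₂
        a₁≢b₁  : a₁ ≢ b₁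
        a₁≢b₂  : a₁ ≢ b₂
        keyA   : key a₁ ≡ key a₂
        keyB   : key b₁ ≡ key b₂

    private
      class-sorted : ∀ r → AllPairs Fin._<_ (residueClass r)
      class-sorted r = AllPairs.filter⁺ (λ j → β j % t ℕ.≟ toℕ r) (AllPairs.tabulate⁺-< (λ i<j → i<j))

      class-key : ∀ {r j js} → residueClass r ≡ js → j ∈ js → key j ≡ toℕ r
      class-key {r} refl j∈ = proj₂ (∈-filter⁻ (λ j → β j % t ℕ.≟ toℕ r) {xs = allFin N} j∈)

    arranged : ∀ {a₁ a₂ b₁ b₂} → Arrangement a₁ a₂ b₁ b₂ → Arranged a₁ a₂ b₁ b₂
    arranged (twoPairs rA rB rA<rB eA eB)
      with (a₁<a₂ ∷ []) ∷ _ ← subst (AllPairs Fin._<_) eA (class-sorted rA)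
         | (b₁<b₂ ∷ []) ∷ _ ← subst (AllPairs Fin._<_) eB (class-sorted rB) = record
      { a₁<a₂ = a₁<a₂ ; b₁<b₂ = b₁<b₂
      ; a₁≢b₁ = λ { refl → clash (sym kA) kB }
      ; a₁≢b₂ = λ { refl → clash (sym kA) (class-key eB (there (here refl))) }
      ; keyA = trans kA (sym (class-key eA (there (here refl))))
      ; keyB = trans kB (sym (class-key eB (there (here refl)))) }
      where
      kA = class-key eA (here refl)
      kB = class-key eB (here refl)
      clash : ∀ {k} → toℕ rA ≡ k → ¬ k ≡ toℕ rB
      clash refl e = ℕ.<⇒≢ rA<rB e
    arranged (oneTriple r e)
      with (p<q ∷ p<s ∷ []) ∷ (q<s ∷ []) ∷ _ ← subst (AllPairs Fin._<_) e (class-sorted r) = record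
      { a₁<a₂ = p<q ; b₁<b₂ = q<s ; a₁≢b₁ = Fin.<⇒≢ p<q ; a₁≢b₂ = Fin.<⇒≢ p<s
      ; keyA = trans (class-key e (here refl)) (sym (class-key e (there (here refl))))
      ; keyB = trans (class-key e (there (here refl))) (sym (class-key e (there (there (here refl))))) }

    outside? : ∀ a₁ b₁ → Decidable (λ (j : Fin N) → j ≢ a₁ × j ≢ b₁)
    outside? a₁ b₁ j = ¬? (j Fin.≟ a₁) ×-dec ¬? (j Fin.≟ b₁)

    outside : Fin N → Fin N → List (Fin N)
    outside a₁ b₁ = filter (outside? a₁ b₁) (allFin N)

    ∈-outside : ∀ {a₁ b₁ j} → j ≢ a₁ → j ≢ b₁ → j ∈ outside a₁ b₁
    ∈-outside {a₁} {b₁} {j} j≢a j≢b = ∈-filter⁺ (outside? a₁ b₁) (∈-allFin j) (j≢a , j≢b)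

    -- Here `x` and `y` are `a₁` and `b₁` in the order of their columns, which depends on the
    -- partition.
    record Around (a₁ b₁ x y : Fin N) : Set where
      field
        pre mid post : List (Fin N)
        all≡     : allFin N ≡ pre ++ x ∷ mid ++ y ∷ post
        outside≡ : outside a₁ b₁ ≡ pre ++ mid ++ post
        pre#     : length pre ≡ toℕ x
        premid#  : length (pre ++ x ∷ mid) ≡ toℕ y

    around : ∀ a₁ b₁ → a₁ ≢ b₁ → (a₁ Fin.< b₁ × Around a₁ b₁ a₁ b₁) ⊎ (b₁ Fin.< a₁ × Around a₁ b₁ b₁ a₁)
    around a₁ b₁ a≢b with Fin.<-cmp a₁ b₁
    ... | tri≈ _ a≡b _ = contradiction a≡b a≢b
    ... | tri< a<b _ _ with split₂ (outside? a₁ b₁) (λ i → i) a<b (λ o → proj₁ o refl) (λ o → proj₂ o refl) (λ i p q → p , q)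
    ...   | pre , mid , post , e , l , l′ , g = inj₁ (a<b , record { all≡ = e ; outside≡ = g ; pre# = l ; premid# = l′ })
    around a₁ b₁ a≢b | tri> _ _ b<a with split₂ (outside? a₁ b₁) (λ i → i) b<a (λ o → proj₂ o refl) (λ o → proj₁ o refl) (λ i p q → q , p)
    ...   | pre , mid , post , e , l , l′ , g = inj₂ (b<a , record { all≡ = e ; outside≡ = g ; pre# = l ; premid# = l′ })

    around-length : ∀ {a₁ b₁ x y} → Around a₁ b₁ x y → length (outside a₁ b₁) ≡ t
    around-length {x = x} {y} ar = ℕ.+-cancelʳ-≡ 2 _ t (trans (sym total) (List.length-tabulate {n = N} (λ i → i)))
      where
      open Around ar
      total : length (allFin N) ≡ length (outside _ _) ℕ.+ 2
      total = trans (↭.↭-length perm) (trans (cong (2 ℕ.+_) (cong length (sym outside≡))) (ℕ.+-comm 2 _))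
        where
        perm : allFin N ↭ x ∷ y ∷ pre ++ mid ++ post
        perm = ↭.trans (↭.↭-reflexive all≡) (↭.trans (↭.shift x pre _) (↭.prep x
          (↭.trans (↭.++⁺ˡ pre (↭.shift y mid post)) (↭.shift y pre _))))

    class-inhabited : ∀ r → residueClass r ≢ [] → ∃[ j ] key j ≡ toℕ r
    class-inhabited r ≢[] with residueClass r in eq
    ... | []    = contradiction refl ≢[]
    ... | j ∷ _ = j , class-key {r} eq (here refl)

    -- Every residue survives the removal of `a₁` and `b₁`: that of `b₁` is still represented by
    -- `b₂`, and that of `a₁` by `a₂`, or again by `b₂` if `a₂` is `b₁`. The word has `t` letters,
    -- so each residue occurs exactly once.
    word-↭ : ∀ {a₁ a₂ b₁ b₂} → (∀ r → residueClass r ≢ []) → Arranged a₁ a₂ b₁ b₂ → wordS a₁ b₁ ↭ upTo t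
    word-↭ {a₁} {a₂} {b₁} {b₂} noEmpty arr with unique-⊆-↭ {ys = wordS a₁ b₁} (upTo⁺ t) sub
      where
      open Arranged arr
      b₂∈ : b₂ ∈ outside a₁ b₁
      b₂∈ = ∈-outside (a₁≢b₂ ∘ sym) (Fin.<⇒≢ b₁<b₂ ∘ sym)
      hit : ∀ j → key j ∈ wordS a₁ b₁
      hit j with j Fin.≟ a₁ | j Fin.≟ b₁
      ... | no j≢a   | no j≢b   = ∈-map⁺ key (∈-outside j≢a j≢b)
      ... | _        | yes refl = subst (_∈ _) (sym keyB) (∈-map⁺ key b₂∈)
      ... | yes refl | no _ with a₂ Fin.≟ b₁
      ...   | yes refl = subst (_∈ _) (sym (trans keyA keyB)) (∈-map⁺ key b₂∈)
      ...   | no a₂≢b  = subst (_∈ _) (sym keyA) (∈-map⁺ key (∈-outside (Fin.<⇒≢ a₁<a₂ ∘ sym) a₂≢b))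
      sub : ∀ {r} → r ∈ upTo t → r ∈ wordS a₁ b₁
      sub {r} r∈ with class-inhabited r′ (noEmpty r′)
        where r′ = Fin.fromℕ< (∈-upTo⁻ r∈)
      ... | j , e = subst (_∈ wordS a₁ b₁) (trans e (Fin.toℕ-fromℕ< (∈-upTo⁻ r∈))) (hit j)
    ... | zs , p = finish zs p
      where
      word-length : length (wordS a₁ b₁) ≡ t
      word-length with around a₁ b₁ (Arranged.a₁≢b₁ arr)
      ... | inj₁ (_ , ar) = trans (List.length-map key (outside a₁ b₁)) (around-length ar)
      ... | inj₂ (_ , ar) = trans (List.length-map key (outside a₁ b₁)) (around-length ar)
      finish : ∀ zs → wordS a₁ b₁ ↭ upTo t ++ zs → wordS a₁ b₁ ↭ upTo t
      finish []       p = subst (wordS a₁ b₁ ↭_) (List.++-identityʳ (upTo t)) p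
      finish (z ∷ zs) p = contradiction
        (trans (sym word-length) (trans (↭.↭-length p) (trans (List.length-++ (upTo t)) (cong (ℕ._+ suc (length zs)) (List.length-upTo t)))))
        (ℕ.<⇒≢ (ℕ.m<m+n t (s≤s z≤n)))

    -- The keys consist of every residue once and of two extra ones, and a class has one element
    -- more than its residue has occurrences among the extras. Distinct extras give two pairs, equal
    -- ones a triple.
    arrangement-exists : (∀ r → residueClass r ≢ []) →
      Σ[ a₁ ∈ Fin N ] Σ[ a₂ ∈ Fin N ] Σ[ b₁ ∈ Fin N ] Σ[ b₂ ∈ Fin N ] Arrangement a₁ a₂ b₁ b₂
    arrangement-exists noEmpty with unique-⊆-↭ {ys = map key (allFin N)} (upTo⁺ t) sub
      where
      sub : ∀ {r} → r ∈ upTo t → r ∈ map key (allFin N)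
      sub {r} r∈ with class-inhabited r′ (noEmpty r′)
        where r′ = Fin.fromℕ< (∈-upTo⁻ r∈)
      ... | j , e = subst (_∈ map key (allFin N)) (trans e (Fin.toℕ-fromℕ< (∈-upTo⁻ r∈))) (∈-map⁺ key (∈-allFin j))
    ... | zs , p = extra zs p length-zs
      where
      length-zs : length zs ≡ 2
      length-zs = ℕ.+-cancelˡ-≡ t _ 2 (trans (cong (ℕ._+ length zs) (sym (List.length-upTo t)))
        (trans (sym (List.length-++ (upTo t))) (trans (sym (↭.↭-length p))
          (trans (List.length-map key (allFin N)) (List.length-tabulate {n = N} (λ i → i))))))
      class-length : ∀ {zs} → map key (allFin N) ↭ upTo t ++ zs → ∀ r → length (residueClass r) ≡ suc (occurrences (toℕ r) zs)
      class-length {zs} p r =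
        trans (sym (occurrences-map key (toℕ r) (allFin N)))
        (trans (↭.↭-length (↭.filter-↭ (ℕ._≟ toℕ r) p))
        (trans (cong length (List.filter-++ (ℕ._≟ toℕ r) (upTo t) zs))
        (trans (List.length-++ (filter (ℕ._≟ toℕ r) (upTo t)))
               (cong (ℕ._+ occurrences (toℕ r) zs) (occurrences-unique (upTo⁺ t) (∈-upTo⁺ (Fin.toℕ<n r)))))))
      bound : ∀ {z zs} → map key (allFin N) ↭ upTo t ++ zs → z ∈ zs → z < t
      bound {z} {zs} p z∈ with j , _ , refl ← ∈-map⁻ key (↭.∈-resp-↭ (↭-sym p) (∈-++⁺ʳ (upTo t) z∈)) = key<t j
      pair : ∀ {rA rB} → toℕ rA < toℕ rB → length (residueClass rA) ≡ 2 → length (residueClass rB) ≡ 2 →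
        Σ[ a₁ ∈ Fin N ] Σ[ a₂ ∈ Fin N ] Σ[ b₁ ∈ Fin N ] Σ[ b₂ ∈ Fin N ] Arrangement a₁ a₂ b₁ b₂
      pair {rA} {rB} lt lA lB with residueClass rA in eA | residueClass rB in eB
      pair {rA} {rB} lt _ _ | a₁ ∷ a₂ ∷ [] | b₁ ∷ b₂ ∷ [] = a₁ , a₂ , b₁ , b₂ , twoPairs rA rB lt eA eB
      triple : ∀ {r} → length (residueClass r) ≡ 3 →
        Σ[ a₁ ∈ Fin N ] Σ[ a₂ ∈ Fin N ] Σ[ b₁ ∈ Fin N ] Σ[ b₂ ∈ Fin N ] Arrangement a₁ a₂ b₁ b₂
      triple {r} l with residueClass r in e
      triple {r} _ | i ∷ j ∷ k ∷ [] = i , j , j , k , oneTriple r e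
      extra : ∀ zs → map key (allFin N) ↭ upTo t ++ zs → length zs ≡ 2 →
        Σ[ a₁ ∈ Fin N ] Σ[ a₂ ∈ Fin N ] Σ[ b₁ ∈ Fin N ] Σ[ b₂ ∈ Fin N ] Arrangement a₁ a₂ b₁ b₂
      extra (r ∷ s ∷ []) p _ = cases (ℕ.<-cmp r s)
        where
        r<t = bound p (here refl)
        s<t = bound p (there (here refl))
        rF = Fin.fromℕ< r<t
        sF = Fin.fromℕ< s<t
        r≡ : toℕ rF ≡ r
        r≡ = Fin.toℕ-fromℕ< r<t
        s≡ : toℕ sF ≡ s
        s≡ = Fin.toℕ-fromℕ< s<t
        at : ∀ (x : Fin t) {y} → toℕ x ≡ y → length (residueClass x) ≡ suc (occurrences y (r ∷ s ∷ []))
        at x refl = class-length p x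
        once : r ≢ s → occurrences r (r ∷ s ∷ []) ≡ 1 × occurrences s (r ∷ s ∷ []) ≡ 1
        once r≢s = occurrences-unique u (here refl) , occurrences-unique u (there (here refl))
          where
          u : Unique (r ∷ s ∷ [])
          u = (r≢s ∷ []) ∷ [] ∷ []
        twice : r ≡ s → occurrences r (r ∷ s ∷ []) ≡ 2
        twice refl = cong length (List.filter-all (ℕ._≟ r) (refl ∷ refl ∷ []))
        cases : _ → _
        cases (tri< r<s r≢s _) = pair {rF} {sF} (subst (_< toℕ sF) (sym r≡) (subst (r <_) (sym s≡) r<s))
          (trans (at rF r≡) (cong suc (proj₁ (once r≢s)))) (trans (at sF s≡) (cong suc (proj₂ (once r≢s))))
        cases (tri> _ r≢s s<r) = pair {sF} {rF} (subst (_< toℕ rF) (sym s≡) (subst (s <_) (sym r≡) s<r))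
          (trans (at sF s≡) (cong suc (proj₂ (once r≢s)))) (trans (at rF r≡) (cong suc (proj₁ (once r≢s))))
        cases (tri≈ _ r≡s _) = triple {rF} (trans (at rF r≡) (cong suc (twice r≡s)))

-- An alternating form at columns that depend on residues modulo a plane.

module ResidueDeterminant {c ℓ} (R : CommutativeRing c ℓ) where
  open import Defs
  open import Data.Fin.Base as Fin using (Fin; toℕ)
  import Data.Fin.Properties as Fin
  open import Data.Integer.Base as ℤ using (ℤ; +_; _⊖_; 0ℤ; 1ℤ; -1ℤ)
  import Data.Integer.Properties as ℤ
  open import Data.List.Base as List using (List; []; _∷_; _++_; allFin; length; map; upTo)
  import Data.List.Properties as List
  open import Data.List.Membership.Propositional using (_∈_; _∉_)
  open import Data.List.Membership.Propositional.Properties using (∈-map⁺; ∈-map⁻; ∈-filter⁺; ∈-allFin)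
  import Data.List.Relation.Binary.Permutation.Propositional.Properties as ↭
  open import Data.List.Relation.Binary.Permutation.Propositional using (_↭_; ↭-sym)
  import Data.List.Relation.Unary.All as All
  open import Data.List.Relation.Unary.Any using (here; there)
  open import Data.Nat.Base as ℕ using (ℕ; zero; suc; NonZero)
  import Data.Nat.Properties as ℕ
  open import Data.Product.Base using (_,_)
  open import Data.Sum.Base using (inj₁; inj₂)
  open import Function.Base using (_∘_)
  open import Relation.Binary.PropositionalEquality.Core as ≡ using (_≡_; _≢_)
  open import Relation.Nullary.Decidable.Core using (yes; no)
  open CommutativeRing R hiding (zero)
  open IntegerImage R
  open AlternatingForms R
  open Combinatorics
  open import Relation.Binary.Reasoning.Setoid setoid

  sign-square : ∀ k → sign k * sign k ≈ 1#
  sign-square zero    = trans (*-cong ι-1 ι-1) (*-identityˡ 1#)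
  sign-square (suc k) = begin
    sign (suc k) * sign (suc k)  ≈⟨ *-cong (sign-suc k) (sign-suc k) ⟩
    - sign k * - sign k          ≈⟨ solve 1 (λ s → :- s :* :- s := s :* s) refl (sign k) ⟩
    sign k * sign k              ≈⟨ sign-square k ⟩
    1#                           ∎

  sgn-⊖-> : ∀ {m n} → n ℕ.< m → sgn (m ⊖ n) ≡ 1ℤ
  sgn-⊖-> {m} {n} n<m with m ℕ.∸ n | ℕ.m<n⇒0<n∸m n<m | ℤ.⊖-≥ (ℕ.<⇒≤ n<m)
  ... | suc _ | _ | e = ≡.cong sgn e

  sgn-⊖-< : ∀ {m n} → m ℕ.< n → sgn (m ⊖ n) ≡ -1ℤ
  sgn-⊖-< {m} {n} m<n with n ℕ.∸ m | ℕ.m<n⇒0<n∸m m<n | ℤ.⊖-≤ (ℕ.<⇒≤ m<n)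
  ... | suc _ | _ | e = ≡.cong sgn e

  module _ {B : Set} {n} (key : B → ℕ) (v : B → V n) (u : ℕ → V n) (p q : B → Carrier) (e e′ : V n)
           (v≋ : ∀ j → v j ≋ u (key j) ⊞ p j ⊡ e ⊞ q j ⊡ e′) where

    difference : B → B → V n
    difference j k = (p j - p k) ⊡ e ⊞ (q j - q k) ⊡ e′

    wedge : B → B → B → B → Carrier
    wedge a₁ a₂ b₁ b₂ = (p a₁ - p a₂) * (q b₁ - q b₂) - (q a₁ - q a₂) * (p b₁ - p b₂)

    subtract : {F : List (V n) → Carrier} → IsAlternating F → ∀ {j k xs} → key j ≡ key k → k ∈ xs →
               F (v j ∷ map v xs) ≈ F (difference j k ∷ map v xs)
    subtract alt {j} {k} same k∈ = headReduce alt 1# split (∈-map⁺ v k∈)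
      where
      split : v j ≋ difference j k ⊞ 1# ⊡ v k
      split i = begin
        v j i
          ≈⟨ v≋ j i ⟩
        u (key j) i + p j * e i + q j * e′ i
          ≡⟨ ≡.cong (λ r → u r i + p j * e i + q j * e′ i) same ⟩
        u (key k) i + p j * e i + q j * e′ i
          ≈⟨ solve 7 (λ w p q p′ q′ e e′ → w :+ p :* e :+ q :* e′ := ((p :- p′) :* e :+ (q :- q′) :* e′) :+ (w :+ p′ :* e :+ q′ :* e′)) refl _ (p j) (q j) (p k) (q k) (e i) (e′ i) ⟩
        (p j - p k) * e i + (q j - q k) * e′ i + (u (key k) i + p k * e i + q k * e′ i)
          ≈⟨ +-congˡ (trans (sym (v≋ k i)) (sym (*-identityˡ _))) ⟩
        (p j - p k) * e i + (q j - q k) * e′ i + 1# * v k i ∎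

    -- Once e and e′ are columns, the remaining ones only matter modulo e and e′.
    residues : {G : List (V n) → Carrier} → IsAlternating G → (∀ xs → G (e ∷ xs) ≈ 0#) → (∀ xs → G (e′ ∷ xs) ≈ 0#) →
               ∀ xs → G (map v xs) ≈ G (map u (map key xs))
    residues alt Ge Ge′ [] = refl
    residues {G} alt Ge Ge′ (j ∷ xs) = begin
      G (v j ∷ map v xs)
        ≈⟨ headCong alt (v≋ j) _ ⟩
      G (u (key j) ⊞ p j ⊡ e ⊞ q j ⊡ e′ ∷ map v xs)
        ≈⟨ IsAlternating.linear alt [] _ (q j) e′ _ ⟩
      G (u (key j) ⊞ p j ⊡ e ∷ map v xs) + q j * G (e′ ∷ map v xs)
        ≈⟨ +-cong (IsAlternating.linear alt [] _ (p j) e _) (*-congˡ (Ge′ _)) ⟩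
      G (u (key j) ∷ map v xs) + p j * G (e ∷ map v xs) + q j * 0#
        ≈⟨ +-congʳ (+-congˡ (*-congˡ (Ge _))) ⟩
      G (u (key j) ∷ map v xs) + p j * 0# + q j * 0#
        ≈⟨ solve 3 (λ g p q → g :+ p :* con 0ℤ :+ q :* con 0ℤ := g) refl _ _ _ ⟩
      G (u (key j) ∷ map v xs)
        ≈⟨ residues (after alt (u (key j))) (still Ge) (still Ge′) xs ⟩
      G (u (key j) ∷ map u (map key xs)) ∎
      where
      still : ∀ {f} → (∀ xs → G (f ∷ xs) ≈ 0#) → ∀ xs → G (u (key j) ∷ f ∷ xs) ≈ 0#
      still {f} Gf xs = trans (headSwap alt (u (key j)) f xs) (trans (-‿cong (Gf _)) -0#≈0#)

    -- The column of `a₁` is reduced while that of `b₁` is still in place, so `a₂` may be `b₁`; only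
    -- afterwards is `b₁` reduced by `b₂`. This covers the class of three elements.
    twoPairs-value : {F : List (V n) → Carrier} → IsAlternating F → ∀ {a₁ a₂ b₁ b₂ xs} →
      key a₁ ≡ key a₂ → key b₁ ≡ key b₂ → a₂ ∈ b₁ ∷ xs → b₂ ∈ xs →
      F (v a₁ ∷ v b₁ ∷ map v xs) ≈ wedge a₁ a₂ b₁ b₂ * F (e ∷ e′ ∷ map u (map key xs))
    twoPairs-value {F} alt {a₁} {a₂} {b₁} {b₂} {xs} keyA keyB a₂∈ b₂∈ = begin
      F (v a₁ ∷ v b₁ ∷ map v xs)
        ≈⟨ subtract alt keyA a₂∈ ⟩
      F (difference a₁ a₂ ∷ v b₁ ∷ map v xs)
        ≈⟨ subtract (after alt (difference a₁ a₂)) keyB b₂∈ ⟩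
      F (difference a₁ a₂ ∷ difference b₁ b₂ ∷ map v xs)
        ≈⟨ expand₂ alt (p a₁ - p a₂) (q a₁ - q a₂) (p b₁ - p b₂) (q b₁ - q b₂) e e′ (map v xs) ⟩
      wedge a₁ a₂ b₁ b₂ * F (e ∷ e′ ∷ map v xs)
        ≈⟨ *-congˡ (residues (after (after alt e) e′)
             (λ ys → vanish-∈ alt (there (here ≡.refl))) (λ ys → IsAlternating.alternating alt (e ∷ []) e′ ys) xs) ⟩
      wedge a₁ a₂ b₁ b₂ * F (e ∷ e′ ∷ map u (map key xs)) ∎

    private
      peel : {F : List (V n) → Carrier} → IsAlternating F → ∀ {xs} (c : Collision key xs) → let open Collision c in
             F (difference x x′ ∷ map v rest) ≈ 0# → F (map v xs) ≈ 0#
      peel alt c F≈0 = vanish-↭ alt (↭.map⁺ v (↭-sym found)) (trans (subtract alt sameKey x′∈) F≈0)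
        where open Collision c

    -- Three collisions put three columns in the span of e and e′.
    missing-vanish : {F : List (V n) → Carrier} → IsAlternating F → ∀ {t r xs} → r ℕ.< t → (∀ j → key j ℕ.< t) →
      r ∉ map key xs → t ℕ.+ 2 ≡ length xs → F (map v xs) ≈ 0#
    missing-vanish {F} alt {t} {r} r<t key<t r∉ len =
      peel alt c₁ (peel (after alt d₁) c₂ (peel (after (after alt d₁) d₂) c₃ flat))
      where
      next : ∀ {m xs} → r ∉ map key xs → t ℕ.+ m ≡ length xs → Collision key xs
      next {m} {xs} r∉ len = missing⇒collision key xs r<t (All.universal key<t xs) r∉ (≡.subst (t ℕ.≤_) len (ℕ.m≤m+n t m))
      still : ∀ {xs} → r ∉ map key xs → (c : Collision key xs) → r ∉ map key (Collision.rest c)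
      still r∉ c r∈ = r∉ (↭.∈-resp-↭ (↭.map⁺ key (↭-sym (Collision.found c))) (there r∈))
      shorter : ∀ {m xs} → t ℕ.+ suc m ≡ length xs → (c : Collision key xs) → t ℕ.+ m ≡ length (Collision.rest c)
      shorter {m} len c = ℕ.suc-injective (≡.trans (≡.sym (ℕ.+-suc t m)) (≡.trans len (↭.↭-length (Collision.found c))))
      c₁ = next r∉ len
      c₂ = next (still r∉ c₁) (shorter len c₁)
      c₃ = next (still (still r∉ c₁) c₂) (shorter (shorter len c₁) c₂)
      diff : ∀ {xs} → Collision key xs → V n
      diff c = difference (Collision.x c) (Collision.x′ c)
      d₁ = diff c₁
      d₂ = diff c₂
      flat : F (d₁ ∷ d₂ ∷ diff c₃ ∷ map v (Collision.rest c₃)) ≈ 0#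
      flat = trans (expand₂ alt _ _ _ _ e e′ _) (trans (*-congˡ
        (trans (expand₁ (after (after alt e) e′) _ _ e e′ _)
          (+-cong (trans (*-congˡ (vanish-∈ alt (there (here ≡.refl)))) (zeroʳ _))
                  (trans (*-congˡ (IsAlternating.alternating alt (e ∷ []) e′ _)) (zeroʳ _)))))
        (trans (*-congˡ (+-identityˡ 0#)) (zeroʳ _)))

    pullMap : {F : List (V n) → Carrier} → IsAlternating F → ∀ pre x post →
              F (map v (pre ++ x ∷ post)) ≈ sign (length pre) * F (v x ∷ map v (pre ++ post))
    pullMap alt pre x post
      rewrite List.map-++ v pre (x ∷ post) | List.map-++ v pre post | ≡.sym (List.length-map v pre)
      = pull alt (map v pre) (v x) (map v post)

    -- The right one of the two columns is pulled first: each sign is then given by the original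
    -- position, at the price of the order `y`, `x` in front.
    pullMap₂ : {F : List (V n) → Carrier} → IsAlternating F → ∀ pre x mid y post →
               F (map v (pre ++ x ∷ mid ++ y ∷ post)) ≈
               sign (length pre) * sign (length (pre ++ x ∷ mid)) * F (v y ∷ v x ∷ map v (pre ++ mid ++ post))
    pullMap₂ {F} alt pre x mid y post = begin
      F (map v (pre ++ x ∷ mid ++ y ∷ post))
        ≡⟨ ≡.cong (F ∘ map v) (List.++-assoc pre (x ∷ mid) (y ∷ post)) ⟨
      F (map v ((pre ++ x ∷ mid) ++ y ∷ post))
        ≈⟨ pullMap alt (pre ++ x ∷ mid) y post ⟩
      s′ * F (v y ∷ map v ((pre ++ x ∷ mid) ++ post))
        ≡⟨ ≡.cong (λ xs → s′ * F (v y ∷ map v xs)) (List.++-assoc pre (x ∷ mid) post) ⟩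
      s′ * F (v y ∷ map v (pre ++ x ∷ mid ++ post))
        ≈⟨ *-congˡ (pullMap (after alt (v y)) pre x (mid ++ post)) ⟩
      s′ * (s * F (v y ∷ v x ∷ map v (pre ++ mid ++ post)))
        ≈⟨ solve 3 (λ s s′ f → s′ :* (s :* f) := s :* s′ :* f) refl s s′ _ ⟩
      s * s′ * F (v y ∷ v x ∷ map v (pre ++ mid ++ post)) ∎
      where
      s  = sign (length pre)
      s′ = sign (length (pre ++ x ∷ mid))

  module _ (t : ℕ) .{{_ : NonZero t}} (κ : Partition (t ℕ.+ 2)) where
    open Beta t κ
    open Columns t κ

    module _ {n} (v : Fin N → V n) (u : ℕ → V n) (p q : Fin N → Carrier) (e e′ : V n)
             (v≋ : ∀ j → v j ≋ u (key j) ⊞ p j ⊡ e ⊞ q j ⊡ e′)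
             {F : List (V n) → Carrier} (alt : IsAlternating F) where

      private
        bring : ∀ {a₁ b₁ x y} → Around a₁ b₁ x y →
                F (map v (allFin N)) ≈ sign (toℕ x) * sign (toℕ y) * F (v y ∷ v x ∷ map v (outside a₁ b₁))
        bring record { pre = pre ; mid = mid ; post = post ; all≡ = all≡ ; outside≡ = outside≡ ; pre# = pre# ; premid# = premid# }
          rewrite all≡ | outside≡ | ≡.sym pre# | ≡.sym premid# = pullMap₂ key v u p q e e′ v≋ alt pre _ mid _ post

      -- Pulling both columns leaves the one further right in front. A swap is needed exactly when
      -- `a₁` stands left of `b₁`, that is, when β a₁ is the larger number; this explains the
      -- negated `sgn`.
      frontPair : ∀ {a₁ b₁} → a₁ ≢ b₁ → F (map v (allFin N)) ≈
        sign (toℕ a₁) * sign (toℕ b₁) * ι (ℤ.- sgn (β a₁ ⊖ β b₁)) * F (v a₁ ∷ v b₁ ∷ map v (outside a₁ b₁))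
      frontPair {a₁} {b₁} a≢b with around a₁ b₁ a≢b
      ... | inj₁ (a<b , ar) = begin
        F (map v (allFin N))
          ≈⟨ bring ar ⟩
        s * F (v b₁ ∷ v a₁ ∷ map v (outside a₁ b₁))
          ≈⟨ *-congˡ (headSwap alt (v b₁) (v a₁) _) ⟩
        s * - F (v a₁ ∷ v b₁ ∷ map v (outside a₁ b₁))
          ≈⟨ solve 2 (λ s f → s :* :- f := s :* con -1ℤ :* f) refl s _ ⟩
        s * ι -1ℤ * F (v a₁ ∷ v b₁ ∷ map v (outside a₁ b₁))
          ≡⟨ ≡.cong (λ i → s * ι (ℤ.- i) * F (v a₁ ∷ v b₁ ∷ map v (outside a₁ b₁))) (sgn-⊖-> (β-decreasing a<b)) ⟨
        s * ι (ℤ.- sgn (β a₁ ⊖ β b₁)) * F (v a₁ ∷ v b₁ ∷ map v (outside a₁ b₁)) ∎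
        where s = sign (toℕ a₁) * sign (toℕ b₁)
      ... | inj₂ (b<a , ar) = begin
        F (map v (allFin N))
          ≈⟨ bring ar ⟩
        sign (toℕ b₁) * sign (toℕ a₁) * F (v a₁ ∷ v b₁ ∷ map v (outside a₁ b₁))
          ≈⟨ *-congʳ (trans (*-comm _ _) (trans (sym (*-identityʳ _)) (*-congˡ (sym ι-1)))) ⟩
        s * ι 1ℤ * F (v a₁ ∷ v b₁ ∷ map v (outside a₁ b₁))
          ≡⟨ ≡.cong (λ i → s * ι (ℤ.- i) * F (v a₁ ∷ v b₁ ∷ map v (outside a₁ b₁))) (sgn-⊖-< (β-decreasing b<a)) ⟨
        s * ι (ℤ.- sgn (β a₁ ⊖ β b₁)) * F (v a₁ ∷ v b₁ ∷ map v (outside a₁ b₁)) ∎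
        where s = sign (toℕ a₁) * sign (toℕ b₁)

      residue-value : ∀ {a₁ a₂ b₁ b₂} → (∀ r → residueClass r ≢ []) → Arranged a₁ a₂ b₁ b₂ → F (map v (allFin N)) ≈
        sign (toℕ a₁) * sign (toℕ b₁) * ι (ℤ.- sgn (β a₁ ⊖ β b₁)) *
        (wedge key v u p q e e′ v≋ a₁ a₂ b₁ b₂ * (sign (inversions (wordS a₁ b₁)) * signed u (λ xs → F (e ∷ e′ ∷ xs)) (upTo t)))
      residue-value {a₁} {a₂} {b₁} {b₂} noEmpty arr = trans (frontPair a₁≢b₁) (*-congˡ (begin
        F (v a₁ ∷ v b₁ ∷ map v (outside a₁ b₁))
          ≈⟨ twoPairs-value key v u p q e e′ v≋ alt keyA keyB a₂∈ b₂∈ ⟩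
        w * F (e ∷ e′ ∷ map u (wordS a₁ b₁))
          -- The inserted square of the inversion sign provides the factor that `signed` requires
          -- for sorting the word into 0, ..., t - 1.
          ≈⟨ *-congˡ (trans (sym (*-identityˡ _)) (*-congʳ (sym (sign-square i)))) ⟩
        w * (sign i * sign i * F (e ∷ e′ ∷ map u (wordS a₁ b₁)))
          ≈⟨ *-congˡ (trans (*-assoc _ _ _) (*-congˡ (signed-↭ (after (after alt e) e′) u (word-↭ noEmpty arr)))) ⟩
        w * (sign i * signed u (λ xs → F (e ∷ e′ ∷ xs)) (upTo t)) ∎))
        where
        open Arranged arr
        w = wedge key v u p q e e′ v≋ a₁ a₂ b₁ b₂
        i = inversions (wordS a₁ b₁)
        b₂∈ : b₂ ∈ outside a₁ b₁
        b₂∈ = ∈-outside (a₁≢b₂ ∘ ≡.sym) (Fin.<⇒≢ b₁<b₂ ∘ ≡.sym)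
        a₂∈ : a₂ ∈ b₁ ∷ outside a₁ b₁
        a₂∈ with a₂ Fin.≟ b₁
        ... | yes a₂≡b₁ = here a₂≡b₁
        ... | no  a₂≢b₁ = there (∈-outside (Fin.<⇒≢ a₁<a₂ ∘ ≡.sym) a₂≢b₁)

      empty-vanish : ∀ {r : Fin t} → residueClass r ≡ [] → F (map v (allFin N)) ≈ 0#
      empty-vanish {r} empty = missing-vanish key v u p q e e′ v≋ alt (Fin.toℕ<n r) key<t r∉
        (≡.sym (List.length-tabulate {n = N} (λ i → i)))
        where
        r∉ : toℕ r ∉ map key (allFin N)
        r∉ r∈ with j , _ , e ← ∈-map⁻ key r∈ with () ← ≡.subst (j ∈_) empty (∈-filter⁺ (λ j → key j ℕ.≟ toℕ r) (∈-allFin j) (≡.sym e))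

-- The Schur polynomial at t-th roots of unity and two further variables.

module RootsOfUnity {c ℓ} (R : CommutativeRing c ℓ) where
  open import Defs
  open import Data.Fin.Base using (Fin; zero; suc; splitAt; toℕ)
  open import Data.Integer.Base as ℤ using (ℤ; _⊖_; 0ℤ; -1ℤ)
  open import Data.List.Base as List using (List; []; _∷_; allFin; map; upTo)
  import Data.List.Properties as List
  open import Data.List.Relation.Unary.All as All using (All; []; _∷_)
  import Data.List.Relation.Unary.All.Properties as All
  open import Data.Nat.Base as ℕ using (ℕ; zero; suc; NonZero)
  open import Data.Nat.DivMod using (_%_; _/_; m≡m%n+[m/n]*n)
  import Data.Nat.Properties as ℕ
  open import Data.Sum.Base using (inj₁; inj₂; [_,_]′)
  open import Data.Vec.Base as Vec using (Vec; []; _∷_; lookup)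
  import Data.Vec.Properties as Vec
  open import Relation.Binary.PropositionalEquality.Core as ≡ using (_≡_; _≢_)
  open CommutativeRing R hiding (zero)
  open import Algebra.Properties.Semiring.Exp semiring
  open IntegerImage R
  open AlternatingForms R
  open Bialternant R
  open Combinatorics
  open ResidueDeterminant R
  open import Relation.Binary.Reasoning.Setoid setoid

  1^m≈1 : ∀ m → 1# ^ m ≈ 1#
  1^m≈1 zero    = refl
  1^m≈1 (suc m) = trans (*-identityˡ _) (1^m≈1 m)

  ι-product : ∀ i j k l → ι i * ι j * ι k * ι l ≈ ι (i ℤ.* j ℤ.* k ℤ.* l)
  ι-product i j k l = sym (trans (ι-* (i ℤ.* j ℤ.* k) l) (*-congʳ (trans (ι-* (i ℤ.* j) k) (*-congʳ (ι-* i j)))))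

  module _ (t : ℕ) .{{_ : NonZero t}} (roots : Fin t → Carrier) (roots^t : ∀ i → roots i ^ t ≈ 1#) (y y′ : Carrier) where

    variables : Vec Carrier (t ℕ.+ 2)
    variables = Vec.tabulate roots Vec.++ (y ∷ y′ ∷ [])

    residueColumn : ℕ → V (t ℕ.+ 2)
    residueColumn r i = [ (λ i → roots i ^ r) , (λ _ → 0#) ]′ (splitAt t i)

    e e′ : V (t ℕ.+ 2)
    e  i = [ (λ _ → 0#) , lookup (1# ∷ 0# ∷ []) ]′ (splitAt t i)
    e′ i = [ (λ _ → 0#) , lookup (0# ∷ 1# ∷ []) ]′ (splitAt t i)

    root-% : ∀ i m → roots i ^ m ≈ roots i ^ (m % t)
    root-% i m = begin
      x ^ m                              ≈⟨ ^-congʳ x (m≡m%n+[m/n]*n m t) ⟩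
      x ^ (m % t ℕ.+ m / t ℕ.* t)        ≈⟨ ^-homo-* x (m % t) _ ⟩
      x ^ (m % t) * x ^ (m / t ℕ.* t)    ≈⟨ *-congˡ (^-congʳ x (ℕ.*-comm (m / t) t)) ⟩
      x ^ (m % t) * x ^ (t ℕ.* (m / t))  ≈⟨ *-congˡ (^-assocʳ x t (m / t)) ⟨
      x ^ (m % t) * (x ^ t) ^ (m / t)    ≈⟨ *-congˡ (trans (^-congˡ (m / t) (roots^t i)) (1^m≈1 (m / t))) ⟩
      x ^ (m % t) * 1#                   ≈⟨ *-identityʳ _ ⟩
      x ^ (m % t)                        ∎
      where x = roots i

    column≋ : ∀ m → powers variables m ≋ residueColumn (m % t) ⊞ y ^ m ⊡ e ⊞ y′ ^ m ⊡ e′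
    column≋ m i = trans (^-congˡ m (reflexive (Vec.lookup-splitAt t (Vec.tabulate roots) (y ∷ y′ ∷ []) i))) (entry (splitAt t i))
      where
      entry : ∀ s → ([ lookup (Vec.tabulate roots) , lookup (y ∷ y′ ∷ []) ]′ s) ^ m ≈
        [ (λ i → roots i ^ (m % t)) , (λ _ → 0#) ]′ s
        + y ^ m * [ (λ _ → 0#) , lookup (1# ∷ 0# ∷ []) ]′ s
        + y′ ^ m * [ (λ _ → 0#) , lookup (0# ∷ 1# ∷ []) ]′ s
      entry (inj₁ i) = trans (trans (^-congˡ m (reflexive (Vec.lookup∘tabulate roots i))) (root-% i m))
        (solve 3 (λ a b c → a := a :+ b :* con 0ℤ :+ c :* con 0ℤ) refl _ (y ^ m) (y′ ^ m))
      entry (inj₂ zero) = trans (sym (*-identityʳ _)) (solve 2 (λ a b → a := con 0ℤ :+ a :+ b :* con 0ℤ) refl _ (y′ ^ m))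
      entry (inj₂ (suc zero)) = trans (sym (*-identityʳ _)) (solve 2 (λ a b → a := con 0ℤ :+ b :* con 0ℤ :+ a) refl _ (y ^ m))

    -- The factor shared by all partitions. The word `upTo t` is increasing, so this is det(e, e′,
    -- u₀, ..., u_{t-1}) itself.
    minor : Carrier
    minor = signed residueColumn (λ xs → det (t ℕ.+ 2) (e ∷ e′ ∷ xs)) (upTo t)

    minor-closed : ∀ {p} (P : Carrier → Set p) → P 0# → P 1# → (∀ {x y} → P x → P y → P (x + y)) →
      (∀ {x y} → P x → P y → P (x * y)) → (∀ {x} → P x → P (- x)) → (∀ i → P (ι i)) → (∀ i → P (roots i)) → P minor
    minor-closed P P0 P1 P+ P* P- Pι Proots =
      P* (Pι (-1ℤ ℤ.^ inversions (upTo t))) (det-closed P P0 P1 P+ P* P- (t ℕ.+ 2)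
        ((λ i → unit₀ (splitAt t i)) ∷ (λ i → unit₁ (splitAt t i)) ∷ All.map⁺ (All.universal (λ r i → power r (splitAt t i)) (upTo t))))
      where
      Pow : ∀ {x} r → P x → P (x ^ r)
      Pow zero    px = P1
      Pow (suc r) px = P* px (Pow r px)
      power : ∀ r s → P ([ (λ i → roots i ^ r) , (λ _ → 0#) ]′ s)
      power r (inj₁ i) = Pow r (Proots i)
      power r (inj₂ _) = P0
      unit₀ : ∀ s → P ([ (λ _ → 0#) , lookup (1# ∷ 0# ∷ []) ]′ s)
      unit₀ (inj₁ _)          = P0
      unit₀ (inj₂ zero)       = P1
      unit₀ (inj₂ (suc zero)) = P0
      unit₁ : ∀ s → P ([ (λ _ → 0#) , lookup (0# ∷ 1# ∷ []) ]′ s)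
      unit₁ (inj₁ _)          = P0
      unit₁ (inj₂ zero)       = P0
      unit₁ (inj₂ (suc zero)) = P1

    module _ (κ : Partition (t ℕ.+ 2)) where
      open Beta t κ
      open Columns t κ

      private
        v : Fin N → V N
        v j = powers variables (β j)

        numerator : det N (map v (allFin N)) ≈ vandermonde variables * schurSum (Partition.parts κ) variables
        numerator = trans (reflexive (≡.cong (det N) (≡.sym columns))) (bialternant variables (Partition.decreasing κ))
          where
          columns : map (powers variables) (betas (Partition.parts κ)) ≡ map v (allFin N)
          columns = ≡.trans (≡.cong (map (powers variables)) (betas-tabulate (Partition.parts κ)))
            (≡.trans (List.map-tabulate β (powers variables)) (≡.sym (List.map-tabulate (λ i → i) v)))

      pairWedge : Fin N → Fin N → Fin N → Fin N → Carrier
      pairWedge a₁ a₂ b₁ b₂ =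
        (y ^ β a₁ - y ^ β a₂) * (y′ ^ β b₁ - y′ ^ β b₂) - (y′ ^ β a₁ - y′ ^ β a₂) * (y ^ β b₁ - y ^ β b₂)

      -- The part of ε that comes from reordering columns, with positions counted from 0, and with
      -- the extra minus sign of `frontPair`.
      signOf : Fin N → Fin N → ℤ
      signOf a₁ b₁ = (-1ℤ ℤ.^ toℕ a₁) ℤ.* (-1ℤ ℤ.^ toℕ b₁) ℤ.* (ℤ.- sgn (β a₁ ⊖ β b₁)) ℤ.* (-1ℤ ℤ.^ inversions (wordS a₁ b₁))

      schur-value : ∀ {a₁ a₂ b₁ b₂} → (∀ r → residueClass r ≢ []) → Arranged a₁ a₂ b₁ b₂ →
        vandermonde variables * schurSum (Partition.parts κ) variables ≈ ι (signOf a₁ b₁) * (minor * pairWedge a₁ a₂ b₁ b₂)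
      schur-value {a₁} {a₂} {b₁} {b₂} noEmpty arr = begin
        vandermonde variables * schurSum (Partition.parts κ) variables
          ≈⟨ numerator ⟨
        det N (map v (allFin N))
          ≈⟨ residue-value t κ v residueColumn (λ j → y ^ β j) (λ j → y′ ^ β j) e e′ (λ j → column≋ (β j)) (det-isAlternating N) noEmpty arr ⟩
        s₁ * s₂ * s₃ * (w * (s₄ * minor))
          ≈⟨ solve 6 (λ s₁ s₂ s₃ w s₄ m → s₁ :* s₂ :* s₃ :* (w :* (s₄ :* m)) := s₁ :* s₂ :* s₃ :* s₄ :* (m :* w)) refl s₁ s₂ s₃ w s₄ minor ⟩
        s₁ * s₂ * s₃ * s₄ * (minor * w)
          ≈⟨ *-congʳ (ι-product (-1ℤ ℤ.^ toℕ a₁) (-1ℤ ℤ.^ toℕ b₁) (ℤ.- sgn (β a₁ ⊖ β b₁)) (-1ℤ ℤ.^ inversions (wordS a₁ b₁))) ⟩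
        ι (signOf a₁ b₁) * (minor * w) ∎
        where
        s₁ = sign (toℕ a₁)
        s₂ = sign (toℕ b₁)
        s₃ = ι (ℤ.- sgn (β a₁ ⊖ β b₁))
        s₄ = sign (inversions (wordS a₁ b₁))
        w  = pairWedge a₁ a₂ b₁ b₂

      schur-vanish : ∀ {r : Fin t} → residueClass r ≡ [] → vandermonde variables * schurSum (Partition.parts κ) variables ≈ 0#
      schur-vanish empty = trans (sym numerator)
        (empty-vanish t κ v residueColumn (λ j → y ^ β j) (λ j → y′ ^ β j) e e′ (λ j → column≋ (β j)) (det-isAlternating N) empty)

-- Recovering the multiset of differences from the coefficients of an odd Laurent polynomial.

module SumMultisets where
  open import Defs using (sgn)
  open import Data.Bool.Base using (if_then_else_)
  open import Data.Integer.Base as ℤ using (ℤ; +_; -[1+_]; 0ℤ; 1ℤ; _+_; _-_; _*_; -_; _≤_; _<_; +≤+; +<+; ∣_∣)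
  import Data.Integer.Properties as ℤ
  open import Data.Integer.Solver using (module +-*-Solver)
  open import Data.List.Base as List using (List; []; _∷_; map; length)
  import Data.List.Properties as List
  open import Data.List.Membership.DecPropositional using () renaming (_∈?_ to decMember)
  open import Data.List.Membership.Propositional using (_∉_)
  open import Data.List.Membership.Propositional.Properties using (∈-∃++)
  open import Data.List.Relation.Binary.Permutation.Propositional as ↭ using (_↭_; ↭-sym; ↭-refl)
  import Data.List.Relation.Binary.Permutation.Propositional.Properties as ↭
  open import Data.List.Relation.Unary.All as All using (All; []; _∷_)
  open import Data.List.Relation.Unary.Any using (here; there)
  open import Data.Nat.Base as ℕ using (ℕ; zero; suc)
  import Data.Nat.ListAction as ℕ
  import Data.Nat.ListAction.Properties as ℕ
  import Data.Nat.Properties as ℕ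
  open import Data.Product.Base using (∃-syntax; _×_; _,_; proj₁; proj₂)
  open import Function.Base using (_∘_)
  open import Relation.Binary.Definitions using (tri<; tri≈; tri>)
  open import Relation.Binary.PropositionalEquality.Core using (_≡_; _≢_; refl; sym; trans; cong; cong₂; subst)
  open import Relation.Nullary.Decidable.Core using (⌊_⌋; yes; no)
  open import Relation.Nullary.Negation.Core using (contradiction)
  open +-*-Solver

  indicator : ℤ → ℤ → ℤ
  indicator k n = if ⌊ n ℤ.≟ k ⌋ then 1ℤ else 0ℤ

  -- The coefficient of zᵏ in zⁿ - z⁻ⁿ.
  odd : ℤ → ℤ → ℤ
  odd k n = indicator k n - indicator k (- n)

  oddSum : ℤ → List ℤ → ℤ
  oddSum k []       = 0ℤ
  oddSum k (m ∷ ms) = odd k m + oddSum k ms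

  indicator-≡ : ∀ {k n} → n ≡ k → indicator k n ≡ 1ℤ
  indicator-≡ {k} {n} n≡k with n ℤ.≟ k
  ... | yes _  = refl
  ... | no n≢k = contradiction n≡k n≢k

  indicator-≢ : ∀ {k n} → n ≢ k → indicator k n ≡ 0ℤ
  indicator-≢ {k} {n} n≢k with n ℤ.≟ k
  ... | yes n≡k = contradiction n≡k n≢k
  ... | no _  = refl

  odd-neg : ∀ k n → odd k (- n) ≡ - odd k n
  odd-neg k n rewrite ℤ.neg-involutive n = solve 2 (λ a b → a :- b := :- (b :- a)) refl (indicator k (- n)) (indicator k n)

  odd-≢ : ∀ {k n} → n ≢ k → - n ≢ k → odd k n ≡ 0ℤ
  odd-≢ n≢k -n≢k = cong₂ _-_ (indicator-≢ n≢k) (indicator-≢ -n≢k)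

  odd-≡ : ∀ {k} → - k ≢ k → odd k k ≡ 1ℤ
  odd-≡ {k} -k≢k = cong₂ _-_ (indicator-≡ {k} refl) (indicator-≢ -k≢k)

  double-injective : ∀ {x y} → x + x ≡ y + y → x ≡ y
  double-injective {x} {y} e = ℤ.*-cancelˡ-≡ (+ 2) x y (trans (two x) (trans e (sym (two y))))
    where
    two : ∀ x → + 2 * x ≡ x + x
    two = solve 1 (λ x → con (+ 2) :* x := x :+ x) refl

  -x≢x : ∀ {x} → x ≢ 0ℤ → - x ≢ x
  -x≢x {x} x≢0 e = x≢0 (double-injective (trans (cong (_+ x) (sym e)) (ℤ.+-inverseˡ x)))

  oddSum-↭ : ∀ k {ms ys} → ms ↭ ys → oddSum k ms ≡ oddSum k ys
  oddSum-↭ k ↭.refl          = refl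
  oddSum-↭ k (↭.prep x p)    = cong (λ s → odd k x + s) (oddSum-↭ k p)
  oddSum-↭ k {ys = _ ∷ _ ∷ ms′} (↭.swap x y p) = trans (cong (λ s → odd k x + (odd k y + s)) (oddSum-↭ k p))
    (solve 3 (λ a b c → a :+ (b :+ c) := b :+ (a :+ c)) refl (odd k x) (odd k y) (oddSum k ms′))
  oddSum-↭ k (↭.trans p q)   = trans (oddSum-↭ k p) (oddSum-↭ k q)

  -- An entry `y` can contribute negatively at exponent `x` only through `- y ≡ x`, which is
  -- excluded, while `x` itself contributes 1.
  oddSum-positive : ∀ {x ms} → x ≢ 0ℤ → All (λ y → - y ≢ x) ms → 1ℤ ≤ oddSum x (x ∷ ms)
  oddSum-positive {x} {ms} x≢0 -ms≢ rewrite odd-≡ (-x≢x x≢0) = ℤ.+-monoʳ-≤ 1ℤ (nonneg -ms≢)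
    where
    nonneg : ∀ {ms} → All (λ y → - y ≢ x) ms → 0ℤ ≤ oddSum x ms
    nonneg []              = ℤ.≤-refl
    nonneg {y ∷ _} (-y≢x ∷ rest) = ℤ.+-mono-≤ term (nonneg rest)
      where
      term : 0ℤ ≤ odd x y
      term rewrite indicator-≢ -y≢x with y ℤ.≟ x
      ... | yes _ = +≤+ ℕ.z≤n
      ... | no _  = +≤+ ℕ.z≤n

  oddSum-nonpositive : ∀ {x ms} → x ∉ ms → oddSum x ms ≤ 0ℤ
  oddSum-nonpositive {ms = []}     _  = ℤ.≤-refl
  oddSum-nonpositive {x} {y ∷ ms} x∉ = ℤ.+-mono-≤ term (oddSum-nonpositive (x∉ ∘ there))
    where
    term : odd x y ≤ 0ℤ
    term rewrite indicator-≢ {x} {y} (λ e → x∉ (here (sym e))) with - y ℤ.≟ x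
    ... | yes _ = ℤ.-≤+
    ... | no _  = +≤+ ℕ.z≤n

  private
    +-cancelˡ : ∀ i j k → i + j ≡ i + k → j ≡ k
    +-cancelˡ i j k e = trans (sym (drop i j)) (trans (cong (λ s → - i + s) e) (drop i k))
      where
      drop : ∀ i j → - i + (i + j) ≡ j
      drop = solve 2 (λ i j → :- i :+ (i :+ j) := j) refl

  -- At k = x the left-hand sum is positive, which forces x to occur on the right.
  oddSum-match : ∀ {x ms ms′} → x ≢ 0ℤ → All (λ y → - y ≢ x) ms →
                 (∀ k → oddSum k (x ∷ ms) ≡ oddSum k ms′) →
                 ∃[ ms″ ] ms′ ↭ x ∷ ms″ × (∀ k → oddSum k ms ≡ oddSum k ms″)
  oddSum-match {x} {ms} {ms′} x≢0 -ms≢ same with decMember ℤ._≟_ x ms′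
  ... | no x∉  = contradiction (subst (1ℤ ≤_) (same x) (oddSum-positive x≢0 -ms≢))
                   (λ 1≤ → ℤ.<⇒≱ (+<+ (ℕ.s≤s ℕ.z≤n)) (ℤ.≤-trans 1≤ (oddSum-nonpositive x∉)))
  ... | yes x∈ with ∈-∃++ x∈
  ...   | us , vs , refl = us List.++ vs , ↭.shift x us vs ,
          λ k → +-cancelˡ (odd k x) _ _ (trans (same k) (oddSum-↭ k (↭.shift x us vs)))

  sumℤ : List ℤ → ℤ
  sumℤ []       = 0ℤ
  sumℤ (m ∷ ms) = m + sumℤ ms

  sumℤ-↭ : ∀ {ms ys} → ms ↭ ys → sumℤ ms ≡ sumℤ ys
  sumℤ-↭ ↭.refl          = refl
  sumℤ-↭ (↭.prep x p)    = cong (λ s → x + s) (sumℤ-↭ p)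
  sumℤ-↭ {ys = _ ∷ _ ∷ ms′} (↭.swap x y p) = trans (cong (λ s → x + (y + s)) (sumℤ-↭ p))
    (solve 3 (λ a b c → a :+ (b :+ c) := b :+ (a :+ c)) refl x y (sumℤ ms′))
  sumℤ-↭ (↭.trans p q)   = trans (sumℤ-↭ p) (sumℤ-↭ q)

  private
    positive-sum : ∀ {x y} → 0ℤ < x + y → - y ≢ x
    positive-sum {x} {y} 0< refl = ℤ.<-irrefl (sym (ℤ.+-inverseˡ y)) 0<

    -- Two nonzero entries are matched through coefficients, the third through the sum: it may be 0,
    -- and then no coefficient shows it.
    match₂ : ∀ {x y z ms′} → x ≢ 0ℤ → y ≢ 0ℤ → 0ℤ < x + y → 0ℤ < x + z → 0ℤ < y + z →
             (∀ k → oddSum k (x ∷ y ∷ z ∷ []) ≡ oddSum k ms′) →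
             sumℤ (x ∷ y ∷ z ∷ []) ≡ sumℤ ms′ → length ms′ ≡ 3 → x ∷ y ∷ z ∷ [] ↭ ms′
    match₂ {x} {y} {z} {ms′} x≢0 y≢0 xy xz yz same sums len
      with ms₁ , p , same₁ ← oddSum-match x≢0 (positive-sum xy ∷ positive-sum xz ∷ []) same
      with ms₂ , q , _ ← oddSum-match y≢0 (positive-sum yz ∷ []) same₁
      = last ms₂ (↭.trans p (↭.prep x q))
      where
      last : ∀ ms₂ → ms′ ↭ x ∷ y ∷ ms₂ → x ∷ y ∷ z ∷ [] ↭ ms′
      last [] r with () ← trans (sym len) (↭.↭-length r)
      last (_ ∷ _ ∷ _) r with () ← trans (sym len) (↭.↭-length r)
      last (w ∷ []) r = subst (λ z → x ∷ y ∷ z ∷ [] ↭ ms′) w≡z (↭-sym r)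
        where
        w≡z : w ≡ z
        w≡z = trans (solve 3 (λ x y w → w := (x :+ (y :+ (w :+ con 0ℤ))) :- x :- y) refl x y w)
          (trans (cong (λ s → s - x - y) (sym (trans sums (sumℤ-↭ r))))
            (solve 3 (λ x y z → (x :+ (y :+ (z :+ con 0ℤ))) :- x :- y := z) refl x y z))

    -- Positive pairwise sums leave room for at most one entry equal to 0; it is moved to the last
    -- place, where `match₂` tolerates it.
    match₃ : ∀ {x y z ms′} → 0ℤ < x + y → 0ℤ < x + z → 0ℤ < y + z →
             (∀ k → oddSum k (x ∷ y ∷ z ∷ []) ≡ oddSum k ms′) →
             sumℤ (x ∷ y ∷ z ∷ []) ≡ sumℤ ms′ → length ms′ ≡ 3 → x ∷ y ∷ z ∷ [] ↭ ms′
    match₃ {x} {y} {z} {ms′} xy xz yz same sums len with x ℤ.≟ 0ℤ | y ℤ.≟ 0ℤ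
    ... | no x≢0 | no y≢0 = match₂ x≢0 y≢0 xy xz yz same sums len
    ... | yes refl | _ = ↭.trans rotate (match₂ (nonzero y xy) (nonzero z xz) yz (flip y xy) (flip z xz)
            (λ k → trans (sym (oddSum-↭ k rotate)) (same k)) (trans (sym (sumℤ-↭ rotate)) sums) len)
      where
      nonzero : ∀ y → 0ℤ < 0ℤ + y → y ≢ 0ℤ
      nonzero _ 0< refl = ℤ.<-irrefl refl 0<
      flip : ∀ y → 0ℤ < 0ℤ + y → 0ℤ < y + 0ℤ
      flip y = subst (0ℤ <_) (ℤ.+-comm 0ℤ y)
      rotate : 0ℤ ∷ y ∷ z ∷ [] ↭ y ∷ z ∷ 0ℤ ∷ []
      rotate = ↭.trans (↭.swap 0ℤ y ↭-refl) (↭.prep y (↭.swap 0ℤ z ↭-refl))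
    ... | no x≢0 | yes refl = ↭.trans swapped (match₂ x≢0 z≢0 xz xy (subst (0ℤ <_) (ℤ.+-comm 0ℤ z) yz)
            (λ k → trans (sym (oddSum-↭ k swapped)) (same k)) (trans (sym (sumℤ-↭ swapped)) sums) len)
      where
      z≢0 : z ≢ 0ℤ
      z≢0 refl = ℤ.<-irrefl refl yz
      swapped : x ∷ 0ℤ ∷ z ∷ [] ↭ x ∷ z ∷ 0ℤ ∷ []
      swapped = ↭.prep x (↭.swap 0ℤ z ↭-refl)

  shifts : ℤ → List ℕ → List ℤ
  shifts M = map (λ d → M - + d)

  -- The coefficient of zᵏ in φ(M) - Σ φ(M - d), in the notation of the overview.
  profile : ℤ → ℤ → List ℕ → ℤ
  profile k M ds = odd k M - oddSum k (shifts M ds)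

  profile-↭ : ∀ k M {ds ds′} → ds ↭ ds′ → profile k M ds ≡ profile k M ds′
  profile-↭ k M p = cong (λ s → odd k M - s) (oddSum-↭ k (↭.map⁺ (λ d → M - + d) p))

  halfSum-↭ : ∀ {M M′ ds ds′} → M + M ≡ + ℕ.sum ds → M′ + M′ ≡ + ℕ.sum ds′ → ds ↭ ds′ → M ≡ M′
  halfSum-↭ half half′ p = double-injective (trans half (trans (cong +_ (ℕ.sum-↭ p)) (sym half′)))

  module _ (M : ℤ) {d₁ d₂ d₃ : ℕ} (half : M + M ≡ + ℕ.sum (d₁ ∷ d₂ ∷ d₃ ∷ []))
           (d₁>0 : 0 ℕ.< d₁) (d₂>0 : 0 ℕ.< d₂) (d₃>0 : 0 ℕ.< d₃) where
    private
      ds : List ℕ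
      ds = d₁ ∷ d₂ ∷ d₃ ∷ []

      S : ℕ
      S = ℕ.sum ds

      S>0 : 0 ℕ.< S
      S>0 = ℕ.≤-trans d₁>0 (ℕ.m≤m+n d₁ _)

      d<S : All (ℕ._< S) ds
      d<S = ℕ.m<m+n d₁ (ℕ.≤-trans d₂>0 (ℕ.m≤m+n d₂ _))
          ∷ ℕ.≤-trans (ℕ.m<m+n d₂ (ℕ.≤-trans d₃>0 (ℕ.m≤m+n d₃ 0))) (ℕ.m≤n+m _ d₁)
          ∷ ℕ.≤-<-trans (ℕ.m≤m+n d₃ 0) (ℕ.≤-<-trans (ℕ.m≤n+m (d₃ ℕ.+ 0) d₂) (ℕ.m<n+m _ d₁>0))
          ∷ []

      oddSum-0 : ∀ k {ds} → All (λ d → M - + d ≢ k × - (M - + d) ≢ k) ds → oddSum k (shifts M ds) ≡ 0ℤ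
      oddSum-0 k []              = refl
      oddSum-0 k ((n≢ , n≢′) ∷ es) = cong₂ _+_ (odd-≢ n≢ n≢′) (oddSum-0 k es)

    M≢-M : - M ≢ M
    M≢-M e = ℕ.<⇒≢ S>0 (sym (ℤ.+-injective (trans (sym half) (trans (cong (_+ M) (sym e)) (ℤ.+-inverseˡ M)))))

    -- Since 0 < d < 2M for each of the three differences, no M - d equals M or -M, and only φ(M)
    -- contributes.
    profile-top : profile M M ds ≡ 1ℤ
    profile-top = cong₂ _-_ (odd-≡ M≢-M) (oddSum-0 M (All.zipWith sep (d>0 , d<S)))
      where
      d>0 : All (0 ℕ.<_) ds
      d>0 = d₁>0 ∷ d₂>0 ∷ d₃>0 ∷ []
      sep : ∀ {d} → 0 ℕ.< d × d ℕ.< S → M - + d ≢ M × - (M - + d) ≢ M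
      sep {d} (0<d , d<S) =
        (λ e → ℕ.<⇒≢ 0<d (ℤ.+-injective (sym (trans (solve 2 (λ M d → d := M :- (M :- d)) refl M (+ d)) (trans (cong (λ x → M - x) e) (ℤ.+-inverseʳ M)))))) ,
        (λ e → ℕ.<⇒≢ d<S (ℤ.+-injective (trans (trans (solve 2 (λ M d → d := :- (M :- d) :+ M) refl M (+ d)) (cong (_+ M) e)) half)))

    -- M′ is half of a sum S′ that exceeds S, so every exponent that occurs is smaller than M′ in absolute value.
    profile-above : ∀ {M′ S′} → M′ + M′ ≡ + S′ → S ℕ.< S′ → profile M′ M ds ≡ 0ℤ
    profile-above {M′} {S′} half′ S<S′ = cong₂ _-_ (odd-≢ M≢M′ -M≢M′) (oddSum-0 M′ (All.map sep d<S))
      where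
      M≢M′ : M ≢ M′
      M≢M′ refl = ℕ.<⇒≢ S<S′ (ℤ.+-injective (trans (sym half) half′))
      -M≢M′ : - M ≢ M′
      -M≢M′ refl = ℕ.<⇒≢ (ℕ.≤-trans S>0 (ℕ.m≤n+m S S′)) (sym (ℤ.+-injective (trans (cong₂ _+_ (sym half′) (sym half))
        (solve 1 (λ M → (:- M :+ :- M) :+ (M :+ M) := con 0ℤ) refl M))))
      sep : ∀ {d} → d ℕ.< S → M - + d ≢ M′ × - (M - + d) ≢ M′
      sep {d} d<S =
        (λ { refl → ℕ.<⇒≢ (ℕ.<-≤-trans S<S′ (ℕ.m≤m+n S′ (d ℕ.+ d))) (ℤ.+-injective (trans (sym half)
          (trans (solve 2 (λ M d → M :+ M := ((M :- d) :+ (M :- d)) :+ (d :+ d)) refl M (+ d)) (cong (_+ (+ d + + d)) half′)))) }) ,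
        (λ { refl → ℕ.<⇒≢ (ℕ.+-mono-< d<S (ℕ.<-trans d<S S<S′)) (ℤ.+-injective
          (trans (solve 2 (λ M d → d :+ d := (M :+ M) :+ (:- (M :- d) :+ :- (M :- d))) refl M (+ d)) (cong₂ _+_ half half′))) })

    shifts-sum : sumℤ (shifts M ds) ≡ M
    shifts-sum = trans (solve 4 (λ M a b c → (M :- a) :+ ((M :- b) :+ ((M :- c) :+ con 0ℤ)) := M :+ ((M :+ M) :- (a :+ (b :+ (c :+ con 0ℤ))))) refl M (+ d₁) (+ d₂) (+ d₃))
        (trans (cong (λ s → M + (s - + S)) half) (solve 2 (λ M s → M :+ (s :- s) := M) refl M (+ S)))

    -- Two of the shifts add up to 2M minus two of the differences, which is the third difference
    -- and hence positive.
    shifts-↭ : ∀ {ms′} → (∀ k → oddSum k (shifts M ds) ≡ oddSum k ms′) → sumℤ ms′ ≡ M → length ms′ ≡ 3 → shifts M ds ↭ ms′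
    shifts-↭ same sum′ = match₃ (positive d₃>0 (eq (solve 4 (λ M a b c → (M :- a) :+ (M :- b) := (M :+ M) :- (a :+ b) ) refl M (+ d₁) (+ d₂) (+ d₃))
                                   (solve 3 (λ a b c → (a :+ (b :+ (c :+ con 0ℤ))) :- (a :+ b) := c) refl (+ d₁) (+ d₂) (+ d₃))))
                                (positive d₂>0 (eq (solve 4 (λ M a b c → (M :- a) :+ (M :- c) := (M :+ M) :- (a :+ c) ) refl M (+ d₁) (+ d₂) (+ d₃))
                                   (solve 3 (λ a b c → (a :+ (b :+ (c :+ con 0ℤ))) :- (a :+ c) := b) refl (+ d₁) (+ d₂) (+ d₃))))
                                (positive d₁>0 (eq (solve 4 (λ M a b c → (M :- b) :+ (M :- c) := (M :+ M) :- (b :+ c) ) refl M (+ d₁) (+ d₂) (+ d₃))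
                                   (solve 3 (λ a b c → (a :+ (b :+ (c :+ con 0ℤ))) :- (b :+ c) := a) refl (+ d₁) (+ d₂) (+ d₃))))
                                same (trans shifts-sum (sym sum′))
      where
      positive : ∀ {d x} → 0 ℕ.< d → x ≡ + d → 0ℤ < x
      positive 0<d refl = +<+ 0<d
      eq : ∀ {x r y} → x ≡ M + M - r → + S - r ≡ y → x ≡ y
      eq {r = r} e e′ = trans e (trans (cong (_- r) half) e′)

  unshift : ∀ {M ds ds′} → shifts M ds ↭ shifts M ds′ → ds ↭ ds′
  unshift {M} {ds} {ds′} p = subst (_↭ ds′) (back ds) (subst (map (λ m → ∣ M - m ∣) (shifts M ds) ↭_) (back ds′) (↭.map⁺ (λ m → ∣ M - m ∣) p))
    where
    back : ∀ ds → map (λ m → ∣ M - m ∣) (shifts M ds) ≡ ds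
    back ds = trans (sym (List.map-∘ ds)) (trans (List.map-cong (λ d → cong ∣_∣ (solve 2 (λ M d → M :- (M :- d) := d) refl M (+ d))) ds) (List.map-id ds))

  -- If the sums differ, the coefficient at the larger center is 0 on one side and the nonzero
  -- factor on the other. If they agree, the top coefficients identify the factors, which then
  -- cancel in ℤ.
  profile-unique : ∀ {M M′ d₁ d₂ d₃ d₁′ d₂′ d₃′ s s′} →
    M + M ≡ + ℕ.sum (d₁ ∷ d₂ ∷ d₃ ∷ []) → M′ + M′ ≡ + ℕ.sum (d₁′ ∷ d₂′ ∷ d₃′ ∷ []) →
    0 ℕ.< d₁ → 0 ℕ.< d₂ → 0 ℕ.< d₃ → 0 ℕ.< d₁′ → 0 ℕ.< d₂′ → 0 ℕ.< d₃′ → s ≢ 0ℤ → s′ ≢ 0ℤ →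
    (∀ k → s * profile k M (d₁ ∷ d₂ ∷ d₃ ∷ []) ≡ s′ * profile k M′ (d₁′ ∷ d₂′ ∷ d₃′ ∷ [])) →
    d₁ ∷ d₂ ∷ d₃ ∷ [] ↭ d₁′ ∷ d₂′ ∷ d₃′ ∷ [] × s ≡ s′
  profile-unique {M} {M′} {d₁} {d₂} {d₃} {d₁′} {d₂′} {d₃′} {s} {s′} half half′ p₁ p₂ p₃ p₁′ p₂′ p₃′ s≢0 s′≢0 same
    with ℕ.<-cmp (ℕ.sum (d₁ ∷ d₂ ∷ d₃ ∷ [])) (ℕ.sum (d₁′ ∷ d₂′ ∷ d₃′ ∷ []))
  ... | tri< S<S′ _ _ = contradiction (trans (sym (ℤ.*-identityʳ s′)) (trans (cong (s′ *_) (sym (profile-top M′ half′ p₁′ p₂′ p₃′)))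
          (trans (sym (same M′)) (trans (cong (s *_) (profile-above M half p₁ p₂ p₃ {M′} half′ S<S′)) (ℤ.*-zeroʳ s))))) s′≢0
  ... | tri> _ _ S′<S = contradiction (trans (sym (ℤ.*-identityʳ s)) (trans (cong (s *_) (sym (profile-top M half p₁ p₂ p₃)))
          (trans (same M) (trans (cong (s′ *_) (profile-above M′ half′ p₁′ p₂′ p₃′ {M} half S′<S)) (ℤ.*-zeroʳ s′))))) s≢0
  ... | tri≈ _ S≡S′ _ with double-injective {M} {M′} (trans half (trans (cong +_ S≡S′) (sym half′)))
  ...   | refl = unshift {M} (shifts-↭ M half p₁ p₂ p₃ oddSums (shifts-sum M half′ p₁′ p₂′ p₃′) refl) , s≡s′
    where
    s≡s′ : s ≡ s′
    s≡s′ = trans (sym (ℤ.*-identityʳ s)) (trans (cong (s *_) (sym (profile-top M half p₁ p₂ p₃)))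
      (trans (same M) (trans (cong (s′ *_) (profile-top M half′ p₁′ p₂′ p₃′)) (ℤ.*-identityʳ s′))))
    oddSums : ∀ k → oddSum k (shifts M (d₁ ∷ d₂ ∷ d₃ ∷ [])) ≡ oddSum k (shifts M (d₁′ ∷ d₂′ ∷ d₃′ ∷ []))
    oddSums k = trans (solve 2 (λ o x → x := o :- (o :- x)) refl (odd k M) _)
      (trans (cong (λ x → odd k M - x) (ℤ.*-cancelˡ-≡ s _ _ {{ℤ.≢-nonZero s≢0}} (trans (same k) (cong (_* _) (sym s≡s′)))))
        (solve 2 (λ o x → o :- (o :- x) := x) refl (odd k M) _))

  -- The coefficient of zᵏ in (z^a₁ - z^a₂)(z^-b₁ - z^-b₂) - (z^-a₁ - z^-a₂)(z^b₁ - z^b₂).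
  oddWedge : ℤ → ℤ → ℤ → ℤ → ℤ → ℤ
  oddWedge k a₁ a₂ b₁ b₂ = odd k (a₁ - b₁) - odd k (a₁ - b₂) - odd k (a₂ - b₁) + odd k (a₂ - b₂)

  private
    oddEq : ∀ k {x y} → x ≡ y → odd k x ≡ odd k y
    oddEq k = cong (odd k)

  module _ (a₁ a₂ b₁ b₂ : ℤ) {d₁ d₂ d₃ : ℕ} (e₁ : a₁ - a₂ ≡ + d₁) (e₂ : b₁ - b₂ ≡ + d₂) where

    -- The center a₁ - b₂ is the exponent whose double is d₁ + d₂ + d₃. The exponents a₂ - b₂, a₁ -
    -- b₁ and b₁ - a₂ lie below it by d₁, d₂ and d₃; the last of them is a₂ - b₁ reversed, which by
    -- oddness changes the sign of its term.
    oddWedge-positive : a₁ + a₂ - (b₁ + b₂) ≡ + d₃ →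
      (∀ k → oddWedge k a₁ a₂ b₁ b₂ ≡ - profile k (a₁ - b₂) (d₁ ∷ d₂ ∷ d₃ ∷ [])) ×
      (a₁ - b₂) + (a₁ - b₂) ≡ + ℕ.sum (d₁ ∷ d₂ ∷ d₃ ∷ [])
    -- `ℕ.sum` of the triple ends in `d₃ + 0`.
    oddWedge-positive e₃ rewrite ℕ.+-identityʳ d₃ =
      (λ k → trans (cong₂ _+_ (cong (λ x → odd k (a₁ - b₁) - odd k (a₁ - b₂) - x) (trans (oddEq k (solve 2 (λ a b → a :- b := :- (b :- a)) refl a₂ b₁)) (odd-neg k (b₁ - a₂)))) refl)
        (trans (solve 4 (λ p m q r → p :- m :- :- q :+ r := :- (m :- (r :+ (p :+ (q :+ con 0ℤ))))) refl (odd k (a₁ - b₁)) (odd k (a₁ - b₂)) (odd k (b₁ - a₂)) (odd k (a₂ - b₂)))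
          (cong (λ x → - (odd k (a₁ - b₂) - x)) (cong₂ _+_ (oddEq k s₁) (cong₂ _+_ (oddEq k s₂) (cong (_+ 0ℤ) (oddEq k s₃))))))) ,
      trans (solve 4 (λ a₁ a₂ b₁ b₂ → (a₁ :- b₂) :+ (a₁ :- b₂) := (a₁ :- a₂) :+ ((b₁ :- b₂) :+ (a₁ :+ a₂ :- (b₁ :+ b₂)))) refl a₁ a₂ b₁ b₂)
        (cong₂ _+_ e₁ (cong₂ _+_ e₂ e₃))
      where
      s₁ : a₂ - b₂ ≡ a₁ - b₂ - + d₁
      s₁ rewrite sym e₁ = solve 3 (λ a₁ a₂ b₂ → a₂ :- b₂ := a₁ :- b₂ :- (a₁ :- a₂)) refl a₁ a₂ b₂
      s₂ : a₁ - b₁ ≡ a₁ - b₂ - + d₂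
      s₂ rewrite sym e₂ = solve 3 (λ a₁ b₁ b₂ → a₁ :- b₁ := a₁ :- b₂ :- (b₁ :- b₂)) refl a₁ b₁ b₂
      s₃ : b₁ - a₂ ≡ a₁ - b₂ - + d₃
      s₃ rewrite sym e₃ = solve 4 (λ a₁ a₂ b₁ b₂ → b₁ :- a₂ := a₁ :- b₂ :- (a₁ :+ a₂ :- (b₁ :+ b₂))) refl a₁ a₂ b₁ b₂

  -- Equal sums make a₂ - b₁ the negative of a₁ - b₂ and a₂ - b₂ that of a₁ - b₁, so the four odd
  -- terms cancel in pairs.
  oddWedge-zero : ∀ a₁ a₂ b₁ b₂ → a₁ + a₂ - (b₁ + b₂) ≡ 0ℤ → ∀ k → oddWedge k a₁ a₂ b₁ b₂ ≡ 0ℤ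
  oddWedge-zero a₁ a₂ b₁ b₂ e₃ k = trans (cong₂ (λ x y → odd k (a₁ - b₁) - odd k (a₁ - b₂) - x + y)
      (trans (oddEq k s) (odd-neg k (a₁ - b₂))) (trans (oddEq k s′) (odd-neg k (a₁ - b₁))))
    (solve 2 (λ x y → x :- y :- :- y :+ :- x := con 0ℤ) refl (odd k (a₁ - b₁)) (odd k (a₁ - b₂)))
    where
    s : a₂ - b₁ ≡ - (a₁ - b₂)
    s = trans (solve 4 (λ a₁ a₂ b₁ b₂ → a₂ :- b₁ := (a₁ :+ a₂ :- (b₁ :+ b₂)) :- (a₁ :- b₂)) refl a₁ a₂ b₁ b₂) (trans (cong (_- (a₁ - b₂)) e₃) (ℤ.+-identityˡ _))
    s′ : a₂ - b₂ ≡ - (a₁ - b₁)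
    s′ = trans (solve 4 (λ a₁ a₂ b₁ b₂ → a₂ :- b₂ := (a₁ :+ a₂ :- (b₁ :+ b₂)) :- (a₁ :- b₁)) refl a₁ a₂ b₁ b₂) (trans (cong (_- (a₁ - b₁)) e₃) (ℤ.+-identityˡ _))

  -- Interchanging the pairs also negates d̃₃, so the case of negative d̃₃ reduces to that of
  -- positive d̃₃; hence the factor `sgn D` in `Center`.
  oddWedge-swap : ∀ k a₁ a₂ b₁ b₂ → oddWedge k a₁ a₂ b₁ b₂ ≡ - oddWedge k b₁ b₂ a₁ a₂
  oddWedge-swap k a₁ a₂ b₁ b₂ = trans
    (cong₂ _+_ (cong₂ _-_ (cong₂ _-_ (turn a₁ b₁) (turn a₁ b₂)) (turn a₂ b₁)) (turn a₂ b₂))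
    (solve 4 (λ x y z w → :- x :- :- y :- :- z :+ :- w := :- (x :- z :- y :+ w)) refl (odd k (b₁ - a₁)) (odd k (b₂ - a₁)) (odd k (b₁ - a₂)) (odd k (b₂ - a₂)))
    where
    turn : ∀ a b → odd k (a - b) ≡ - odd k (b - a)
    turn a b = trans (oddEq k (solve 2 (λ a b → a :- b := :- (b :- a)) refl a b)) (odd-neg k (b - a))

  -- The number M of the overview, given through its double. It is a₁ - b₂ or b₁ - a₂ according to
  -- the sign of `D`.
  record Center (a₁ a₂ b₁ b₂ : ℤ) (d₁ d₂ : ℕ) (D : ℤ) : Set where
    field
      center : ℤ
      half   : center + center ≡ + ℕ.sum (d₁ ∷ d₂ ∷ ∣ D ∣ ∷ [])
      value  : ∀ k → oddWedge k a₁ a₂ b₁ b₂ ≡ - sgn D * profile k center (d₁ ∷ d₂ ∷ ∣ D ∣ ∷ [])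

  findCenter : ∀ {a₁ a₂ b₁ b₂ d₁ d₂} D → a₁ - a₂ ≡ + d₁ → b₁ - b₂ ≡ + d₂ →
               a₁ + a₂ - (b₁ + b₂) ≡ D → D ≢ 0ℤ → Center a₁ a₂ b₁ b₂ d₁ d₂ D
  findCenter (+ zero) _ _ _ D≢0 = contradiction refl D≢0
  findCenter {a₁} {a₂} {b₁} {b₂} (+ suc n) e₁ e₂ e₃ _ = record
    { center = a₁ - b₂
    ; half   = proj₂ (oddWedge-positive a₁ a₂ b₁ b₂ e₁ e₂ e₃)
    ; value  = λ k → trans (proj₁ (oddWedge-positive a₁ a₂ b₁ b₂ e₁ e₂ e₃) k) (sym (ℤ.-1*i≡-i _))
    }
  findCenter {a₁} {a₂} {b₁} {b₂} {d₁} {d₂} -[1+ n ] e₁ e₂ e₃ _ = record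
    { center = b₁ - a₂
    ; half   = trans (proj₂ swapped) (cong +_ (ℕ.sum-↭ reorder))
    ; value  = λ k → trans (oddWedge-swap k a₁ a₂ b₁ b₂)
        (trans (cong -_ (proj₁ swapped k)) (trans (ℤ.neg-involutive _)
          (trans (profile-↭ k (b₁ - a₂) reorder) (sym (ℤ.*-identityˡ _)))))
    }
    where
    swapped = oddWedge-positive b₁ b₂ a₁ a₂ {d₃ = suc n} e₂ e₁
      (trans (solve 4 (λ a₁ a₂ b₁ b₂ → b₁ :+ b₂ :- (a₁ :+ a₂) := :- (a₁ :+ a₂ :- (b₁ :+ b₂))) refl a₁ a₂ b₁ b₂) (cong -_ e₃))
    reorder : d₂ ∷ d₁ ∷ suc n ∷ [] ↭ d₁ ∷ d₂ ∷ suc n ∷ []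
    reorder = ↭.swap d₂ d₁ ↭-refl

-- The commutative ring of Laurent polynomials and its cancellable elements.

module LaurentRing {c ℓ} (R : CommutativeRing c ℓ) where
  open import Defs
  open import Level using (_⊔_)
  open import Data.Bool.Base using (if_then_else_)
  open import Data.Integer.Base as ℤ using (ℤ; +_; -[1+_]; 0ℤ; 1ℤ; -1ℤ)
  import Data.Integer.Properties as ℤ
  open import Data.List.Base using ([]; _∷_; _++_; map)
  open import Data.Nat.Base as ℕ using (ℕ; zero; suc)
  import Data.Nat.Properties as ℕ
  open import Data.Product.Base using (Σ-syntax; _,_; proj₁; proj₂)
  open import Relation.Nullary.Decidable.Core using (⌊_⌋; yes; no)
  open import Relation.Nullary.Negation.Core using (contradiction)
  open import Relation.Binary.PropositionalEquality.Core as ≡ using (_≡_; _≢_)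
  open import Relation.Binary.Structures using (IsEquivalence)
  open SumMultisets using (indicator; oddWedge)
  open Laurent R
  open CommutativeRing R hiding (zero)
  open IntegerImage R
  open import Relation.Binary.Reasoning.Setoid setoid

  -- Σ a g(i) over the terms a zⁱ of p: this turns products into iterated sums.
  pair : LaurentPoly → (ℤ → Carrier) → Carrier
  pair []            g = 0#
  pair ((i , a) ∷ p) g = a * g i + pair p g

  δ : ℤ → ℤ → Carrier
  δ k i = if ⌊ i ℤ.≟ k ⌋ then 1# else 0#

  pair-cong : ∀ p {g h} → (∀ i → g i ≈ h i) → pair p g ≈ pair p h
  pair-cong []            g≈h = refl
  pair-cong ((i , a) ∷ p) g≈h = +-cong (*-congˡ (g≈h i)) (pair-cong p g≈h)

  pair-++ : ∀ p q g → pair (p ++ q) g ≈ pair p g + pair q g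
  pair-++ []            q g = sym (+-identityˡ _)
  pair-++ ((i , a) ∷ p) q g = trans (+-congˡ (pair-++ p q g)) (sym (+-assoc _ _ _))

  pair-linear : ∀ p a g h → pair p (λ i → a * g i + h i) ≈ a * pair p g + pair p h
  pair-linear []            a g h = sym (trans (+-identityʳ _) (zeroʳ a))
  pair-linear ((i , b) ∷ p) a g h = trans (+-congˡ (pair-linear p a g h))
    (solve 6 (λ a b g h x y → b :* (a :* g :+ h) :+ (a :* x :+ y) := a :* (b :* g :+ x) :+ (b :* h :+ y)) refl a b _ _ _ _)

  pair-0 : ∀ p → pair p (λ _ → 0#) ≈ 0#
  pair-0 []            = refl
  pair-0 ((i , a) ∷ p) = trans (+-cong (zeroʳ a) (pair-0 p)) (+-identityˡ _)

  pair-swap : ∀ p q (g : ℤ → ℤ → Carrier) → pair p (λ i → pair q (g i)) ≈ pair q (λ j → pair p (λ i → g i j))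
  pair-swap []            q g = sym (pair-0 q)
  pair-swap ((i , a) ∷ p) q g = trans (+-congˡ (pair-swap p q g)) (sym (pair-linear q a (g i) _))

  -- With products as iterated sums, the laws of multiplication reduce to those of adding exponents
  -- and to an interchange of sums.
  pair-* : ∀ p q g → pair (p *ᴸ q) g ≈ pair p (λ i → pair q (λ j → g (i ℤ.+ j)))
  pair-* []            q g = refl
  pair-* ((i , a) ∷ p) q g = trans (pair-++ (map _ q) (p *ᴸ q) g) (+-cong (row q) (pair-* p q g))
    where
    row : ∀ q → pair (map (λ { (j , b) → i ℤ.+ j , a * b }) q) g ≈ a * pair q (λ j → g (i ℤ.+ j))
    row []            = sym (zeroʳ a)
    row ((j , b) ∷ q) = trans (+-cong (*-assoc a b _) (row q)) (sym (distribˡ a _ _))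

  coeff-pair : ∀ p k → coeff p k ≈ pair p (δ k)
  coeff-pair []            k = refl
  coeff-pair ((i , a) ∷ p) k with i ℤ.≟ k
  ... | yes _ = +-cong (sym (*-identityʳ a)) (coeff-pair p k)
  ... | no _  = +-cong (sym (zeroʳ a)) (coeff-pair p k)

  δ-shift : ∀ k i j → δ k (i ℤ.+ j) ≡ δ (k ℤ.- i) j
  δ-shift k i j with i ℤ.+ j ℤ.≟ k | j ℤ.≟ k ℤ.- i
  ... | yes _  | yes _  = ≡.refl
  ... | no _   | no _   = ≡.refl
  ... | yes ≡.refl | no ≢ = contradiction (≡.sym (≡.trans (≡.cong (ℤ._- i) (ℤ.+-comm i j))
    (≡.trans (ℤ.+-assoc j i (ℤ.- i)) (≡.trans (≡.cong (λ l → j ℤ.+ l) (ℤ.+-inverseʳ i)) (ℤ.+-identityʳ j))))) ≢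
  ... | no ≢ | yes ≡.refl = contradiction (≡.trans (ℤ.+-comm i _) (≡.trans (ℤ.+-assoc k (ℤ.- i) i) (≡.trans (≡.cong (λ l → k ℤ.+ l) (ℤ.+-inverseˡ i)) (ℤ.+-identityʳ k)))) ≢

  coeff-++ : ∀ p q k → coeff (p ++ q) k ≈ coeff p k + coeff q k
  coeff-++ []      q k = sym (+-identityˡ _)
  coeff-++ (_ ∷ p) q k = trans (+-congˡ (coeff-++ p q k)) (sym (+-assoc _ _ _))

  coeff-* : ∀ p q k → coeff (p *ᴸ q) k ≈ pair p (λ i → coeff q (k ℤ.- i))
  coeff-* p q k = begin
    coeff (p *ᴸ q) k                                    ≈⟨ coeff-pair (p *ᴸ q) k ⟩
    pair (p *ᴸ q) (δ k)                                 ≈⟨ pair-* p q (δ k) ⟩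
    pair p (λ i → pair q (λ j → δ k (i ℤ.+ j)))         ≈⟨ pair-cong p (λ i → pair-cong q (λ j → reflexive (δ-shift k i j))) ⟩
    pair p (λ i → pair q (δ (k ℤ.- i)))                 ≈⟨ pair-cong p (λ i → coeff-pair q (k ℤ.- i)) ⟨
    pair p (λ i → coeff q (k ℤ.- i))                    ∎

  ≈ᴸ-isEquivalence : IsEquivalence _≈ᴸ_
  ≈ᴸ-isEquivalence = record
    { refl = λ k → refl ; sym = λ e k → sym (e k) ; trans = λ e e′ k → trans (e k) (e′ k) }

  *ᴸ-comm : ∀ p q → (p *ᴸ q) ≈ᴸ (q *ᴸ p)
  *ᴸ-comm p q k = begin
    coeff (p *ᴸ q) k                               ≈⟨ coeff-pair (p *ᴸ q) k ⟩
    pair (p *ᴸ q) (δ k)                            ≈⟨ pair-* p q (δ k) ⟩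
    pair p (λ i → pair q (λ j → δ k (i ℤ.+ j)))    ≈⟨ pair-swap p q _ ⟩
    pair q (λ j → pair p (λ i → δ k (i ℤ.+ j)))    ≈⟨ pair-cong q (λ j → pair-cong p (λ i → reflexive (≡.cong (δ k) (ℤ.+-comm i j)))) ⟩
    pair q (λ j → pair p (λ i → δ k (j ℤ.+ i)))    ≈⟨ pair-* q p (δ k) ⟨
    pair (q *ᴸ p) (δ k)                            ≈⟨ coeff-pair (q *ᴸ p) k ⟨
    coeff (q *ᴸ p) k                               ∎

  private
    *ᴸ-congˡ : ∀ p {q q′} → q ≈ᴸ q′ → (p *ᴸ q) ≈ᴸ (p *ᴸ q′)
    *ᴸ-congˡ p {q} {q′} e k =
      trans (coeff-* p q k) (trans (pair-cong p (λ i → e (k ℤ.- i))) (sym (coeff-* p q′ k)))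

  *ᴸ-cong : ∀ {p p′ q q′} → p ≈ᴸ p′ → q ≈ᴸ q′ → (p *ᴸ q) ≈ᴸ (p′ *ᴸ q′)
  *ᴸ-cong {p} {p′} {q} {q′} e e′ k =
    trans (*ᴸ-congˡ p {q} {q′} e′ k) (trans (*ᴸ-comm p q′ k) (trans (*ᴸ-congˡ q′ {p} {p′} e k) (*ᴸ-comm q′ p′ k)))

  *ᴸ-assoc : ∀ p q r → ((p *ᴸ q) *ᴸ r) ≈ᴸ (p *ᴸ (q *ᴸ r))
  *ᴸ-assoc p q r k = begin
    coeff ((p *ᴸ q) *ᴸ r) k
      ≈⟨ coeff-pair ((p *ᴸ q) *ᴸ r) k ⟩
    pair ((p *ᴸ q) *ᴸ r) (δ k)
      ≈⟨ trans (pair-* (p *ᴸ q) r (δ k)) (pair-* p q _) ⟩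
    pair p (λ i → pair q (λ j → pair r (λ l → δ k (i ℤ.+ j ℤ.+ l))))
      ≈⟨ pair-cong p (λ i → pair-cong q (λ j → pair-cong r (λ l → reflexive (≡.cong (δ k) (ℤ.+-assoc i j l))))) ⟩
    pair p (λ i → pair q (λ j → pair r (λ l → δ k (i ℤ.+ (j ℤ.+ l)))))
      ≈⟨ pair-cong p (λ i → sym (pair-* q r _)) ⟩
    pair p (λ i → pair (q *ᴸ r) (λ j → δ k (i ℤ.+ j)))
      ≈⟨ pair-* p (q *ᴸ r) (δ k) ⟨
    pair (p *ᴸ (q *ᴸ r)) (δ k)
      ≈⟨ coeff-pair (p *ᴸ (q *ᴸ r)) k ⟨
    coeff (p *ᴸ (q *ᴸ r)) k ∎

  coeff-const-* : ∀ a p k → coeff (const a *ᴸ p) k ≈ a * coeff p k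
  coeff-const-* a p k = trans (coeff-* (const a) p k)
    (trans (+-identityʳ _) (*-congˡ (reflexive (≡.cong (coeff p) (ℤ.+-identityʳ k)))))

  *ᴸ-identityˡ : ∀ p → (const 1# *ᴸ p) ≈ᴸ p
  *ᴸ-identityˡ p k = trans (coeff-const-* 1# p k) (*-identityˡ _)

  *ᴸ-distribʳ : ∀ p q r → ((q ++ r) *ᴸ p) ≈ᴸ ((q *ᴸ p) ++ (r *ᴸ p))
  *ᴸ-distribʳ p q r k = trans (coeff-* (q ++ r) p k) (trans (pair-++ q r _)
    (trans (+-cong (sym (coeff-* q p k)) (sym (coeff-* r p k))) (sym (coeff-++ (q *ᴸ p) (r *ᴸ p) k))))

  -ᴸ_ : LaurentPoly → LaurentPoly
  -ᴸ_ = map (λ { (i , a) → i , - a })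

  coeff-neg : ∀ p k → coeff (-ᴸ p) k ≈ - coeff p k
  coeff-neg []            k = sym -0#≈0#
  coeff-neg ((i , a) ∷ p) k with i ℤ.≟ k
  ... | yes _ = trans (+-congˡ (coeff-neg p k)) (solve 2 (λ a b → :- a :+ :- b := :- (a :+ b)) refl _ _)
  ... | no _  = trans (+-congˡ (coeff-neg p k)) (solve 1 (λ b → con 0ℤ :+ :- b := :- (con 0ℤ :+ b)) refl _)

  laurentRing : CommutativeRing c ℓ
  laurentRing = record
    { Carrier = LaurentPoly ; _≈_ = _≈ᴸ_ ; _+_ = _++_ ; _*_ = _*ᴸ_ ; -_ = -ᴸ_ ; 0# = 0ᴸ ; 1# = const 1#
    ; isCommutativeRing = record
      { isRing = record
        { +-isAbelianGroup = record
          { isGroup = record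
            { isMonoid = record
              { isSemigroup = record
                { isMagma = record
                  { isEquivalence = ≈ᴸ-isEquivalence
                  ; ∙-cong = λ {p} {p′} {q} {q′} e e′ k → trans (coeff-++ p q k) (trans (+-cong (e k) (e′ k)) (sym (coeff-++ p′ q′ k)))
                  }
                ; assoc = λ p q r k → trans (coeff-++ (p ++ q) r k) (trans (+-congʳ (coeff-++ p q k))
                    (trans (+-assoc _ _ _) (trans (+-congˡ (sym (coeff-++ q r k))) (sym (coeff-++ p (q ++ r) k)))))
                }
              ; identity = (λ p k → refl) , (λ p k → trans (coeff-++ p [] k) (+-identityʳ _))
              }
            ; inverse = (λ p k → trans (coeff-++ (-ᴸ p) p k) (trans (+-congʳ (coeff-neg p k)) (-‿inverseˡ _)))
                      , (λ p k → trans (coeff-++ p (-ᴸ p) k) (trans (+-congˡ (coeff-neg p k)) (-‿inverseʳ _)))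
            ; ⁻¹-cong = λ {p} {q} e k → trans (coeff-neg p k) (trans (-‿cong (e k)) (sym (coeff-neg q k)))
            }
          ; comm = λ p q k → trans (coeff-++ p q k) (trans (+-comm _ _) (sym (coeff-++ q p k)))
          }
        ; *-cong = λ {p} {p′} {q} {q′} → *ᴸ-cong {p} {p′} {q} {q′}
        ; *-assoc = *ᴸ-assoc
        ; *-identity = *ᴸ-identityˡ , (λ p k → trans (*ᴸ-comm p (const 1#) k) (*ᴸ-identityˡ p k))
        ; distrib = (λ p q r k → trans (*ᴸ-comm p (q ++ r) k) (trans (*ᴸ-distribʳ p q r k)
                      (trans (coeff-++ (q *ᴸ p) (r *ᴸ p) k) (trans (+-cong (*ᴸ-comm q p k) (*ᴸ-comm r p k)) (sym (coeff-++ (p *ᴸ q) (p *ᴸ r) k))))))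
                  , *ᴸ-distribʳ
        }
      ; *-comm = *ᴸ-comm
      }
    }

  private module L = CommutativeRing laurentRing

  open IntegerImage laurentRing using () renaming (ι to ιᴸ)
  private module SL = IntegerImage laurentRing
  open import Algebra.Properties.Semiring.Exp L.semiring using () renaming (_^_ to _^ᴸ_)
  open import Algebra.Properties.Semiring.Exp semiring using (_^_)
  open import Algebra.Properties.Semiring.Mult semiring using () renaming (_×_ to _·_)
  open import Algebra.Properties.Semiring.Mult L.semiring using () renaming (_×_ to _·ᴸ_)

  coeff-const : ∀ a k → coeff (const a) k ≈ a * δ k 0ℤ
  coeff-const a k = trans (coeff-pair (const a) k) (+-identityʳ _)

  const-cong : ∀ {a b} → a ≈ b → const a ≈ᴸ const b
  const-cong {a} {b} e k = trans (coeff-const a k) (trans (*-congʳ e) (sym (coeff-const b k)))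

  const-+ : ∀ a b → const (a + b) ≈ᴸ (const a ++ const b)
  const-+ a b k = trans (coeff-const (a + b) k) (trans (distribʳ _ a b)
    (trans (+-cong (sym (coeff-const a k)) (sym (coeff-const b k))) (sym (coeff-++ (const a) (const b) k))))

  const-0 : const 0# ≈ᴸ []
  const-0 k = trans (coeff-const 0# k) (zeroˡ _)

  const-^ : ∀ a m → const a ^ᴸ m ≈ᴸ const (a ^ m)
  const-^ a zero    _ = refl
  const-^ a (suc m) = *ᴸ-cong {const a} {const a} {const a ^ᴸ m} {const (a ^ m)} (λ _ → refl) (const-^ a m)

  ι-const : ∀ i → ιᴸ i ≈ᴸ const (ι i)
  ι-const (+ n)    = nat n
    where
    nat : ∀ n → n ·ᴸ const 1# ≈ᴸ const (n · 1#)
    nat zero    = λ k → sym (const-0 k)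
    nat (suc n) = λ k → trans (coeff-++ (const 1#) (n ·ᴸ const 1#) k) (trans (+-congˡ (nat n k))
      (trans (sym (coeff-++ (const 1#) (const (n · 1#)) k)) (sym (const-+ 1# (n · 1#) k))))
  ι-const -[1+ n ] = L.-‿cong {suc n ·ᴸ const 1#} {const (suc n · 1#)} (ι-const (+ suc n))

  coeff-ι-* : ∀ i p k → coeff (ιᴸ i *ᴸ p) k ≈ ι i * coeff p k
  coeff-ι-* i p k = trans (*ᴸ-cong {ιᴸ i} {const (ι i)} {p} {p} (ι-const i) (λ _ → refl) k) (coeff-const-* (ι i) p k)

  IsConstant : LaurentPoly → Set (c ⊔ ℓ)
  IsConstant p = Σ[ a ∈ Carrier ] p ≈ᴸ const a

  T : ℤ → LaurentPoly
  T i = (i , 1#) ∷ []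

  T-+ : ∀ i j → (T i *ᴸ T j) ≈ᴸ T (i ℤ.+ j)
  T-+ i j k = begin
    coeff (T i *ᴸ T j) k          ≈⟨ coeff-pair (T i *ᴸ T j) k ⟩
    1# * 1# * δ k (i ℤ.+ j) + 0#  ≈⟨ +-congʳ (*-congʳ (*-identityˡ 1#)) ⟩
    1# * δ k (i ℤ.+ j) + 0#       ≈⟨ coeff-pair (T (i ℤ.+ j)) k ⟨
    coeff (T (i ℤ.+ j)) k         ∎

  z^ : ∀ m → z ^ᴸ m ≈ᴸ T (+ m)
  z^ zero    _ = refl
  z^ (suc m) = λ k → trans (*ᴸ-cong {z} {z} {z ^ᴸ m} {T (+ m)} (λ _ → refl) (z^ m) k) (T-+ 1ℤ (+ m) k)

  z⁻¹^ : ∀ m → z⁻¹ ^ᴸ m ≈ᴸ T (ℤ.- (+ m))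
  z⁻¹^ zero    _ = refl
  z⁻¹^ (suc m) = λ k → trans (*ᴸ-cong {z⁻¹} {z⁻¹} {z⁻¹ ^ᴸ m} {T (ℤ.- (+ m))} (λ _ → refl) (z⁻¹^ m) k)
    (trans (T-+ -1ℤ (ℤ.- (+ m)) k) (reflexive (≡.cong (λ i → coeff (T i) k) (≡.sym (ℤ.neg-distrib-+ 1ℤ (+ m))))))

  private
    i≤∣i∣ : ∀ i → i ℤ.≤ + ℤ.∣ i ∣
    i≤∣i∣ (+ n)    = ℤ.≤-refl
    i≤∣i∣ -[1+ n ] = ℤ.-≤+

  bounded : ∀ p → Σ[ M ∈ ℕ ] (∀ k → + M ℤ.≤ k → coeff p k ≈ 0#)
  bounded [] = 0 , λ k _ → refl
  bounded ((i , a) ∷ p) with bounded p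
  ... | M , p≈0 = suc ℤ.∣ i ∣ ℕ.+ M , vanish
    where
    vanish : ∀ k → + (suc ℤ.∣ i ∣ ℕ.+ M) ℤ.≤ k → coeff ((i , a) ∷ p) k ≈ 0#
    vanish k ≤k with i ℤ.≟ k
    ... | yes ≡.refl = contradiction (ℤ.≤-<-trans (i≤∣i∣ i) (ℤ.<-≤-trans (ℤ.+<+ (ℕ.s≤s (ℕ.m≤m+n _ M))) ≤k)) (ℤ.<-irrefl ≡.refl)
    ... | no _ = trans (+-identityˡ _) (p≈0 k (ℤ.≤-trans (ℤ.+≤+ (ℕ.m≤n+m M _)) ≤k))

  -- Not being a zero divisor, phrased for direct use: the leading term of an arbitrary `q` cannot
  -- be located when equality of coefficients is undecidable. The property passes to products.
  Cancellable : LaurentPoly → Set (c ⊔ ℓ)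
  Cancellable p = ∀ q → (p *ᴸ q) ≈ᴸ 0ᴸ → q ≈ᴸ 0ᴸ

  -- A recurrence f k = a f (k + suc m) carries the vanishing at large exponents down to all exponents.
  recurrence-0 : ∀ p a m → (∀ k → coeff p k ≈ a * coeff p (k ℤ.+ + suc m)) → p ≈ᴸ 0ᴸ
  recurrence-0 p a m rec k = descend (M ℕ.+ ℤ.∣ k ∣) k (far k)
    where
    M = proj₁ (bounded p)
    descend : ∀ n k → + M ℤ.≤ k ℤ.+ + n → coeff p k ≈ 0#
    descend zero    k le = proj₂ (bounded p) k (≡.subst (+ M ℤ.≤_) (ℤ.+-identityʳ k) le)
    descend (suc n) k le = trans (rec k) (trans (*-congˡ (descend n (k ℤ.+ + suc m) le′)) (zeroʳ a))
      where
      le′ : + M ℤ.≤ (k ℤ.+ + suc m) ℤ.+ + n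
      le′ = ℤ.≤-trans le (≡.subst (k ℤ.+ + suc n ℤ.≤_) (≡.sym (ℤ.+-assoc k (+ suc m) (+ n)))
              (ℤ.+-monoʳ-≤ k (ℤ.+≤+ (ℕ.s≤s (ℕ.m≤n+m n m)))))
    far : ∀ k → + M ℤ.≤ k ℤ.+ + (M ℕ.+ ℤ.∣ k ∣)
    far (+ n)    = ℤ.+≤+ (ℕ.≤-trans (ℕ.m≤m+n M n) (ℕ.m≤n+m (M ℕ.+ n) n))
    far -[1+ n ] = ≡.subst (+ M ℤ.≤_) (≡.sym (ℤ.⊖-≥ (ℕ.m≤n+m (suc n) M)))
      (ℤ.+≤+ (ℕ.≤-reflexive (≡.sym (ℕ.m+n∸n≡m M (suc n)))))

  cancellable-≈ : ∀ {p q} → p ≈ᴸ q → Cancellable p → Cancellable q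
  cancellable-≈ {p} {q} e can f qf≈0 = can f (λ k → trans (*ᴸ-cong {p} {q} {f} {f} e (λ _ → refl) k) (qf≈0 k))

  cancellable-* : ∀ {p q} → Cancellable p → Cancellable q → Cancellable (p *ᴸ q)
  cancellable-* {p} {q} canp canq f e = canq f (canp (q *ᴸ f) (λ k → trans (sym (*ᴸ-assoc p q f k)) (e k)))

  cancellable-unit : ∀ {a} u → u * a ≈ 1# → Cancellable (const a)
  cancellable-unit {a} u ua≈1 f e k = begin
    coeff f k              ≈⟨ *-identityˡ _ ⟨
    1# * coeff f k         ≈⟨ *-congʳ ua≈1 ⟨
    u * a * coeff f k      ≈⟨ *-assoc u a _ ⟩
    u * (a * coeff f k)    ≈⟨ *-congˡ (trans (sym (coeff-const-* a f k)) (e k)) ⟩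
    u * 0#                 ≈⟨ zeroʳ u ⟩
    0#                     ∎

  -- The coefficient of the product at k + (j + suc m) involves `f` at `k` and at `k + suc m` only.
  -- As `a` is invertible, it expresses the former through the latter, which is the recurrence of
  -- `recurrence-0`.
  cancellable-binomial : ∀ {a b} j m u → u * a ≈ 1# → Cancellable ((j ℤ.+ + suc m , a) ∷ (j , b) ∷ [])
  cancellable-binomial {a} {b} j m u ua≈1 f e = recurrence-0 f (- (u * b)) m λ k → begin
    coeff f k
      ≈⟨ *-identityˡ _ ⟨
    1# * coeff f k
      ≈⟨ *-congʳ ua≈1 ⟨
    u * a * coeff f k
      ≈⟨ solve 5 (λ u a b x y → u :* a :* x := :- (u :* b) :* y :+ u :* (a :* x :+ (b :* y :+ con 0ℤ))) refl u a b _ _ ⟩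
    - (u * b) * coeff f (k ℤ.+ + suc m) + u * (a * coeff f k + (b * coeff f (k ℤ.+ + suc m) + 0#))
      ≈⟨ +-congˡ (*-congˡ (trans (sym (at k)) (e (k ℤ.+ (j ℤ.+ + suc m))))) ⟩
    - (u * b) * coeff f (k ℤ.+ + suc m) + u * 0#
      ≈⟨ trans (+-congˡ (zeroʳ u)) (+-identityʳ _) ⟩
    - (u * b) * coeff f (k ℤ.+ + suc m) ∎
    where
    open import Data.Integer.Solver using (module +-*-Solver)
    at : ∀ k → coeff (((j ℤ.+ + suc m , a) ∷ (j , b) ∷ []) *ᴸ f) (k ℤ.+ (j ℤ.+ + suc m)) ≈
               a * coeff f k + (b * coeff f (k ℤ.+ + suc m) + 0#)
    at k = trans (coeff-* ((j ℤ.+ + suc m , a) ∷ (j , b) ∷ []) f (k ℤ.+ (j ℤ.+ + suc m)))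
      (+-cong (*-congˡ (reflexive (≡.cong (coeff f) (S.solve 3 (λ k j m → k S.:+ (j S.:+ m) S.:- (j S.:+ m) S.:= k) ≡.refl k j (+ suc m)))))
              (+-congʳ (*-congˡ (reflexive (≡.cong (coeff f) (S.solve 3 (λ k j m → k S.:+ (j S.:+ m) S.:- j S.:= k S.:+ m) ≡.refl k j (+ suc m)))))))
      where module S = +-*-Solver

  coeff-minus : ∀ p q k → coeff (p ++ (-ᴸ q)) k ≈ coeff p k - coeff q k
  coeff-minus p q k = trans (coeff-++ p (-ᴸ q) k) (+-congˡ (coeff-neg q k))

  cancel : ∀ p {f g} → Cancellable p → (p *ᴸ f) ≈ᴸ (p *ᴸ g) → f ≈ᴸ g
  cancel p {f} {g} can e k = begin
    coeff f k                                  ≈⟨ solve 2 (λ x y → x := (x :- y) :+ y) refl _ _ ⟩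
    coeff f k - coeff g k + coeff g k          ≈⟨ +-congʳ (trans (sym (coeff-minus f g k)) (can (f ++ (-ᴸ g)) difference k)) ⟩
    0# + coeff g k                             ≈⟨ +-identityˡ _ ⟩
    coeff g k                                  ∎
    where
    difference : (p *ᴸ (f ++ (-ᴸ g))) ≈ᴸ 0ᴸ
    difference k = begin
      coeff (p *ᴸ (f ++ (-ᴸ g))) k
        ≈⟨ proj₁ L.distrib p f (-ᴸ g) k ⟩
      coeff ((p *ᴸ f) ++ (p *ᴸ (-ᴸ g))) k
        ≈⟨ coeff-++ (p *ᴸ f) (p *ᴸ (-ᴸ g)) k ⟩
      coeff (p *ᴸ f) k + coeff (p *ᴸ (-ᴸ g)) k
        ≈⟨ +-cong (e k) (trans (sym (-‿distribʳ-*ᴸ p g k)) (coeff-neg (p *ᴸ g) k)) ⟩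
      coeff (p *ᴸ g) k - coeff (p *ᴸ g) k
        ≈⟨ -‿inverseʳ _ ⟩
      0# ∎
      where open import Algebra.Properties.Ring L.ring using () renaming (-‿distribʳ-* to -‿distribʳ-*ᴸ)

  coeff-T : ∀ i k → coeff (T i) k ≈ ι (indicator k i)
  coeff-T i k with i ℤ.≟ k
  ... | yes _ = trans (+-identityʳ 1#) (sym ι-1)
  ... | no _  = +-identityʳ 0#

  -- The factors are arbitrary representatives of monomials, because a power of `z` is a list that
  -- is merely equivalent to `T`. By T-multiplication each product of two of them contributes one
  -- indicator.
  coeff-wedge : ∀ {p₁ p₂ q₁ q₂ p₁′ p₂′ q₁′ q₂′} a₁ a₂ b₁ b₂ →
    p₁ ≈ᴸ T a₁ → p₂ ≈ᴸ T a₂ → q₁′ ≈ᴸ T (ℤ.- b₁) → q₂′ ≈ᴸ T (ℤ.- b₂) →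
    p₁′ ≈ᴸ T (ℤ.- a₁) → p₂′ ≈ᴸ T (ℤ.- a₂) → q₁ ≈ᴸ T b₁ → q₂ ≈ᴸ T b₂ → ∀ k →
    coeff (((p₁ ++ (-ᴸ p₂)) *ᴸ (q₁′ ++ (-ᴸ q₂′))) ++ (-ᴸ ((p₁′ ++ (-ᴸ p₂′)) *ᴸ (q₁ ++ (-ᴸ q₂))))) k ≈
    ι (oddWedge k a₁ a₂ b₁ b₂)
  coeff-wedge {p₁} {p₂} {q₁} {q₂} {p₁′} {p₂′} {q₁′} {q₂′} a₁ a₂ b₁ b₂ e₁ e₂ e₃ e₄ e₅ e₆ e₇ e₈ k = begin
    coeff (((p₁ ++ (-ᴸ p₂)) *ᴸ (q₁′ ++ (-ᴸ q₂′))) ++ (-ᴸ ((p₁′ ++ (-ᴸ p₂′)) *ᴸ (q₁ ++ (-ᴸ q₂))))) k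
      ≈⟨ coeff-minus ((p₁ ++ (-ᴸ p₂)) *ᴸ (q₁′ ++ (-ᴸ q₂′))) ((p₁′ ++ (-ᴸ p₂′)) *ᴸ (q₁ ++ (-ᴸ q₂))) k ⟩
    coeff ((p₁ ++ (-ᴸ p₂)) *ᴸ (q₁′ ++ (-ᴸ q₂′))) k - coeff ((p₁′ ++ (-ᴸ p₂′)) *ᴸ (q₁ ++ (-ᴸ q₂))) k
      ≈⟨ +-cong (product p₁ p₂ q₁′ q₂′ a₁ a₂ (ℤ.- b₁) (ℤ.- b₂) e₁ e₂ e₃ e₄)
                (-‿cong (product p₁′ p₂′ q₁ q₂ (ℤ.- a₁) (ℤ.- a₂) b₁ b₂ e₅ e₆ e₇ e₈)) ⟩
    ι (four a₁ a₂ (ℤ.- b₁) (ℤ.- b₂)) - ι (four (ℤ.- a₁) (ℤ.- a₂) b₁ b₂)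
      ≈⟨ trans (ι-+ (four a₁ a₂ (ℤ.- b₁) (ℤ.- b₂)) (ℤ.- four (ℤ.- a₁) (ℤ.- a₂) b₁ b₂)) (+-congˡ (ι-neg (four (ℤ.- a₁) (ℤ.- a₂) b₁ b₂))) ⟨
    ι (four a₁ a₂ (ℤ.- b₁) (ℤ.- b₂) ℤ.- four (ℤ.- a₁) (ℤ.- a₂) b₁ b₂)
      ≡⟨ ≡.cong ι regroup ⟩
    ι (oddWedge k a₁ a₂ b₁ b₂) ∎
    where
    open import Data.Integer.Solver using (module +-*-Solver)
    module S = +-*-Solver
    ind : ℤ → ℤ
    ind = indicator k
    four : ℤ → ℤ → ℤ → ℤ → ℤ
    four a a′ b b′ = ind (a ℤ.+ b) ℤ.- ind (a ℤ.+ b′) ℤ.- (ind (a′ ℤ.+ b) ℤ.- ind (a′ ℤ.+ b′))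
    ι-minus : ∀ i j → ι (i ℤ.- j) ≈ ι i - ι j
    ι-minus i j = trans (ι-+ i (ℤ.- j)) (+-congˡ (ι-neg j))
    term : ∀ p q a b → p ≈ᴸ T a → q ≈ᴸ T b → coeff (p *ᴸ q) k ≈ ι (ind (a ℤ.+ b))
    term p q a b e e′ = trans (*ᴸ-cong {p} {T a} {q} {T b} e e′ k) (trans (T-+ a b k) (coeff-T (a ℤ.+ b) k))
    product : ∀ p p′ q q′ a a′ b b′ → p ≈ᴸ T a → p′ ≈ᴸ T a′ → q ≈ᴸ T b → q′ ≈ᴸ T b′ →
              coeff ((p ++ (-ᴸ p′)) *ᴸ (q ++ (-ᴸ q′))) k ≈ ι (four a a′ b b′)
    product p p′ q q′ a a′ b b′ e₁ e₂ e₃ e₄ = begin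
      coeff ((p ++ (-ᴸ p′)) *ᴸ (q ++ (-ᴸ q′))) k
        ≈⟨ SL.solve 4 (λ p p′ q q′ → (p SL.:- p′) SL.:* (q SL.:- q′) SL.:= (p SL.:* q SL.:- p SL.:* q′) SL.:- (p′ SL.:* q SL.:- p′ SL.:* q′)) (λ _ → refl) p p′ q q′ k ⟩
      coeff (((p *ᴸ q) ++ (-ᴸ (p *ᴸ q′))) ++ (-ᴸ ((p′ *ᴸ q) ++ (-ᴸ (p′ *ᴸ q′))))) k
        ≈⟨ trans (coeff-minus ((p *ᴸ q) ++ (-ᴸ (p *ᴸ q′))) ((p′ *ᴸ q) ++ (-ᴸ (p′ *ᴸ q′))) k)
             (+-cong (coeff-minus (p *ᴸ q) (p *ᴸ q′) k) (-‿cong (coeff-minus (p′ *ᴸ q) (p′ *ᴸ q′) k))) ⟩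
      (coeff (p *ᴸ q) k - coeff (p *ᴸ q′) k) - (coeff (p′ *ᴸ q) k - coeff (p′ *ᴸ q′) k)
        ≈⟨ +-cong (+-cong (term p q a b e₁ e₃) (-‿cong (term p q′ a b′ e₁ e₄)))
                  (-‿cong (+-cong (term p′ q a′ b e₂ e₃) (-‿cong (term p′ q′ a′ b′ e₂ e₄)))) ⟩
      (ι (ind (a ℤ.+ b)) - ι (ind (a ℤ.+ b′))) - (ι (ind (a′ ℤ.+ b)) - ι (ind (a′ ℤ.+ b′)))
        ≈⟨ trans (ι-minus (ind (a ℤ.+ b) ℤ.- ind (a ℤ.+ b′)) (ind (a′ ℤ.+ b) ℤ.- ind (a′ ℤ.+ b′)))
             (+-cong (ι-minus (ind (a ℤ.+ b)) (ind (a ℤ.+ b′))) (-‿cong (ι-minus (ind (a′ ℤ.+ b)) (ind (a′ ℤ.+ b′))))) ⟨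
      ι (four a a′ b b′) ∎
    flip : ∀ a b → ℤ.- a ℤ.+ b ≡ ℤ.- (a ℤ.- b)
    flip = S.solve 2 (λ a b → S.:- a S.:+ b S.:= S.:- (a S.:- b)) ≡.refl
    regroup : four a₁ a₂ (ℤ.- b₁) (ℤ.- b₂) ℤ.- four (ℤ.- a₁) (ℤ.- a₂) b₁ b₂ ≡ oddWedge k a₁ a₂ b₁ b₂
    regroup rewrite flip a₁ b₁ | flip a₁ b₂ | flip a₂ b₁ | flip a₂ b₂ =
      S.solve 8 (λ x y z w x′ y′ z′ w′ → (x S.:- y S.:- (z S.:- w)) S.:- (x′ S.:- y′ S.:- (z′ S.:- w′)) S.:=
                  (x S.:- x′) S.:- (y S.:- y′) S.:- (z S.:- z′) S.:+ (w S.:- w′)) ≡.refl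
        (ind (a₁ ℤ.- b₁)) (ind (a₁ ℤ.- b₂)) (ind (a₂ ℤ.- b₁)) (ind (a₂ ℤ.- b₂))
        (ind (ℤ.- (a₁ ℤ.- b₁))) (ind (ℤ.- (a₁ ℤ.- b₂))) (ind (ℤ.- (a₂ ℤ.- b₁))) (ind (ℤ.- (a₂ ℤ.- b₂)))

-- The specialization over a field of characteristic 0 with a primitive root of unity.

module Specialization {c ℓ₁ ℓ₂} (K : HeytingField c ℓ₁ ℓ₂) (char0 : CharacteristicZero K) (t : ℕ) .{{t≢0 : NonZero t}}
                (ζ : HeytingField.Carrier K) (ζ-primitive : IsPrimitiveRoot K t ζ) where
  open import Defs
  open import Level using (_⊔_)
  open import Algebra.Bundles using (CommutativeRing)
  open import Data.Fin.Base as Fin using (Fin; toℕ)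
  import Data.Fin.Properties as Fin
  open import Data.Integer.Base as ℤ using (ℤ; +_; -[1+_]; _⊖_; 0ℤ; 1ℤ; -1ℤ)
  import Data.Integer.Properties as ℤ
  open import Data.Integer.Solver using (module +-*-Solver)
  open import Data.List.Base as List using (List; []; _∷_; _++_)
  open import Data.List.Relation.Binary.Permutation.Propositional using (_↭_)
  import Data.Nat.Base as ℕ
  open import Data.Nat.Base using (zero; suc)
  open import Data.Nat.Combinatorics using (_C_)
  import Data.Nat.Properties as ℕ
  open import Data.Product.Base using (Σ-syntax; _×_; _,_; proj₁; proj₂)
  open import Data.Vec.Base as Vec using (Vec; []; _∷_)
  open import Data.Vec.Relation.Unary.All using ([]; _∷_)
  import Data.Vec.Relation.Unary.All.Properties as VecAll
  open import Data.Vec.Relation.Unary.AllPairs using ([]; _∷_)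
  import Data.Vec.Relation.Unary.AllPairs.Properties as VecAllPairs
  open import Function.Base using (_∘_)
  open import Function.Bundles using (_⇔_; mk⇔)
  open import Relation.Binary.Definitions using (tri<; tri≈; tri>)
  open import Relation.Binary.PropositionalEquality.Core as ≡ using (_≡_; _≢_)
  open import Relation.Nullary.Decidable.Core using (Dec; yes; no)
  open import Relation.Nullary.Negation.Core using (¬_; contradiction)
  open HeytingField K using (_#_; #⇒invertible)
  open CommutativeRing (fieldRing K) hiding (zero)
  open import Algebra.Properties.Semiring.Exp semiring using (_^_; ^-congʳ; ^-congˡ; ^-homo-*; ^-assocʳ)
  open IntegerImage (fieldRing K)
  open Laurent (fieldRing K)
  open LaurentRing (fieldRing K)
  open Bialternant laurentRing using (vandermonde; vandermonde-closed)
  open IntegerImage laurentRing using () renaming (ι to ιᴸ)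
  open import Algebra.Definitions.RawSemiring laurentRawSemiring using () renaming (_^_ to _^ᴸ_)
  open RootsOfUnity laurentRing using (variables; minor; minor-closed; pairWedge; signOf; schur-value; schur-vanish)
  open Combinatorics using (module Columns)
  open SumMultisets
  open import Relation.Binary.Reasoning.Setoid setoid

  Unit : Carrier → Set (c ⊔ ℓ₁)
  Unit x = Σ[ u ∈ Carrier ] u * x ≈ 1#

  unit-# : ∀ {x} → x # 0# → Unit x
  unit-# {x} x#0 with u , ux≈1 , _ ← #⇒invertible x#0 =
    u , trans (*-congˡ (solve 1 (λ x → x := x :- con 0ℤ) refl x)) ux≈1

  unit-* : ∀ {x y} → Unit x → Unit y → Unit (x * y)
  unit-* {x} {y} (u , ux≈1) (v , vy≈1) = u * v ,
    trans (solve 4 (λ u v x y → u :* v :* (x :* y) := u :* x :* (v :* y)) refl u v x y)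
          (trans (*-cong ux≈1 vy≈1) (*-identityˡ 1#))

  unit-neg : ∀ {x} → Unit x → Unit (- x)
  unit-neg {x} (u , ux≈1) = - u , trans (solve 2 (λ u x → :- u :* :- x := u :* x) refl u x) ux≈1

  unit-≈ : ∀ {x y} → x ≈ y → Unit x → Unit y
  unit-≈ x≈y (u , ux≈1) = u , trans (*-congˡ (sym x≈y)) ux≈1

  unit-1 : Unit 1#
  unit-1 = 1# , *-identityˡ 1#

  unit-^ : ∀ {x} m → Unit x → Unit (x ^ m)
  unit-^ zero    ux = unit-1
  unit-^ (suc m) ux = unit-* ux (unit-^ m ux)

  unit-ι : ∀ {i} → i ≢ 0ℤ → Unit (ι i)
  unit-ι {+ zero}  i≢0 = contradiction ≡.refl i≢0
  unit-ι {+ suc n} _   = unit-# (char0 n)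
  unit-ι { -[1+ n ]} _ = unit-neg (unit-# (char0 n))

  -- The element `x` is only known not to be 0 and cannot be divided by. Instead the integers are
  -- compared: a nonzero difference is a unit in characteristic 0 and would force `x ≈ 0#`.
  ι-injective : ∀ {x i j} → ¬ x ≈ 0# → x * ι i ≈ x * ι j → i ≡ j
  ι-injective {x} {i} {j} x≉0 e with i ℤ.- j ℤ.≟ 0ℤ
  ... | yes i-j≡0 = ℤ.i-j≡0⇒i≡j i j i-j≡0
  ... | no i-j≢0 with u , u*≈1 ← unit-ι i-j≢0 = contradiction x≈0 x≉0
    where
    x≈0 : x ≈ 0#
    x≈0 = begin
      x                                 ≈⟨ *-identityʳ x ⟨
      x * 1#                            ≈⟨ *-congˡ u*≈1 ⟨
      x * (u * ι (i ℤ.- j))             ≈⟨ *-congˡ (*-congˡ (trans (ι-+ i (ℤ.- j)) (+-congˡ (ι-neg j)))) ⟩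
      x * (u * (ι i - ι j))             ≈⟨ solve 4 (λ x u a b → x :* (u :* (a :- b)) := u :* (x :* a :- x :* b)) refl x u (ι i) (ι j) ⟩
      u * (x * ι i - x * ι j)           ≈⟨ *-congˡ (trans (+-congʳ e) (-‿inverseʳ _)) ⟩
      u * 0#                            ≈⟨ zeroʳ u ⟩
      0#                                ∎

  open IsPrimitiveRoot ζ-primitive

  unit-ζ : Unit ζ
  unit-ζ = ζ ^ ℕ.pred t , (begin
    ζ ^ ℕ.pred t * ζ        ≈⟨ *-comm _ ζ ⟩
    ζ ^ suc (ℕ.pred t)      ≈⟨ ^-congʳ ζ (ℕ.suc-pred t) ⟩
    ζ ^ t                   ≈⟨ ζ^t≈1 ⟩
    1#                      ∎)

  -- The difference is ζⁱ (ζʲ⁻ⁱ - 1). Primitivity is given as apartness from 1, so the second factor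
  -- is invertible and not merely nonzero.
  unit-gap : ∀ {i j} → i ℕ.< j → j ℕ.< t → Unit (ζ ^ j - ζ ^ i)
  unit-gap {i} {j} i<j j<t = unit-≈ equal (unit-* (unit-^ i unit-ζ) unit-ζ^k-1)
    where
    k : ℕ
    k = j ℕ.∸ i
    unit-ζ^k-1 : Unit (ζ ^ k - 1#)
    unit-ζ^k-1 with u , e , _ ← #⇒invertible (ζ^k#1 k (ℕ.m<n⇒0<n∸m i<j) (ℕ.≤-<-trans (ℕ.m∸n≤m j i) j<t)) = u , e
    equal : ζ ^ i * (ζ ^ k - 1#) ≈ ζ ^ j - ζ ^ i
    equal = begin
      ζ ^ i * (ζ ^ k - 1#)           ≈⟨ trans (distribˡ _ _ _) (+-congˡ (sym (-‿distribʳ-* _ _))) ⟩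
      ζ ^ i * ζ ^ k - ζ ^ i * 1#     ≈⟨ +-cong (sym (^-homo-* ζ i k)) (-‿cong (*-identityʳ _)) ⟩
      ζ ^ (i ℕ.+ k) - ζ ^ i          ≈⟨ +-congʳ (^-congʳ ζ (ℕ.m+[n∸m]≡n (ℕ.<⇒≤ i<j))) ⟩
      ζ ^ j - ζ ^ i                  ∎

  unit-difference : ∀ {i j : Fin t} → i ≢ j → Unit (ζ ^ toℕ i - ζ ^ toℕ j)
  unit-difference {i} {j} i≢j with Fin.<-cmp i j
  ... | tri< i<j _ _ = unit-≈ (solve 2 (λ x y → :- (x :- y) := y :- x) refl _ _) (unit-neg (unit-gap i<j (Fin.toℕ<n j)))
  ... | tri≈ _ i≡j _ = contradiction i≡j i≢j
  ... | tri> _ _ j<i = unit-gap j<i (Fin.toℕ<n i)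

  root : Fin t → LaurentPoly
  root i = const (ζ ^ toℕ i)

  root^t≈1 : ∀ i → root i ^ᴸ t ≈ᴸ const 1#
  root^t≈1 i k = trans (const-^ (ζ ^ toℕ i) t k) (const-cong (begin
    (ζ ^ toℕ i) ^ t         ≈⟨ ^-assocʳ ζ (toℕ i) t ⟩
    ζ ^ (toℕ i ℕ.* t)       ≈⟨ ^-congʳ ζ (ℕ.*-comm (toℕ i) t) ⟩
    ζ ^ (t ℕ.* toℕ i)       ≈⟨ ^-assocʳ ζ t (toℕ i) ⟨
    (ζ ^ t) ^ toℕ i         ≈⟨ ^-congˡ (toℕ i) ζ^t≈1 ⟩
    1# ^ toℕ i              ≈⟨ RootsOfUnity.1^m≈1 (fieldRing K) (toℕ i) ⟩
    1#                      ∎) k)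

  vars : Vec LaurentPoly (t ℕ.+ 2)
  vars = variables t root root^t≈1 z z⁻¹

  v : LaurentPoly
  v = vandermonde vars

  -- The factors are differences of distinct powers of ζ, which are units, and the binomials ζⁱ - z,
  -- ζⁱ - z⁻¹ and z - z⁻¹, whose top coefficients are -1, ζⁱ and 1.
  v-cancellable : Cancellable v
  v-cancellable = vandermonde-closed Cancellable (cancellable-unit 1# (*-identityˡ 1#)) (λ p q → cancellable-* {p} {q})
    (VecAllPairs.++⁺ (VecAllPairs.tabulate⁺ root-root)
      -- The factor z - z⁻¹: its top exponent is -1 + 2.
      ((cancellable-binomial -1ℤ 1 1# (*-identityˡ 1#) ∷ []) ∷ [] ∷ [])
      (VecAll.tabulate⁺ (λ i → root-z (ζ ^ toℕ i) ∷ root-z⁻¹ i ∷ [])))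
    where
    root-root : ∀ {i j} → i ≢ j → Cancellable (root i ++ (-ᴸ root j))
    root-root {i} {j} i≢j with u , e ← unit-difference i≢j =
      cancellable-≈ {const (ζ ^ toℕ i - ζ ^ toℕ j)} {root i ++ (-ᴸ root j)} (const-+ (ζ ^ toℕ i) (- (ζ ^ toℕ j))) (cancellable-unit u e)
    root-z : ∀ a → Cancellable (const a ++ (-ᴸ z))
    -- The two terms are exchanged because `cancellable-binomial` expects the higher exponent first;
    -- the coefficient -1 is its own inverse.
    root-z a = cancellable-≈ {(1ℤ , - 1#) ∷ (0ℤ , a) ∷ []} {const a ++ (-ᴸ z)}
      (λ k → trans (coeff-++ ((1ℤ , - 1#) ∷ []) (const a) k) (trans (+-comm _ _) (sym (coeff-++ (const a) (-ᴸ z) k))))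
      (cancellable-binomial 0ℤ 0 (- 1#) (trans (solve 1 (λ x → :- x :* :- x := x :* x) refl 1#) (*-identityˡ 1#)))
    root-z⁻¹ : ∀ i → Cancellable (root i ++ (-ᴸ z⁻¹))
    root-z⁻¹ i with u , e ← unit-^ (toℕ i) unit-ζ = cancellable-binomial -1ℤ 0 u e

  minorᴸ : LaurentPoly
  minorᴸ = minor t root root^t≈1 z z⁻¹

  -- The entries are powers of roots, 0 and 1, all free of z. The factor common to all partitions is
  -- thus a scalar and can be compared coefficient by coefficient.
  minor-constant : IsConstant minorᴸ
  minor-constant = minor-closed t root root^t≈1 z z⁻¹ IsConstant
    (0# , λ k → sym (const-0 k))
    (1# , λ _ → refl)
    (λ {p} {q} (a , p≈) (b , q≈) → a + b , λ k → trans (coeff-++ p q k) (trans (+-cong (p≈ k) (q≈ k))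
      (trans (sym (coeff-++ (const a) (const b) k)) (sym (const-+ a b k)))))
    (λ {p} {q} (a , p≈) (b , q≈) → a * b , *ᴸ-cong {p} {const a} {q} {const b} p≈ q≈)
    (λ {p} (a , p≈) → - a , λ k → trans (coeff-neg p k) (trans (-‿cong (p≈ k)) (sym (coeff-neg (const a) k))))
    (λ i → ι i , ι-const i)
    (λ i → ζ ^ toℕ i , λ _ → refl)

  c₀ : Carrier
  c₀ = proj₁ minor-constant

  module _ (κ : Partition (t ℕ.+ 2)) where
    open Beta t κ
    open Columns t κ

    private
      b : Fin N → ℤ
      b j = + β j

    coeff-arranged : ∀ {a₁ a₂ b₁ b₂} → (∀ r → residueClass r ≢ []) → Arrangement a₁ a₂ b₁ b₂ → ∀ k →
      coeff (v *ᴸ Φ K t ζ κ) k ≈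
      c₀ * ι (signOf t root root^t≈1 z z⁻¹ κ a₁ b₁ ℤ.* oddWedge k (b a₁) (b a₂) (b b₁) (b b₂))
    coeff-arranged {a₁} {a₂} {b₁} {b₂} noEmpty arr k = begin
      coeff (v *ᴸ Φ K t ζ κ) k
        ≈⟨ schur-value t root root^t≈1 z z⁻¹ κ noEmpty (arranged arr) k ⟩
      coeff (ιᴸ n *ᴸ (minorᴸ *ᴸ w)) k
        ≈⟨ coeff-ι-* n (minorᴸ *ᴸ w) k ⟩
      ι n * coeff (minorᴸ *ᴸ w) k
        ≈⟨ *-congˡ (trans (*ᴸ-cong {minorᴸ} {const c₀} {w} {w} (proj₂ minor-constant) (λ _ → refl) k) (coeff-const-* c₀ w k)) ⟩
      ι n * (c₀ * coeff w k)
        ≈⟨ *-congˡ (*-congˡ (coeff-wedge {z ^ᴸ β a₁} {z ^ᴸ β a₂} {z ^ᴸ β b₁} {z ^ᴸ β b₂} {z⁻¹ ^ᴸ β a₁} {z⁻¹ ^ᴸ β a₂} {z⁻¹ ^ᴸ β b₁} {z⁻¹ ^ᴸ β b₂}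
             (b a₁) (b a₂) (b b₁) (b b₂)
             (z^ (β a₁)) (z^ (β a₂)) (z⁻¹^ (β b₁)) (z⁻¹^ (β b₂)) (z⁻¹^ (β a₁)) (z⁻¹^ (β a₂)) (z^ (β b₁)) (z^ (β b₂)) k)) ⟩
      ι n * (c₀ * ι W)
        ≈⟨ solve 3 (λ n c w → n :* (c :* w) := c :* (n :* w)) refl (ι n) c₀ (ι W) ⟩
      c₀ * (ι n * ι W)
        ≈⟨ *-congˡ (ι-* n W) ⟨
      c₀ * ι (n ℤ.* W) ∎
      where
      n : ℤ
      n = signOf t root root^t≈1 z z⁻¹ κ a₁ b₁
      w : LaurentPoly
      w = pairWedge t root root^t≈1 z z⁻¹ κ a₁ a₂ b₁ b₂
      W : ℤ
      W = oddWedge k (b a₁) (b a₂) (b b₁) (b b₂)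

    d̃₃-integer : ∀ a₁ a₂ b₁ b₂ → b a₁ ℤ.+ b a₂ ℤ.- (b b₁ ℤ.+ b b₂) ≡ d̃₃ a₁ a₂ b₁ b₂
    d̃₃-integer a₁ a₂ b₁ b₂ = ℤ.m-n≡m⊖n (β a₁ ℕ.+ β a₂) (β b₁ ℕ.+ β b₂)

    gap : ∀ {i j} → i Fin.< j → b i ℤ.- b j ≡ + (β i ℕ.∸ β j)
    gap {i} {j} i<j = ≡.trans (ℤ.m-n≡m⊖n (β i) (β j)) (ℤ.⊖-≥ (ℕ.<⇒≤ (β-decreasing i<j)))

    -- Emptiness of some class is decidable, and so a negative hypothesis yields the actual columns:
    -- an empty class, or d̃₃ = 0, would make the product with `v` vanish, and `v` cancels.
    defined : ¬ Φ K t ζ κ ≈ᴸ 0ᴸ → Defined t κ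
    defined Φ≉0 with Fin.any? {P = λ r → residueClass r ≡ []} (λ r → isEmpty? (residueClass r))
      where
      isEmpty? : (js : List (Fin N)) → Dec (js ≡ [])
      isEmpty? []      = yes ≡.refl
      isEmpty? (_ ∷ _) = no λ ()
    ... | yes (r , empty) = contradiction
      (v-cancellable (Φ K t ζ κ) (schur-vanish t root root^t≈1 z z⁻¹ κ empty)) Φ≉0
    ... | no noneEmpty with a₁ , a₂ , b₁ , b₂ , arr ← arrangement-exists (λ r e → noneEmpty (r , e))
      = record
        { noEmptyClass = noEmpty ; a₁ = a₁ ; a₂ = a₂ ; b₁ = b₁ ; b₂ = b₂ ; arrangement = arr
        ; d̃₃≢0 = λ d̃₃≡0 → Φ≉0 (v-cancellable (Φ K t ζ κ) (vanish d̃₃≡0)) }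
      where
      noEmpty : ∀ r → residueClass r ≢ []
      noEmpty r e = noneEmpty (r , e)
      open Arranged (arranged arr)
      vanish : d̃₃ a₁ a₂ b₁ b₂ ≡ 0ℤ → (v *ᴸ Φ K t ζ κ) ≈ᴸ 0ᴸ
      vanish d̃₃≡0 k = trans (coeff-arranged noEmpty arr k) (trans (*-congˡ (ι-cong (≡.trans
        (≡.cong (signOf t root root^t≈1 z z⁻¹ κ a₁ b₁ ℤ.*_)
          (oddWedge-zero (b a₁) (b a₂) (b b₁) (b b₂) (≡.trans (d̃₃-integer a₁ a₂ b₁ b₂) d̃₃≡0) k))
        (ℤ.*-zeroʳ (signOf t root root^t≈1 z z⁻¹ κ a₁ b₁))))) (zeroʳ c₀))

  -- The part of ε that depends on t only.
  τ : ℤ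
  τ = -1ℤ ℤ.^ (t ℕ.+ suc (t ℕ.+ 2) C 2)

  power-square : ∀ m → (-1ℤ ℤ.^ m) ℤ.* (-1ℤ ℤ.^ m) ≡ 1ℤ
  power-square zero    = ≡.refl
  power-square (suc m) = ≡.trans (square (-1ℤ ℤ.^ m)) (power-square m)
    where
    module S = +-*-Solver
    square : ∀ x → (-1ℤ ℤ.* x) ℤ.* (-1ℤ ℤ.* x) ≡ x ℤ.* x
    square = S.solve 1 (λ x → (S.con -1ℤ S.:* x) S.:* (S.con -1ℤ S.:* x) S.:= x S.:* x) ≡.refl

  -- The determinant does not produce the sign `τ` of ε. Since `τ` squares to 1, one copy completes
  -- ε and the other goes into the common constant.
  c₁ : Carrier
  c₁ = c₀ * ι τ

  module Value {κ : Partition (t ℕ.+ 2)} (D : Defined t κ) where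
    open Beta t κ
    open Columns t κ
    open Defined D
    open Arranged (arranged arrangement)
    open Center (findCenter {+ β a₁} {+ β a₂} {+ β b₁} {+ β b₂} (d̃₃ a₁ a₂ b₁ b₂) (gap κ a₁<a₂) (gap κ b₁<b₂) (d̃₃-integer κ a₁ a₂ b₁ b₂) d̃₃≢0) public

    d₁>0 : 0 ℕ.< d₁
    d₁>0 = ℕ.m<n⇒0<n∸m (β-decreasing a₁<a₂)

    d₂>0 : 0 ℕ.< d₂
    d₂>0 = ℕ.m<n⇒0<n∸m (β-decreasing b₁<b₂)

    d₃>0 : 0 ℕ.< d₃
    d₃>0 = ℕ.n≢0⇒n>0 (d̃₃≢0 ∘ ℤ.∣i∣≡0⇒i≡0)

    -- Counting columns from 1 instead of 0 changes two signs, which cancel; the minus sign of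
    -- `signOf` meets the one in front of `sgn` of d̃₃; and `τ` occurs twice on the right.
    sign-ε : ∀ x → signOf t root root^t≈1 z z⁻¹ κ a₁ b₁ ℤ.* (ℤ.- sgn (d̃₃ a₁ a₂ b₁ b₂) ℤ.* x) ≡ τ ℤ.* (ε ℤ.* x)
    sign-ε x = ≡.sym (≡.trans (≡.cong (λ p → τ ℤ.* (τ ℤ.* p ℤ.* g₁ ℤ.* g₂ ℤ.* x)) split) (≡.trans
      (S.solve 7 (λ τ a b i g₁ g₂ x →
        τ S.:* (τ S.:* ((S.con -1ℤ S.:* a) S.:* (S.con -1ℤ S.:* b) S.:* i) S.:* g₁ S.:* g₂ S.:* x) S.:=
        (τ S.:* τ) S.:* (a S.:* b S.:* (S.:- g₁) S.:* i S.:* ((S.:- g₂) S.:* x)))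
        ≡.refl τ (power (toℕ a₁)) (power (toℕ b₁)) (power i) g₁ g₂ x)
      (≡.trans (≡.cong (ℤ._* y) (power-square (t ℕ.+ suc (t ℕ.+ 2) C 2))) (ℤ.*-identityˡ y))))
      where
      module S = +-*-Solver
      power : ℕ → ℤ
      power m = -1ℤ ℤ.^ m
      i : ℕ
      i = inversions (wordS a₁ b₁)
      g₁ g₂ y : ℤ
      g₁ = sgn (β a₁ ⊖ β b₁)
      g₂ = sgn (d̃₃ a₁ a₂ b₁ b₂)
      y = signOf t root root^t≈1 z z⁻¹ κ a₁ b₁ ℤ.* (ℤ.- g₂ ℤ.* x)
      split : power (column a₁ ℕ.+ column b₁ ℕ.+ i) ≡ power (column a₁) ℤ.* power (column b₁) ℤ.* power i
      split = ≡.trans (ℤ.^-distribˡ-+-* -1ℤ (column a₁ ℕ.+ column b₁) i)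
        (≡.cong (ℤ._* power i) (ℤ.^-distribˡ-+-* -1ℤ (column a₁) (column b₁)))

    coeff-value : ∀ k → coeff (v *ᴸ Φ K t ζ κ) k ≈ c₁ * ι (ε ℤ.* profile k center triple)
    coeff-value k = begin
      coeff (v *ᴸ Φ K t ζ κ) k
        ≈⟨ coeff-arranged κ noEmptyClass arrangement k ⟩
      c₀ * ι (n ℤ.* oddWedge k (+ β a₁) (+ β a₂) (+ β b₁) (+ β b₂))
        ≡⟨ ≡.cong (λ w → c₀ * ι w) (≡.trans (≡.cong (n ℤ.*_) (value k)) (sign-ε (profile k center triple))) ⟩
      c₀ * ι (τ ℤ.* (ε ℤ.* profile k center triple))
        ≈⟨ *-congˡ (ι-* τ (ε ℤ.* profile k center triple)) ⟩
      c₀ * (ι τ * ι (ε ℤ.* profile k center triple))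
        ≈⟨ *-assoc _ _ _ ⟨
      c₁ * ι (ε ℤ.* profile k center triple) ∎
      where
      n : ℤ
      n = signOf t root root^t≈1 z z⁻¹ κ a₁ b₁

    -- The nonvanishing of the common constant is drawn from a single partition with nonzero Φ.
    c₁≉0 : ¬ Φ K t ζ κ ≈ᴸ 0ᴸ → ¬ c₁ ≈ 0#
    c₁≉0 Φ≉0 c₁≈0 = Φ≉0 (v-cancellable (Φ K t ζ κ) (λ k → trans (coeff-value k) (trans (*-congʳ c₁≈0) (zeroˡ _))))

    ε≢0 : ¬ Φ K t ζ κ ≈ᴸ 0ᴸ → ε ≢ 0ℤ
    ε≢0 Φ≉0 ε≡0 = Φ≉0 (v-cancellable (Φ K t ζ κ) (λ k → trans (coeff-value k)
      (trans (*-congˡ (ι-cong (≡.cong (ℤ._* profile k center triple) ε≡0))) (zeroʳ c₁))))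

  equal⇔ : ∀ {lam mu} (Dlam : Defined t lam) → ¬ Φ K t ζ lam ≈ᴸ 0ᴸ →
    (Φ K t ζ lam ≈ᴸ Φ K t ζ mu) ⇔
    (Σ[ Dmu ∈ Defined t mu ] (Defined.triple Dlam ↭ Defined.triple Dmu × Defined.ε Dlam ≡ Defined.ε Dmu))
  equal⇔ {lam} {mu} Dlam Φlam≉0 = mk⇔ forward backward
    where
    module A = Value Dlam
    forward : Φ K t ζ lam ≈ᴸ Φ K t ζ mu →
      Σ[ Dmu ∈ Defined t mu ] (Defined.triple Dlam ↭ Defined.triple Dmu × Defined.ε Dlam ≡ Defined.ε Dmu)
    -- The common constant is dropped by `ι-injective`, which leaves an equation of integers for
    -- each exponent.
    forward Φ≈ = Dmu , profile-unique {A.center} {B.center} A.half B.half A.d₁>0 A.d₂>0 A.d₃>0 B.d₁>0 B.d₂>0 B.d₃>0 (A.ε≢0 Φlam≉0) (B.ε≢0 Φmu≉0)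
      (λ k → ι-injective (A.c₁≉0 Φlam≉0) (trans (sym (A.coeff-value k))
        (trans (*ᴸ-cong {v} {v} {Φ K t ζ lam} {Φ K t ζ mu} (λ _ → refl) Φ≈ k) (B.coeff-value k))))
      where
      Φmu≉0 : ¬ Φ K t ζ mu ≈ᴸ 0ᴸ
      Φmu≉0 Φmu≈0 = Φlam≉0 (λ k → trans (Φ≈ k) (Φmu≈0 k))
      Dmu : Defined t mu
      Dmu = defined mu Φmu≉0
      module B = Value Dmu
    backward : Σ[ Dmu ∈ Defined t mu ] (Defined.triple Dlam ↭ Defined.triple Dmu × Defined.ε Dlam ≡ Defined.ε Dmu) →
      Φ K t ζ lam ≈ᴸ Φ K t ζ mu
    -- Twice the center is the sum of the triple, so permuted triples have the same center, and the
    -- products with `v` agree coefficientwise.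
    backward (Dmu , triple↭ , ε≡) = cancel v v-cancellable (λ k → trans (A.coeff-value k)
      (trans (*-congˡ (ι-cong (≡.cong₂ ℤ._*_ ε≡ (≡.trans (profile-↭ k A.center triple↭)
        (≡.cong (λ M → profile k M (Defined.triple Dmu)) {A.center} {B.center} (halfSum-↭ {A.center} {B.center} A.half B.half triple↭))))))
        (sym (B.coeff-value k))))
      where module B = Value Dmu

open import Defs
open import Algebra.Apartness.Bundles using (HeytingField)
open import Data.List.Relation.Binary.Permutation.Propositional using (_↭_)
open import Data.Nat.Base using (ℕ; _+_; _≤_; NonZero)
open import Data.Product.Base using (Σ-syntax; _×_; _,_)
open import Function.Bundles using (_⇔_)
open import Relation.Binary.PropositionalEquality.Core using (_≡_)
open import Relation.Nullary.Negation.Core using (¬_)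

proposition3p10 : ∀ {c ℓ₁ ℓ₂} (K : HeytingField c ℓ₁ ℓ₂) → CharacteristicZero K →
    (t : ℕ) .{{_ : NonZero t}} → 2 ≤ t →
    (ζ : HeytingField.Carrier K) → IsPrimitiveRoot K t ζ →
    (lam mu : Partition (t + 2)) →
    ¬ Laurent._≈ᴸ_ (fieldRing K) (Φ K t ζ lam) (Laurent.0ᴸ (fieldRing K)) →
    Σ[ Dlam ∈ Defined t lam ]
    (Laurent._≈ᴸ_ (fieldRing K) (Φ K t ζ lam) (Φ K t ζ mu)
    ⇔ (Σ[ Dmu ∈ Defined t mu ]
    (Defined.triple Dlam ↭ Defined.triple Dmu
    × Defined.ε Dlam ≡ Defined.ε Dmu)))
proposition3p10 K char0 t 2≤t ζ ζ-primitive lam mu Φlam≉0 = Dlam , equal⇔ Dlam Φlam≉0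
  where
  open Specialization K char0 t ζ ζ-primitive
  Dlam = defined lam Φlam≉0
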